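{- Let $n\ge 3$ and consider the affine Weyl group $W_{\mathrm{aff}}$ of type $A_{n-1}^{(1)}$. Let $\alpha\in\Pi_{\mathrm{aff}}^{\mathrm{re},+}$ with $\alpha<c$, and let $$\Pi_{\mathrm{aff}}^{\mathrm{re},+}(\alpha)=\{\beta'\in\Pi_{\mathrm{aff}}^{\mathrm{re},+}:\ \beta'<c,\ \text{and either } \beta'\le c-\alpha,\ \text{or both } \beta'>\alpha \text{ and } \beta'\perp\alpha\}.$$ Then: (1) $\Gamma_{c+\alpha}(id)=\{t_{\beta'}s_\alpha:\beta'\in\Pi_{\mathrm{aff}}^{\mathrm{re},+}(\alpha),\ \alpha_0\notin\operatorname{supp}(\beta')\}\cup\{t_{\beta'-c}s_\alpha:\beta'\in\Pi_{\mathrm{aff}}^{\mathrm{re},+}(\alpha),\ \alpha_0\in\operatorname{supp}(\beta')\}$; (2) $|\Gamma_{c+\alpha}(id)|=|\Pi_{\mathrm{aff}}^{\mathrm{re},+}(\alpha)|$; (3) $\ell(w)=2(n-1)+\ell(s_\alpha)$ for all $w\in\Gamma_{c+\alpha}(id)$.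
   Context: Roots. Let $n\ge 3$. Let $\alpha_0,\dots,\alpha_{n-1}$ (indices mod $n$) be the affine simple roots of type $A_{n-1}^{(1)}$, $Q_{\mathrm{aff}}=\bigoplus_{i=0}^{n-1}\mathbb Z\alpha_i$, with symmetric form $\langle\alpha_i,\alpha_i\rangle=2$, $\langle\alpha_i,\alpha_{i\pm1}\rangle=-1$, all other $\langle\alpha_i,\alpha_j\rangle=0$; $\perp$ refers to this form. For $a,b\in Q_{\mathrm{aff}}$, $a\le b$ means $b-a$ has non-negative coefficients, and $a<b$ means $a\le b$, $a\ne b$. Put $c=\sum_{i=0}^{n-1}\alpha_i$ (identified with the imaginary root $\delta$). Let $\Pi=\Pi^+\sqcup\Pi^-$ be the finite root system of type $A_{n-1}$ with simple roots $\alpha_1,\dots,\alpha_{n-1}$. The affine real roots are $\alpha+mc$ with $\alpha\in\Pi$, $m\in\mathbb Z$; such a root is positive if $m>0$, or $m=0$ and $\alpha\in\Pi^+$. The set of positive real roots is $\Pi_{\mathrm{aff}}^{\mathrm{re},+}$. For $\alpha=\sum a_i\alpha_i$, $\operatorname{supp}(\alpha)=\{\alpha_i:a_i\ne0\}$. Weyl group. For a real root $\alpha$, $s_\alpha(\mu)=\mu-\langle\mu,\alpha\rangle\alpha$. $W_{\mathrm{aff}}$ is the group generated by $s_i=s_{\alpha_i}$, $0\le i\le n-1$ (a Coxeter group with these generators), with length $\ell$ and Bruhat order $\le$. One has $W_{\mathrm{aff}}=W\ltimes Q$, where $W=\langle s_1,\dots,s_{n-1}\rangle$ and $Q=\bigoplus_{i=1}^{n-1}\mathbb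 Z\alpha_i$ (root and coroot lattices identified); $t_\mu$ denotes the image of $\mu\in Q$, with $s_{\alpha+mc}=s_\alpha t_{m\alpha}$ for $\alpha\in\Pi$, $m\in\mathbb Z$ (so $t_\mu(\nu)=\nu-\langle\mu,\nu\rangle c$). For a positive real root $\beta'<c$: $\beta'\in Q$ if $\alpha_0\notin\operatorname{supp}(\beta')$, and $\beta'-c\in Q$ if $\alpha_0\in\operatorname{supp}(\beta')$. Curve neighborhoods. The moment graph has vertex set $W_{\mathrm{aff}}$ and an edge $u\stackrel{\alpha}{\longrightarrow}us_\alpha$ of degree $\alpha$ for each $u\in W_{\mathrm{aff}}$, $\alpha\in\Pi_{\mathrm{aff}}^{\mathrm{re},+}$. The degree of a chain (a succession of adjacent edges, possibly empty) is the sum of the degrees of its edges. A degree is a tuple $\mathbf d=(d_0,\dots,d_{n-1})\in\mathbb Z_{\ge0}^n$, identified with $\sum d_i\alpha_i$; degrees are ordered componentwise. For $u\in W_{\mathrm{aff}}$, $\Gamma_{\mathbf d}(u)$ is the set of Bruhat-maximal elements of the set of all $v\in W_{\mathrm{aff}}$ that can be joined to some $u'\le u$ by a chain of degree $\le\mathbf d$. -}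

module Defs where

open import Data.Bool.Base using (if_then_else_; _∧_)
open import Data.Fin.Base using (Fin; toℕ; fromℕ<)
import Data.Fin.Properties as Fin
open import Data.Integer.Base as ℤ using (ℤ; 0ℤ; 1ℤ; +_)
import Data.Integer.Properties as ℤ
open import Data.List.Base using (List; []; _∷_; length)
open import Data.Nat.Base as ℕ using (ℕ; NonZero; >-nonZero; s≤s; z≤n)
open import Data.Nat.DivMod using (_mod_)
import Data.Nat.Properties as ℕ
open import Data.Product.Base using (Σ; ∃; ∃₂; _×_; proj₁)
open import Data.Sum.Base using (_⊎_)
open import Data.Vec.Base using (Vec; lookup; map; replicate; tabulate; zipWith)
open import Function.Base using (id; _∘_)
open import Level using (0ℓ)
open import Relation.Binary.Bundles using (Setoid)
import Relation.Binary.Construct.On as On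
open import Relation.Binary.PropositionalEquality
  using (_≡_; _≢_; _≗_; setoid; _→-setoid_)
open import Relation.Nullary.Decidable using (⌊_⌋)
open import Relation.Unary using (Pred; _∈_)

open import Algebra.Properties.Semiring.Sum ℤ.+-*-semiring using (sum-syntax)

-- A subset of a setoid, with the equality of the ambient setoid.
subset : (S : Setoid 0ℓ 0ℓ) → Pred (Setoid.Carrier S) 0ℓ → Setoid 0ℓ 0ℓ
subset S P = On.setoid {B = ∃ P} S proj₁

-- Type A⁽¹⁾_{n-1}.
module Affine (n : ℕ) (n≥3 : 3 ℕ.≤ n) where

  private instance
    n≢0 : NonZero n
    n≢0 = >-nonZero (ℕ.≤-trans (s≤s z≤n) n≥3)

  0ᵢ : Fin n
  0ᵢ = fromℕ< (ℕ.≤-trans (s≤s z≤n) n≥3)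

  next : Fin n → Fin n
  next i = ℕ.suc (toℕ i) mod n

  -- The element Σ aᵢ αᵢ is the vector of its coefficients (a₀ , … , aₙ₋₁).
  -- Degrees are the vectors with non-negative entries.
  Qaff : Set
  Qaff = Vec ℤ n

  infixl 6 _⊕_ _⊖_
  infixl 7 _·_
  infix  4 _≤Q_ _<Q_ _⊥_

  𝟎 : Qaff
  𝟎 = replicate n 0ℤ

  _⊕_ _⊖_ : Qaff → Qaff → Qaff
  _⊕_ = zipWith ℤ._+_
  _⊖_ = zipWith ℤ._-_

  _·_ : ℤ → Qaff → Qaff
  k · μ = map (k ℤ.*_) μ

  α[_] : Fin n → Qaff
  α[ i ] = tabulate λ j → if ⌊ i Fin.≟ j ⌋ then 1ℤ else 0ℤ

  c : Qaff
  c = replicate n 1ℤ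

  cartan : Fin n → Fin n → ℤ
  cartan i j =
    if ⌊ i Fin.≟ j ⌋ then + 2 else
    if ⌊ j Fin.≟ next i ⌋ then ℤ.-1ℤ else
    if ⌊ i Fin.≟ next j ⌋ then ℤ.-1ℤ else 0ℤ

  ⟨_,_⟩ : Qaff → Qaff → ℤ
  ⟨ μ , ν ⟩ = ∑[ i < n ] ∑[ j < n ] (lookup μ i ℤ.* cartan i j ℤ.* lookup ν j)

  _⊥_ : Qaff → Qaff → Set
  μ ⊥ ν = ⟨ μ , ν ⟩ ≡ 0ℤ

  _≤Q_ _<Q_ : Qaff → Qaff → Set
  a ≤Q b = ∀ i → lookup a i ℤ.≤ lookup b i
  a <Q b = a ≤Q b × a ≢ b

  supp : Qaff → Pred (Fin n) 0ℓ
  supp a i = lookup a i ≢ 0ℤ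

  -- α_a + α_{a+1} + … + α_b
  interval : Fin n → Fin n → Qaff
  interval a b = tabulate λ i →
    if ⌊ toℕ a ℕ.≤? toℕ i ⌋ ∧ ⌊ toℕ i ℕ.≤? toℕ b ⌋ then 1ℤ else 0ℤ

  -- The finite root system of type A_{n-1}: its positive roots are the
  -- α_a + … + α_b with 1 ≤ a ≤ b ≤ n - 1.
  Π⁺ Π⁻ Π : Pred Qaff 0ℓ
  Π⁺ γ = ∃₂ λ a b → 1 ℕ.≤ toℕ a × toℕ a ℕ.≤ toℕ b × γ ≡ interval a b
  Π⁻ γ = Π⁺ (𝟎 ⊖ γ)
  Π  γ = Π⁺ γ ⊎ Π⁻ γ

  Πre⁺ : Pred Qaff 0ℓ
  Πre⁺ β = ∃₂ λ γ m → Π γ × β ≡ γ ⊕ m · c × (0ℤ ℤ.< m ⊎ (m ≡ 0ℤ × Π⁺ γ))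

  -- The affine Weyl group acts faithfully on Qaff.  It is taken to be the
  -- group of transformations of Qaff generated by the simple reflections,
  -- with pointwise equality _≗_; since these are involutions, its elements
  -- are the products of words in them.
  Endo : Set
  Endo = Qaff → Qaff

  refl[_] : Qaff → Endo
  refl[ α ] μ = μ ⊖ ⟨ μ , α ⟩ · α

  ⟦_⟧ : List (Fin n) → Endo
  ⟦ [] ⟧     = id
  ⟦ i ∷ is ⟧ = refl[ α[ i ] ] ∘ ⟦ is ⟧

  Waff : Pred Endo 0ℓ
  Waff w = ∃ λ is → w ≗ ⟦ is ⟧

  -- t_μ, for μ in the finite root lattice Q (no α₀-component).
  t[_] : Qaff → Endo
  t[ μ ] ν = ν ⊖ ⟨ μ , ν ⟩ · c

  -- ℓ(w) = k; there is no such k if w lies outside Waff.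
  HasLength : Endo → ℕ → Set
  HasLength w k =
    (∃ λ is → w ≗ ⟦ is ⟧ × length is ≡ k) ×
    (∀ is → w ≗ ⟦ is ⟧ → k ℕ.≤ length is)

  -- Bruhat order: generated by u < u s_β whenever ℓ(u) < ℓ(u s_β), for β a
  -- positive real root (the s_β are exactly the reflections of Waff).
  infix 4 _≤B_
  data _≤B_ (u : Endo) : Endo → Set where
    equal : ∀ {v} → u ≗ v → u ≤B v
    step  : ∀ {v w β k l} → u ≤B v → β ∈ Πre⁺ → w ≗ v ∘ refl[ β ] →
            HasLength v k → HasLength w l → k ℕ.< l → u ≤B w

  -- Chains in the moment graph; starting at u ∈ Waff, all vertices lie in Waff.
  data Chain (u : Endo) : Endo → Set where
    empty : ∀ {v} → u ≗ v → Chain u v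
    edge  : ∀ {v w} → Chain u v → ∀ α → α ∈ Πre⁺ → w ≗ v ∘ refl[ α ] → Chain u w

  degree : ∀ {u v} → Chain u v → Qaff
  degree (empty _)      = 𝟎
  degree (edge p α _ _) = degree p ⊕ α

  Reachable : Qaff → Endo → Pred Endo 0ℓ
  Reachable d u v = v ∈ Waff ×
    ∃ λ u′ → u′ ∈ Waff × u′ ≤B u × Σ (Chain u′ v) λ p → degree p ≤Q d

  -- The curve neighborhood Γ_d(u), for u ∈ Waff.
  Γ : Qaff → Endo → Pred Endo 0ℓ
  Γ d u v = v ∈ Reachable d u ×
    (∀ v′ → v′ ∈ Reachable d u → v ≤B v′ → v ≗ v′)

  Πre⁺[_] : Qaff → Pred Qaff 0ℓ
  Πre⁺[ α ] β′ = β′ ∈ Πre⁺ × β′ <Q c × (β′ ≤Q c ⊖ α ⊎ (α <Q β′ × β′ ⊥ α))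

  ΓSetoid : Qaff → Endo → Setoid 0ℓ 0ℓ
  ΓSetoid d u = subset (Qaff →-setoid Qaff) (Γ d u)

  Πre⁺Setoid : Qaff → Setoid 0ℓ 0ℓ
  Πre⁺Setoid α = subset (setoid Qaff) Πre⁺[ α ]

{-# OPTIONS --safe #-}

-- Waff acts on the simple roots through affine permutations σ of ℤ: write
-- α_i = ε_i - ε_{i+1} with indices in ℤ and ε_{i+n} = ε_i - c; then w sends
-- ε_i - ε_j to ε_{σ i} - ε_{σ j}, and right multiplication by the reflection in
-- ε_a - ε_b exchanges the values of σ at a and b.  The flow of σ at k is the
-- number of a ≤ k with σ a > k; a chain of degree d ending in σ forces
-- flow σ ≤ d.  If flow σ ≤ c + α, then either some exchange moves σ up in the
-- Bruhat order and keeps that bound, or the flow equals c + α everywhere and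
-- every class other than those of the two ends of α is preserved, which forces
-- σ to be t_β′ s_α with β′ as in the theorem.  Conversely all these elements are
-- reached by a chain of degree c + α and have the same length, so that none lies
-- strictly below another reachable element.

module Submission where

open import Defs
open import Algebra.Properties.CommutativeSemigroup using (x∙yz≈y∙xz; interchange)
open import Data.Bool.Base using (Bool; true; false; _∧_; _∨_; T; if_then_else_)
open import Data.Bool.Properties using (T-∧; T-∨)
open import Data.Empty using (⊥-elim)
open import Data.Fin.Base as Fin using (Fin; zero; suc; toℕ; fromℕ<)
import Data.Fin.Properties as Fin
open import Data.Integer.Base as ℤ using (ℤ; 0ℤ; 1ℤ; -1ℤ; +_; -[1+_])
import Data.Integer.DivMod as ℤ
import Data.Integer.Properties as ℤ
open import Data.List.Base using (List; []; _∷_; _++_; map; foldr; length)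
import Data.List.Properties as List
open import Data.Nat.Base as ℕ using (ℕ; zero; suc; NonZero; >-nonZero; s≤s; z≤n)
import Data.Nat.DivMod as ℕ
import Data.Nat.Properties as ℕ
open import Data.Product.Base using (∃; ∃₂; ∃-syntax; _×_; _,_; proj₁; proj₂)
open import Data.Sum.Base using (_⊎_; inj₁; inj₂)
open import Data.Unit.Base using (⊤)
open import Data.Vec.Base using (lookup; tabulate)
open import Data.Vec.N-ary using (N-ary)
import Data.Vec.Properties as Vec
open import Function.Base using (id; _∘_)
open import Function.Bundles using (Bijection; Equivalence; _⇔_; mk⇔)
open import Relation.Binary.Definitions using (Tri; tri<; tri≈; tri>)
open import Relation.Binary.PropositionalEquality
open import Relation.Nullary.Decidable using (Dec; yes; no; does; map′; ⌊_⌋)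
open import Relation.Nullary.Negation using (¬_; contradiction)
open import Relation.Unary using (_∈_; _∉_)

open import Algebra.Properties.Semiring.Sum ℤ.+-*-semiring
  using (sum; sum-syntax; sum-cong-≗; ∑-distrib-+; ∑-comm; *-distribˡ-sum; *-distribʳ-sum)

-- Lengths are minimal word lengths, and two facts about them carry the proof: an exchange that puts
-- two values out of order lengthens, and if the values are adjacent it lengthens by exactly one.
-- The climb therefore has a measure of its own, Σ (σ i - i)², which grows with every exchange and
-- stays bounded because flow at most 2 limits each jump to 2n. Write α = ε_p - ε_q with p < q < p +
-- n. Since c + α has only the coefficients 1 and 2, a point with slack leads to a local minimum of
-- the flow with slack, where an exchange adds 1 to the flow at that point alone. Once the bound is
-- attained, the flow changes only at p and q; every other class is preserved or takes part in an
-- exchange that leaves the flow as it is. α has coefficient 0 at α_q, so just one jump passes q in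
-- each direction: σ s_α raises one class x by n and lowers one class y by n. Exchanges that remain
-- possible confine x to [q , p + n) and y to (q , p + n]. Here x < y amounts to β′ ≤ c - α, and y <
-- x to β′ > α with β′ ⊥ α. The degree c pays for the translation, a product of two reflections
-- whose roots add up to c.

-- Reflective linear arithmetic over the integers.

module LinearArithmetic where

  open import Data.Empty using (⊥)
  open import Data.Integer.Base using (_+_; _-_; _*_; -_; _<_; _≤_)

  infixl 7 _:+_ _:-_
  infixl 8 _:*_
  infix  6 _:≤_ _:<_ _:≡_
  infix  5 _⊢_ ⊢_
  infixr 4 _,_

  data Expr : Set where
    var           : ℕ → Expr
    #_ -#_        : ℕ → Expr
    _:+_ _:-_ _:*_ : Expr → Expr → Expr
    neg           : Expr → Expr

  data Rel : Set where
    _:≤_ _:<_ _:≡_ : Expr → Expr → Rel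
    :⊥             : Rel

  data Sequent : Set where
    ⊢_  : Rel → Sequent
    _⊢_ : Rel → Rel → Sequent
    _,_ : Rel → Sequent → Sequent

  hypotheses : Sequent → List Rel
  hypotheses (⊢ g)   = []
  hypotheses (h ⊢ g) = h ∷ []
  hypotheses (h , s) = h ∷ hypotheses s

  goal : Sequent → Rel
  goal (⊢ g)   = g
  goal (h ⊢ g) = g
  goal (h , s) = goal s

  module _ (ρ : ℕ → ℤ) where

    ⟦_⟧ₑ : Expr → ℤ
    ⟦ var i ⟧ₑ  = ρ i
    ⟦ # k ⟧ₑ    = + k
    ⟦ -# k ⟧ₑ   = - + k
    ⟦ a :+ b ⟧ₑ = ⟦ a ⟧ₑ + ⟦ b ⟧ₑ
    ⟦ a :- b ⟧ₑ = ⟦ a ⟧ₑ - ⟦ b ⟧ₑ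
    ⟦ neg a ⟧ₑ  = - ⟦ a ⟧ₑ
    ⟦ a :* b ⟧ₑ = ⟦ a ⟧ₑ * ⟦ b ⟧ₑ

    ⟦_⟧ᵣ : Rel → Set
    ⟦ a :≤ b ⟧ᵣ = ⟦ a ⟧ₑ ≤ ⟦ b ⟧ₑ
    ⟦ a :< b ⟧ᵣ = ⟦ a ⟧ₑ < ⟦ b ⟧ₑ
    ⟦ a :≡ b ⟧ᵣ = ⟦ a ⟧ₑ ≡ ⟦ b ⟧ₑ
    ⟦ :⊥ ⟧ᵣ     = ⊥

    ⟦_⟧ₛ : Sequent → Set
    ⟦ ⊢ g ⟧ₛ   = ⟦ g ⟧ᵣ
    ⟦ h ⊢ g ⟧ₛ = ⟦ h ⟧ᵣ → ⟦ g ⟧ᵣ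
    ⟦ h , s ⟧ₛ = ⟦ h ⟧ᵣ → ⟦ s ⟧ₛ

  Monomial Poly : Set
  Monomial = List ℕ
  Poly = List (ℤ × Monomial)

  insert : ℕ → Monomial → Monomial
  insert i [] = i ∷ []
  insert i (j ∷ m) with i ℕ.≤ᵇ j
  ... | true  = i ∷ j ∷ m
  ... | false = j ∷ insert i m

  _*ₘ_ : Monomial → Monomial → Monomial
  m *ₘ m′ = foldr insert m′ m

  addTerm : ℤ × Monomial → Poly → Poly
  addTerm t [] = t ∷ []
  addTerm (a , m) ((b , m′) ∷ p) with List.≡-dec ℕ._≟_ m m′
  ... | yes _ = (a + b , m′) ∷ p
  ... | no _  = (b , m′) ∷ addTerm (a , m) p

  _+ₚ_ : Poly → Poly → Poly
  p +ₚ q = foldr addTerm q p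

  scale : ℤ × Monomial → Poly → Poly
  scale (a , m) = map λ (b , m′) → a * b , m *ₘ m′

  _*ₚ_ : Poly → Poly → Poly
  [] *ₚ q      = []
  (t ∷ p) *ₚ q = scale t q +ₚ (p *ₚ q)

  -ₚ_ : Poly → Poly
  -ₚ_ = map λ (a , m) → - a , m

  poly : Expr → Poly
  poly (var i)  = (1ℤ , i ∷ []) ∷ []
  poly (# k)    = (+ k , []) ∷ []
  poly (-# k)   = (- + k , []) ∷ []
  poly (a :+ b) = poly a +ₚ poly b
  poly (a :- b) = poly a +ₚ (-ₚ poly b)
  poly (neg a)  = -ₚ poly a
  poly (a :* b) = poly a *ₚ poly b

  -- `addTerm` keeps monomials whose coefficients have cancelled, so zero terms of any degree are
  -- skipped; besides those only non-negative constants may remain.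
  nonneg : Poly → Bool
  nonneg []                        = true
  nonneg ((+ 0 , _) ∷ p)           = nonneg p
  nonneg ((+ _ , []) ∷ p)          = nonneg p
  nonneg (_ ∷ _)                   = false

  -- Every hypothesis is used exactly once, equations with either sign; what is
  -- left over must be a non-negative constant.
  proves : Poly → List Rel → Bool
  proves p []             = nonneg p
  proves p (a :≤ b ∷ hs)  = proves (p +ₚ (poly a +ₚ (-ₚ poly b))) hs
  proves p (a :< b ∷ hs)  = proves (p +ₚ (poly a +ₚ addTerm (1ℤ , []) (-ₚ poly b))) hs
  proves p (a :≡ b ∷ hs)  =
    proves (p +ₚ (poly a +ₚ (-ₚ poly b))) hs ∨ proves (p +ₚ (poly b +ₚ (-ₚ poly a))) hs
  proves p (:⊥ ∷ hs)      = true

  -- Every goal becomes the non-negativity of a polynomial: over ℤ, `a < b` reads `b - a - 1 ≥ 0`,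
  -- an equation is two inequalities, and absurdity is the claim `-1 ≥ 0`.
  valid : List Rel → Rel → Bool
  valid hs (a :≤ b) = proves (poly b +ₚ (-ₚ poly a)) hs
  valid hs (a :< b) = proves (addTerm (-1ℤ , []) (poly b +ₚ (-ₚ poly a))) hs
  valid hs (a :≡ b) = proves (poly b +ₚ (-ₚ poly a)) hs ∧ proves (poly a +ₚ (-ₚ poly b)) hs
  valid hs :⊥     = proves ((-1ℤ , []) ∷ []) hs

  module _ (ρ : ℕ → ℤ) where

    ⟦_⟧ₘ : Monomial → ℤ
    ⟦ [] ⟧ₘ    = 1ℤ
    ⟦ i ∷ m ⟧ₘ = ρ i * ⟦ m ⟧ₘ

    ⟦_⟧ₚ : Poly → ℤ
    ⟦ [] ⟧ₚ          = 0ℤ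
    ⟦ (a , m) ∷ p ⟧ₚ = a * ⟦ m ⟧ₘ + ⟦ p ⟧ₚ

    swap-* : ∀ a b c → a * (b * c) ≡ b * (a * c)
    swap-* = x∙yz≈y∙xz ℤ.*-commutativeSemigroup

    ⟦insert⟧ : ∀ i m → ⟦ insert i m ⟧ₘ ≡ ρ i * ⟦ m ⟧ₘ
    ⟦insert⟧ i [] = refl
    ⟦insert⟧ i (j ∷ m) with i ℕ.≤ᵇ j
    ... | true  = refl
    ... | false = trans (cong (ρ j *_) (⟦insert⟧ i m)) (swap-* (ρ j) (ρ i) ⟦ m ⟧ₘ)

    ⟦*ₘ⟧ : ∀ m m′ → ⟦ m *ₘ m′ ⟧ₘ ≡ ⟦ m ⟧ₘ * ⟦ m′ ⟧ₘ
    ⟦*ₘ⟧ [] m′      = sym (ℤ.*-identityˡ _)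
    ⟦*ₘ⟧ (i ∷ m) m′ = trans (⟦insert⟧ i (m *ₘ m′))
      (trans (cong (ρ i *_) (⟦*ₘ⟧ m m′)) (sym (ℤ.*-assoc (ρ i) _ _)))

    merge : ∀ a b x p → (a + b) * x + p ≡ a * x + (b * x + p)
    merge a b x p = trans (cong (_+ p) (ℤ.*-distribʳ-+ x a b)) (ℤ.+-assoc (a * x) (b * x) p)

    swap-+ : ∀ a b c → a + (b + c) ≡ b + (a + c)
    swap-+ = x∙yz≈y∙xz ℤ.+-commutativeSemigroup

    ⟦addTerm⟧ : ∀ a m p → ⟦ addTerm (a , m) p ⟧ₚ ≡ a * ⟦ m ⟧ₘ + ⟦ p ⟧ₚ
    ⟦addTerm⟧ a m [] = refl
    ⟦addTerm⟧ a m ((b , m′) ∷ p) with List.≡-dec ℕ._≟_ m m′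
    ... | yes refl = merge a b ⟦ m ⟧ₘ ⟦ p ⟧ₚ
    ... | no _     = trans (cong (λ z → b * ⟦ m′ ⟧ₘ + z) (⟦addTerm⟧ a m p))
                           (swap-+ (b * ⟦ m′ ⟧ₘ) (a * ⟦ m ⟧ₘ) ⟦ p ⟧ₚ)

    ⟦+ₚ⟧ : ∀ p q → ⟦ p +ₚ q ⟧ₚ ≡ ⟦ p ⟧ₚ + ⟦ q ⟧ₚ
    ⟦+ₚ⟧ [] q            = sym (ℤ.+-identityˡ _)
    ⟦+ₚ⟧ ((a , m) ∷ p) q = trans (⟦addTerm⟧ a m (p +ₚ q))
      (trans (cong (λ z → a * ⟦ m ⟧ₘ + z) (⟦+ₚ⟧ p q)) (sym (ℤ.+-assoc (a * ⟦ m ⟧ₘ) _ _)))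

    scale-step : ∀ a x b y p → a * b * (x * y) + a * x * p ≡ a * x * (b * y + p)
    scale-step a x b y p = trans (cong (_+ a * x * p) (interchange ℤ.*-commutativeSemigroup a b x y))
      (sym (ℤ.*-distribˡ-+ (a * x) (b * y) p))

    ⟦scale⟧ : ∀ a m p → ⟦ scale (a , m) p ⟧ₚ ≡ a * ⟦ m ⟧ₘ * ⟦ p ⟧ₚ
    ⟦scale⟧ a m []            = sym (ℤ.*-zeroʳ (a * ⟦ m ⟧ₘ))
    ⟦scale⟧ a m ((b , m′) ∷ p) = trans
      (cong₂ (λ x y → a * b * x + y) (⟦*ₘ⟧ m m′) (⟦scale⟧ a m p))
      (scale-step a ⟦ m ⟧ₘ b ⟦ m′ ⟧ₘ ⟦ p ⟧ₚ)

    ⟦*ₚ⟧ : ∀ p q → ⟦ p *ₚ q ⟧ₚ ≡ ⟦ p ⟧ₚ * ⟦ q ⟧ₚ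
    ⟦*ₚ⟧ [] q            = sym (ℤ.*-zeroˡ ⟦ q ⟧ₚ)
    ⟦*ₚ⟧ ((a , m) ∷ p) q = trans (⟦+ₚ⟧ (scale (a , m) q) (p *ₚ q))
      (trans (cong₂ _+_ (⟦scale⟧ a m q) (⟦*ₚ⟧ p q))
             (sym (ℤ.*-distribʳ-+ ⟦ q ⟧ₚ (a * ⟦ m ⟧ₘ) ⟦ p ⟧ₚ)))

    ⟦-ₚ⟧ : ∀ p → ⟦ -ₚ p ⟧ₚ ≡ - ⟦ p ⟧ₚ
    ⟦-ₚ⟧ []            = refl
    ⟦-ₚ⟧ ((a , m) ∷ p) = trans
      (cong₂ _+_ (sym (ℤ.neg-distribˡ-* a ⟦ m ⟧ₘ)) (⟦-ₚ⟧ p))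
      (sym (ℤ.neg-distrib-+ (a * ⟦ m ⟧ₘ) ⟦ p ⟧ₚ))

    ⟦poly⟧ : ∀ e → ⟦ poly e ⟧ₚ ≡ ⟦ ρ ⟧ₑ e
    ⟦-poly⟧ : ∀ p e → ⟦ p +ₚ (-ₚ poly e) ⟧ₚ ≡ ⟦ p ⟧ₚ - ⟦ ρ ⟧ₑ e
    ⟦poly⟧ (var i)  = trans (ℤ.+-identityʳ _) (trans (ℤ.*-identityˡ _) (ℤ.*-identityʳ (ρ i)))
    ⟦poly⟧ (# k)    = trans (ℤ.+-identityʳ _) (ℤ.*-identityʳ (+ k))
    ⟦poly⟧ (-# k)   = trans (ℤ.+-identityʳ _) (ℤ.*-identityʳ (- + k))
    ⟦poly⟧ (a :+ b) = trans (⟦+ₚ⟧ (poly a) (poly b)) (cong₂ _+_ (⟦poly⟧ a) (⟦poly⟧ b))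
    ⟦poly⟧ (a :- b) = trans (⟦-poly⟧ (poly a) b) (cong (_- ⟦ ρ ⟧ₑ b) (⟦poly⟧ a))
    ⟦poly⟧ (neg a)  = trans (⟦-ₚ⟧ (poly a)) (cong -_ (⟦poly⟧ a))
    ⟦poly⟧ (a :* b) = trans (⟦*ₚ⟧ (poly a) (poly b)) (cong₂ _*_ (⟦poly⟧ a) (⟦poly⟧ b))
    ⟦-poly⟧ p e = trans (⟦+ₚ⟧ p (-ₚ poly e))
      (cong (λ z → ⟦ p ⟧ₚ + z) (trans (⟦-ₚ⟧ (poly e)) (cong -_ (⟦poly⟧ e))))

    nonneg-sound : ∀ p → T (nonneg p) → 0ℤ ≤ ⟦ p ⟧ₚ
    nonneg-sound [] _ = ℤ.≤-refl
    nonneg-sound ((+ 0 , m) ∷ p) t =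
      subst (0ℤ ≤_) (sym (trans (cong (_+ ⟦ p ⟧ₚ) (ℤ.*-zeroˡ ⟦ m ⟧ₘ)) (ℤ.+-identityˡ _))) (nonneg-sound p t)
    nonneg-sound ((+ suc k , []) ∷ p) t =
      subst (λ z → 0ℤ ≤ z + ⟦ p ⟧ₚ) (sym (ℤ.*-identityʳ (+ suc k)))
        (ℤ.+-mono-≤ {0ℤ} {+ suc k} (ℤ.+≤+ ℕ.z≤n) (nonneg-sound p t))

    diff : ∀ a b → ⟦ poly b +ₚ (-ₚ poly a) ⟧ₚ ≡ ⟦ ρ ⟧ₑ b - ⟦ ρ ⟧ₑ a
    diff a b = trans (⟦-poly⟧ (poly b) a) (cong (_- ⟦ ρ ⟧ₑ a) (⟦poly⟧ b))

    -- Since `a - b ≤ 0`, adding it can only lower the value of `p`; this is the sound direction for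
    -- spending a hypothesis `a ≤ b`.
    absorb : ∀ {q} a b p → ⟦ q ⟧ₚ ≡ a - b → a ≤ b → 0ℤ ≤ ⟦ p +ₚ q ⟧ₚ → 0ℤ ≤ ⟦ p ⟧ₚ
    absorb {q} a b p q≡ a≤b pos = begin
      0ℤ              ≤⟨ pos ⟩
      ⟦ p +ₚ q ⟧ₚ     ≡⟨ trans (⟦+ₚ⟧ p q) (cong (λ z → ⟦ p ⟧ₚ + z) q≡) ⟩
      ⟦ p ⟧ₚ + (a - b) ≤⟨ ℤ.+-monoʳ-≤ ⟦ p ⟧ₚ (ℤ.i≤j⇒i-j≤0 a≤b) ⟩
      ⟦ p ⟧ₚ + 0ℤ   ≡⟨ ℤ.+-identityʳ ⟦ p ⟧ₚ ⟩
      ⟦ p ⟧ₚ          ∎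
      where open ℤ.≤-Reasoning

    data Holds : List Rel → Set where
      []  : Holds []
      _∷_ : ∀ {h hs} → ⟦ ρ ⟧ᵣ h → Holds hs → Holds (h ∷ hs)

    proves-sound : ∀ p hs → T (proves p hs) → Holds hs → 0ℤ ≤ ⟦ p ⟧ₚ
    proves-sound p [] t [] = nonneg-sound p t
    proves-sound p (a :≤ b ∷ hs) t (h ∷ H) = absorb _ _ p (diff b a) h (proves-sound _ hs t H)
    proves-sound p (a :< b ∷ hs) t (h ∷ H) =
      absorb (ℤ.suc (⟦ ρ ⟧ₑ a)) (⟦ ρ ⟧ₑ b) p
        (trans (⟦+ₚ⟧ (poly a) _) (trans (cong (λ z → ⟦ poly a ⟧ₚ + z) (⟦addTerm⟧ 1ℤ [] (-ₚ poly b))) (trans (cong₂ (λ x y → x + (1ℤ + y)) (⟦poly⟧ a)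
          (trans (⟦-ₚ⟧ (poly b)) (cong -_ (⟦poly⟧ b)))) (shift (⟦ ρ ⟧ₑ a) (⟦ ρ ⟧ₑ b)))))
        (ℤ.i<j⇒suc[i]≤j h) (proves-sound _ hs t H)
      where
      shift : ∀ a b → a + (1ℤ + - b) ≡ 1ℤ + a - b
      shift a b = trans (sym (ℤ.+-assoc a 1ℤ (- b))) (cong (_- b) (ℤ.+-comm a 1ℤ))
    proves-sound p (a :≡ b ∷ hs) t (h ∷ H) with Equivalence.to T-∨ t
    ... | inj₁ t′ = absorb _ _ p (diff b a) (ℤ.≤-reflexive h) (proves-sound _ hs t′ H)
    ... | inj₂ t′ = absorb _ _ p (diff a b) (ℤ.≤-reflexive (sym h)) (proves-sound _ hs t′ H)
    proves-sound p (:⊥ ∷ hs) t (() ∷ H)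

    ≤-from : ∀ a b → 0ℤ ≤ ⟦ poly b +ₚ (-ₚ poly a) ⟧ₚ → ⟦ ρ ⟧ᵣ (a :≤ b)
    ≤-from a b pos = ℤ.0≤i-j⇒j≤i (subst (0ℤ ≤_) (diff a b) pos)

    valid-sound : ∀ hs g → T (valid hs g) → Holds hs → ⟦ ρ ⟧ᵣ g
    valid-sound hs (a :≤ b) t H = ≤-from a b (proves-sound _ hs t H)
    valid-sound hs (a :< b) t H = ℤ.suc[i]≤j⇒i<j (ℤ.0≤i-j⇒j≤i
      (subst (0ℤ ≤_) (trans (⟦addTerm⟧ -1ℤ [] (poly b +ₚ (-ₚ poly a))) (trans (cong (λ z → -1ℤ * 1ℤ + z) (diff a b)) (shift (⟦ ρ ⟧ₑ a) (⟦ ρ ⟧ₑ b)))) (proves-sound _ hs t H)))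
      where
      shift : ∀ a b → -1ℤ * 1ℤ + (b - a) ≡ b - (1ℤ + a)
      shift a b = trans (swap-+ -1ℤ b (- a)) (cong (λ z → b + z) (sym (ℤ.neg-distrib-+ 1ℤ a)))
    valid-sound hs (a :≡ b) t H = let t₁ , t₂ = Equivalence.to T-∧ t in
      ℤ.≤-antisym (≤-from a b (proves-sound _ hs t₁ H)) (≤-from b a (proves-sound _ hs t₂ H))
    valid-sound hs :⊥ t H with () ← proves-sound ((-1ℤ , []) ∷ []) hs t H

    by-holds : ∀ s → (Holds (hypotheses s) → ⟦ ρ ⟧ᵣ (goal s)) → ⟦ ρ ⟧ₛ s
    by-holds (⊢ g) k   = k []
    by-holds (h ⊢ g) k = λ x → k (x ∷ [])
    by-holds (h , s) k = λ x → by-holds s λ H → k (x ∷ H)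

  instantiate : ∀ m (start : ℕ) → N-ary m Expr Sequent → Sequent
  instantiate zero    _ s = s
  instantiate (suc m) i s = instantiate m (suc i) (s (var i))

  Tuple : ℕ → Set
  Tuple zero          = ⊤
  Tuple (suc zero)    = ℤ
  Tuple (suc (suc m)) = ℤ × Tuple (suc m)

  env : ∀ m → Tuple m → ℕ → ℤ
  env zero          _        _       = 0ℤ
  env (suc zero)    x        zero    = x
  env (suc zero)    x        (suc _) = 0ℤ
  env (suc (suc m)) (x , xs) zero    = x
  env (suc (suc m)) (x , xs) (suc i) = env (suc m) xs i

  -- Products of variables are atoms of the normal form, so a nonlinear goal succeeds once the right
  -- products occur in the hypotheses. A hypothesis that has to enter k times is listed k times. The
  -- implicit argument is the check, settled by evaluation.
  lia : ∀ m (xs : Tuple m) (s : N-ary m Expr Sequent) →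
        {T (valid (hypotheses (instantiate m 0 s)) (goal (instantiate m 0 s)))} → ⟦ env m xs ⟧ₛ (instantiate m 0 s)
  lia m xs s {t} = by-holds (env m xs) sequent (valid-sound (env m xs) (hypotheses sequent) (goal sequent) t)
    where
    sequent : Sequent
    sequent = instantiate m 0 s

open LinearArithmetic using (Expr; #_; -#_; _:+_; _:-_; _:*_; neg; _:≤_; _:<_; _:≡_; :⊥; ⊢_; _⊢_; _,_; lia)

-- Finite sums of integers.

sum-0 : ∀ {m} (g : Fin m → ℤ) → (∀ i → g i ≡ 0ℤ) → sum g ≡ 0ℤ
sum-0 {zero} g g≡0  = refl
sum-0 {suc m} g g≡0 = cong₂ ℤ._+_ (g≡0 zero) (sum-0 (g ∘ suc) (g≡0 ∘ suc))

sum-single : ∀ {m} (g : Fin m → ℤ) r → (∀ i → i ≢ r → g i ≡ 0ℤ) → sum g ≡ g r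
sum-single g zero g≡0 =
  trans (cong (λ z → g zero ℤ.+ z) (sum-0 (g ∘ suc) (λ i → g≡0 (suc i) (λ ())))) (ℤ.+-identityʳ _)
sum-single g (suc r) g≡0 =
  trans (cong₂ ℤ._+_ (g≡0 zero (λ ())) (sum-single (g ∘ suc) r (λ i i≢r → g≡0 (suc i) (i≢r ∘ Fin.suc-injective))))
        (ℤ.+-identityˡ _)

sum-two : ∀ {m} (g : Fin m → ℤ) r s → r ≢ s → (∀ i → i ≢ r → i ≢ s → g i ≡ 0ℤ) → sum g ≡ g r ℤ.+ g s
sum-two g zero zero r≢s g≡0 = contradiction refl r≢s
sum-two g zero (suc s) r≢s g≡0 = cong (λ z → g zero ℤ.+ z)
  (sum-single (g ∘ suc) s (λ i i≢s → g≡0 (suc i) (λ ()) (i≢s ∘ Fin.suc-injective)))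
sum-two g (suc r) zero r≢s g≡0 = trans (cong (λ z → g zero ℤ.+ z)
  (sum-single (g ∘ suc) r (λ i i≢r → g≡0 (suc i) (i≢r ∘ Fin.suc-injective) (λ ())))) (ℤ.+-comm (g zero) (g (suc r)))
sum-two g (suc r) (suc s) r≢s g≡0 = trans (cong₂ ℤ._+_ (g≡0 zero (λ ()) (λ ()))
  (sum-two (g ∘ suc) r s (r≢s ∘ cong suc)
    (λ i i≢r i≢s → g≡0 (suc i) (i≢r ∘ Fin.suc-injective) (i≢s ∘ Fin.suc-injective)))) (ℤ.+-identityˡ _)

sum-mono : ∀ {m} (g h : Fin m → ℤ) → (∀ i → g i ℤ.≤ h i) → sum g ℤ.≤ sum h
sum-mono {zero} g h g≤h  = ℤ.≤-refl
sum-mono {suc m} g h g≤h = ℤ.+-mono-≤ (g≤h zero) (sum-mono (g ∘ suc) (h ∘ suc) (g≤h ∘ suc))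

sum-const : ∀ m x → sum {m} (λ _ → x) ≡ + m ℤ.* x
sum-const zero x    = sym (ℤ.*-zeroˡ x)
sum-const (suc m) x = trans (cong (λ z → x ℤ.+ z) (sum-const m x)) (sym (ℤ.suc-* (+ m) x))

sum-nonneg : ∀ {m} (g : Fin m → ℤ) → (∀ i → 0ℤ ℤ.≤ g i) → 0ℤ ℤ.≤ sum g
sum-nonneg {zero} g 0≤g  = ℤ.≤-refl
sum-nonneg {suc m} g 0≤g = ℤ.+-mono-≤ (0≤g zero) (sum-nonneg (g ∘ suc) (0≤g ∘ suc))

term≤sum : ∀ {m} (g : Fin m → ℤ) → (∀ i → 0ℤ ℤ.≤ g i) → ∀ r → g r ℤ.≤ sum g
term≤sum g 0≤g zero = lia 2 (g zero , sum (g ∘ suc)) (λ a b → # 0 :≤ b ⊢ a :≤ a :+ b)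
  (sum-nonneg (g ∘ suc) (0≤g ∘ suc))
term≤sum g 0≤g (suc r) =
  lia 3 (g zero , g (suc r) , sum (g ∘ suc)) (λ a b s → # 0 :≤ a , b :≤ s ⊢ b :≤ a :+ s)
    (0≤g zero) (term≤sum (g ∘ suc) (0≤g ∘ suc) r)

two-terms≤sum : ∀ {m} (g : Fin m → ℤ) → (∀ i → 0ℤ ℤ.≤ g i) → ∀ r s → r ≢ s → g r ℤ.+ g s ℤ.≤ sum g
two-terms≤sum g 0≤g zero zero r≢s = contradiction refl r≢s
two-terms≤sum g 0≤g zero (suc s) r≢s = ℤ.+-monoʳ-≤ (g zero) (term≤sum (g ∘ suc) (0≤g ∘ suc) s)
two-terms≤sum g 0≤g (suc r) zero r≢s =
  ℤ.≤-trans (ℤ.≤-reflexive (ℤ.+-comm (g (suc r)) (g zero)))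
            (ℤ.+-monoʳ-≤ (g zero) (term≤sum (g ∘ suc) (0≤g ∘ suc) r))
two-terms≤sum g 0≤g (suc r) (suc s) r≢s =
  lia 4 (g zero , g (suc r) , g (suc s) , sum (g ∘ suc))
    (λ a b c s → # 0 :≤ a , b :+ c :≤ s ⊢ b :+ c :≤ a :+ s)
    (0≤g zero) (two-terms≤sum (g ∘ suc) (0≤g ∘ suc) r s (r≢s ∘ cong suc))

positive-term : ∀ {m} (g : Fin m → ℤ) → 0ℤ ℤ.< sum g → ∃ λ r → 0ℤ ℤ.< g r
positive-term {zero} g (ℤ.+<+ ())
positive-term {suc m} g 0<s with 0ℤ ℤ.<? g zero
... | yes 0<g₀ = zero , 0<g₀
... | no 0≮g₀ with r , 0<gr ← positive-term (g ∘ suc)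
        (lia 2 (g zero , sum (g ∘ suc)) (λ a s → a :≤ # 0 , # 0 :< a :+ s ⊢ # 0 :< s) (ℤ.≮⇒≥ 0≮g₀) 0<s)
      = suc r , 0<gr

-- Congruence modulo n and the coefficient functions of the ε_a.

module AffineWeylGroup (n : ℕ) (n≥3 : 3 ℕ.≤ n) where
  open Affine n n≥3
  open import Data.Integer.Base using (_+_; _-_; _*_; -_; _<_; _≤_)

  instance
    n≢0 : NonZero n
    n≢0 = >-nonZero (ℕ.≤-trans (s≤s z≤n) n≥3)

  N : ℤ
  N = + n

  3≤N : + 3 ≤ N
  3≤N = ℤ.+≤+ n≥3

  0<N : 0ℤ < N
  0<N = ℤ.<-≤-trans (ℤ.+<+ (s≤s z≤n)) 3≤N

  cancel-N : ∀ i j → i * N < j * N → i < j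
  cancel-N i j = ℤ.*-cancelʳ-<-nonNeg N

  infix 4 _≋_ _≋?_
  -- The quotient is kept as data because an equivariant map carries it over unchanged: `to σ i` and
  -- `to σ j` differ by the same multiple of `N`.
  record _≋_ (i j : ℤ) : Set where
    constructor _,_
    field
      multiple : ℤ
      equation : i ≡ j + multiple * N

  ≋-reflexive : ∀ {i j} → i ≡ j → i ≋ j
  ≋-reflexive {i} refl = 0ℤ , lia 2 (i , N) λ i N → ⊢ i :≡ i :+ # 0 :* N

  ≋-refl : ∀ {i} → i ≋ i
  ≋-refl = ≋-reflexive refl

  ≋-sym : ∀ {i j} → i ≋ j → j ≋ i
  ≋-sym {i} {j} (k , eq) = - k , lia 4 (i , j , k , N)
    (λ i j k N → i :≡ j :+ k :* N ⊢ j :≡ i :+ neg k :* N) eq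

  ≋-trans : ∀ {i j k} → i ≋ j → j ≋ k → i ≋ k
  ≋-trans {i} {j} {k} (a , eq) (b , eq′) = a + b , lia 6 (i , j , k , a , b , N)
    (λ i j k a b N → i :≡ j :+ a :* N , j :≡ k :+ b :* N ⊢ i :≡ k :+ (a :+ b) :* N) eq eq′

  ≋-+N : ∀ i k → i + k * N ≋ i
  ≋-+N i k = k , refl

  ≋-+ : ∀ {i j} x → i ≋ j → i + x ≋ j + x
  ≋-+ {i} {j} x (k , eq) = k , lia 5 (i , j , k , N , x)
    (λ i j k N x → i :≡ j :+ k :* N ⊢ i :+ x :≡ j :+ x :+ k :* N) eq

  ≋-close : ∀ {i j} → i ≋ j → i < j + N → j < i + N → i ≡ j
  ≋-close {i} {j} (k , eq) i<j+N j<i+N = trans eq (trans (cong (λ z → j + z * N) k≡0)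
      (lia 2 (j , N) λ j N → ⊢ j :+ # 0 :* N :≡ j))
    where
    k<1 : k < 1ℤ
    k<1 = cancel-N k 1ℤ (lia 4 (i , j , k , N)
      (λ i j k N → i :≡ j :+ k :* N , i :< j :+ N ⊢ k :* N :< # 1 :* N) eq i<j+N)
    -1<k : -1ℤ < k
    -1<k = cancel-N -1ℤ k (lia 4 (i , j , k , N)
      (λ i j k N → i :≡ j :+ k :* N , j :< i :+ N ⊢ -# 1 :* N :< k :* N) eq j<i+N)
    k≡0 : k ≡ 0ℤ
    k≡0 = ℤ.≤-antisym (lia 1 k (λ k → k :< # 1 ⊢ k :≤ # 0) k<1)
                      (lia 1 k (λ k → -# 1 :< k ⊢ # 0 :≤ k) -1<k)

  ≋-apart : ∀ {i j} → i < j → j < i + N → ¬ i ≋ j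
  ≋-apart {i} {j} i<j j<i+N i≋j = ℤ.<-irrefl (≋-close i≋j i<j+N j<i+N) i<j
    where i<j+N = lia 3 (i , j , N) (λ i j N → i :< j , # 0 :< N ⊢ i :< j :+ N) i<j 0<N

  ⌜_⌝ : Fin n → ℤ
  ⌜ i ⌝ = + toℕ i

  0≤⌜_⌝ : ∀ i → 0ℤ ≤ ⌜ i ⌝
  0≤⌜ i ⌝ = ℤ.+≤+ z≤n

  ⌜_⌝<N : ∀ i → ⌜ i ⌝ < N
  ⌜ i ⌝<N = ℤ.+<+ (Fin.toℕ<n i)

  ⌜⌝-injective : ∀ {i j} → ⌜ i ⌝ ≋ ⌜ j ⌝ → i ≡ j
  ⌜⌝-injective {i} {j} i≋j = Fin.toℕ-injective (ℤ.+-injective (≋-close i≋j (below i j) (below j i)))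
    where
    below : ∀ i j → ⌜ i ⌝ < ⌜ j ⌝ + N
    below i j = lia 3 (⌜ i ⌝ , ⌜ j ⌝ , N) (λ i j N → i :< N , # 0 :≤ j ⊢ i :< j :+ N) ⌜ i ⌝<N 0≤⌜ j ⌝

  class : ℤ → Fin n
  class z = fromℕ< (ℤ.n%ℕd<d z n)

  ≋-class : ∀ z → z ≋ ⌜ class z ⌝
  ≋-class z = z ℤ./ℕ n , trans (ℤ.a≡a%ℕn+[a/ℕn]*n z n)
    (cong (λ r → + r + (z ℤ./ℕ n) * N) (sym (Fin.toℕ-fromℕ< _)))

  opaque
    _≋?_ : ∀ i j → Dec (i ≋ j)
    i ≋? j = map′
      (λ eq → ≋-trans (≋-class i) (≋-trans (≋-reflexive (cong ⌜_⌝ eq)) (≋-sym (≋-class j))))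
      (λ i≋j → ⌜⌝-injective (≋-trans (≋-sym (≋-class i)) (≋-trans i≋j (≋-class j))))
      (class i Fin.≟ class j)

  next≋ : ∀ i → ⌜ next i ⌝ ≋ ⌜ i ⌝ + 1ℤ
  next≋ i = ≋-sym (+ (suc (toℕ i) ℕ./ n) , (begin
    ⌜ i ⌝ + 1ℤ                                        ≡⟨ ℤ.+-comm ⌜ i ⌝ 1ℤ ⟩
    + suc (toℕ i)                                       ≡⟨ cong +_ (ℕ.m≡m%n+[m/n]*n (suc (toℕ i)) n) ⟩
    + (suc (toℕ i) ℕ.% n) + + (suc (toℕ i) ℕ./ n ℕ.* n) ≡⟨ cong₂ _+_ (cong +_ (sym (Fin.toℕ-fromℕ< _))) (ℤ.pos-* (suc (toℕ i) ℕ./ n) n) ⟩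
    ⌜ next i ⌝ + + (suc (toℕ i) ℕ./ n) * N          ∎))
    where open ≡-Reasoning

  opaque
    δ : ℤ → ℤ → ℤ
    δ i j = if does (i ≋? j) then 1ℤ else 0ℤ

    δ-yes : ∀ {i j} → i ≋ j → δ i j ≡ 1ℤ
    δ-yes {i} {j} i≋j with i ≋? j
    ... | yes _    = refl
    ... | no ¬i≋j = contradiction i≋j ¬i≋j

    δ-no : ∀ {i j} → ¬ i ≋ j → δ i j ≡ 0ℤ
    δ-no {i} {j} ¬i≋j with i ≋? j
    ... | yes i≋j = contradiction i≋j ¬i≋j
    ... | no _    = refl

    δ-cong : ∀ {i i′ j j′} → i ≋ i′ → j ≋ j′ → δ i j ≡ δ i′ j′
    δ-cong {i} {i′} {j} {j′} i≋ j≋ with i′ ≋? j′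
    ... | yes eq = δ-yes (≋-trans i≋ (≋-trans eq (≋-sym j≋)))
    ... | no neq = δ-no (λ eq → neq (≋-trans (≋-sym i≋) (≋-trans eq j≋)))

    δ-sym : ∀ i j → δ i j ≡ δ j i
    δ-sym i j with j ≋? i
    ... | yes eq = δ-yes (≋-sym eq)
    ... | no neq = δ-no (neq ∘ ≋-sym)

    0≤δ : ∀ i j → 0ℤ ≤ δ i j
    0≤δ i j with i ≋? j
    ... | yes _ = ℤ.+≤+ z≤n
    ... | no _  = ℤ.≤-refl

    δ≤1 : ∀ i j → δ i j ≤ 1ℤ
    δ≤1 i j with i ≋? j
    ... | yes _ = ℤ.≤-refl
    ... | no _  = ℤ.+≤+ z≤n

  -- E a k is the coefficient at α_k of the vector ε_a for which ε₀ = 0 and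
  -- ε_a - ε_{a+1} = α_a; the real roots are the differences ε_a - ε_b.
  opaque
    E : ℤ → ℤ → ℤ
    E a k = (k - a) ℤ./ℕ n

    E-spec : ∀ a k → a + E a k * N ≤ k × k < a + (E a k + 1ℤ) * N
    E-spec a k =
      lia 4 (a , k , q , N) (λ a k q N → q :* N :≤ k :- a ⊢ a :+ q :* N :≤ k)
        (ℤ.[n/ℕd]*d≤n (k - a) n) ,
      lia 4 (a , k , q , N) (λ a k q N → k :- a :< (# 1 :+ q) :* N ⊢ k :< a :+ (q :+ # 1) :* N)
        (ℤ.n<s[n/ℕd]*d (k - a) n)
      where
      q : ℤ
      q = (k - a) ℤ./ℕ n

  E-≥ : ∀ a k q → a + q * N ≤ k → q ≤ E a k
  E-≥ a k q h = lia 2 (q , E a k) (λ q e → q :< e :+ # 1 ⊢ q :≤ e) (cancel-N q (E a k + 1ℤ)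
    (lia 5 (a , k , q , E a k , N)
      (λ a k q e N → a :+ q :* N :≤ k , k :< a :+ (e :+ # 1) :* N ⊢ q :* N :< (e :+ # 1) :* N)
      h (proj₂ (E-spec a k))))

  E-< : ∀ a k q → k < a + q * N → E a k < q
  E-< a k q h = cancel-N (E a k) q
    (lia 5 (a , k , q , E a k , N)
      (λ a k q e N → k :< a :+ q :* N , a :+ e :* N :≤ k ⊢ e :* N :< q :* N)
      h (proj₁ (E-spec a k)))

  E-≡ : ∀ a k q → a + q * N ≤ k → k < a + (q + 1ℤ) * N → E a k ≡ q
  E-≡ a k q lo hi = ℤ.≤-antisym
    (lia 2 (q , E a k) (λ q e → e :< q :+ # 1 ⊢ e :≤ q) (E-< a k (q + 1ℤ) hi))
    (E-≥ a k q lo)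

  -- In the first argument this is ε_{a+n} = ε_a - c. The shift in the second argument adds the same
  -- amount for every `a`: as a function of `k`, `E a` is not periodic, but differences
  -- `E a k - E b k` are.
  E-shift : ∀ a k i j → E (a + i * N) (k + j * N) ≡ E a k + j - i
  E-shift a k i j = E-≡ _ _ _
    (lia 6 (a , k , i , j , E a k , N) (λ a k i j e N →
      a :+ e :* N :≤ k ⊢ a :+ i :* N :+ (e :+ j :- i) :* N :≤ k :+ j :* N) (proj₁ (E-spec a k)))
    (lia 6 (a , k , i , j , E a k , N) (λ a k i j e N →
      k :< a :+ (e :+ # 1) :* N ⊢ k :+ j :* N :< a :+ i :* N :+ (e :+ j :- i :+ # 1) :* N) (proj₂ (E-spec a k)))

  E-shiftˡ : ∀ a k i → E (a + i * N) k ≡ E a k - i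
  E-shiftˡ a k i = trans (cong (E (a + i * N)) (lia 2 (k , N) λ k N → ⊢ k :≡ k :+ # 0 :* N))
    (trans (E-shift a k i 0ℤ) (cong (_- i) (ℤ.+-identityʳ (E a k))))

  E-shiftʳ : ∀ a k j → E a (k + j * N) ≡ E a k + j
  E-shiftʳ a k j = trans (cong (λ z → E z (k + j * N)) (lia 2 (a , N) λ a N → ⊢ a :≡ a :+ # 0 :* N))
    (trans (E-shift a k 0ℤ j) (ℤ.+-identityʳ _))

  E-anti : ∀ {a b} k → a ≤ b → E b k ≤ E a k
  E-anti {a} {b} k a≤b = E-≥ a k (E b k) (lia 4 (a , b , k , E b k * N)
    (λ a b k x → a :≤ b , b :+ x :≤ k ⊢ a :+ x :≤ k) a≤b (proj₁ (E-spec b k)))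

  E-suc : ∀ a k → E (a + 1ℤ) k ≡ E a (k - 1ℤ)
  E-suc a k = E-≡ _ _ _
    (lia 3 (a , k , E a (k - 1ℤ) * N) (λ a k x → a :+ x :≤ k :- # 1 ⊢ a :+ # 1 :+ x :≤ k)
      (proj₁ (E-spec a (k - 1ℤ))))
    (lia 3 (a , k , (E a (k - 1ℤ) + 1ℤ) * N) (λ a k x → k :- # 1 :< a :+ x ⊢ k :< a :+ # 1 :+ x)
      (proj₂ (E-spec a (k - 1ℤ))))

  -- The quotient of `k - a` by n grows by one exactly when `k` enters the class of `a`. The
  -- invariant form and the changes of flow are computed from this discrete derivative.
  E-jump : ∀ a k → E a k ≡ E a (k - 1ℤ) + δ k a
  E-jump a k with k ≋? a
  ... | yes (m , eq) = trans (E-≡ a k m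
        (lia 4 (a , k , m , N) (λ a k m N → k :≡ a :+ m :* N ⊢ a :+ m :* N :≤ k) eq)
        (lia 4 (a , k , m , N) (λ a k m N → k :≡ a :+ m :* N , # 0 :< N ⊢ k :< a :+ (m :+ # 1) :* N) eq 0<N))
      (trans (lia 1 m (λ m → ⊢ m :≡ m :- # 1 :+ # 1)) (cong₂ _+_ (sym (E-≡ a (k - 1ℤ) (m - 1ℤ)
        (lia 4 (a , k , m , N) (λ a k m N → k :≡ a :+ m :* N , # 3 :≤ N ⊢ a :+ (m :- # 1) :* N :≤ k :- # 1) eq 3≤N)
        (lia 4 (a , k , m , N) (λ a k m N → k :≡ a :+ m :* N ⊢ k :- # 1 :< a :+ (m :- # 1 :+ # 1) :* N) eq))) (sym (δ-yes (m , eq)))))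
  ... | no ¬k≋a = trans (sym (E-≡ a (k - 1ℤ) e lo hi)) (trans (sym (ℤ.+-identityʳ _)) (cong (λ z → E a (k - 1ℤ) + z) (sym (δ-no ¬k≋a))))
    where
    e = E a k
    a<k : a + e * N < k
    a<k = ℤ.≤∧≢⇒< (proj₁ (E-spec a k)) (λ eq → ¬k≋a (e , sym eq))
    lo = lia 3 (a , k , e * N) (λ a k x → a :+ x :< k ⊢ a :+ x :≤ k :- # 1) a<k
    hi = lia 3 (a , k , (e + 1ℤ) * N) (λ a k x → k :< a :+ x ⊢ k :- # 1 :< a :+ x) (proj₂ (E-spec a k))

  0≤E : ∀ {a k} → a ≤ k → 0ℤ ≤ E a k
  0≤E {a} {k} a≤k = E-≥ a k 0ℤ (lia 3 (a , k , N) (λ a k N → a :≤ k ⊢ a :+ # 0 :* N :≤ k) a≤k)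

  -1≤E : ∀ {a k} → a ≤ k + N → -1ℤ ≤ E a k
  -1≤E {a} {k} h = E-≥ a k -1ℤ (lia 3 (a , k , N) (λ a k N → a :≤ k :+ N ⊢ a :+ -# 1 :* N :≤ k) h)

  E≤0 : ∀ {a k} → k < a + N → E a k ≤ 0ℤ
  E≤0 {a} {k} h = lia 1 (E a k) (λ e → e :< # 1 ⊢ e :≤ # 0)
    (E-< a k 1ℤ (lia 3 (a , k , N) (λ a k N → k :< a :+ N ⊢ k :< a :+ # 1 :* N) h))

  E≤-1 : ∀ {a k} → k < a → E a k ≤ -1ℤ
  E≤-1 {a} {k} k<a = lia 1 (E a k) (λ e → e :< # 0 ⊢ e :≤ -# 1)
    (E-< a k 0ℤ (lia 3 (a , k , N) (λ a k N → k :< a ⊢ k :< a :+ # 0 :* N) k<a))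

  E≡0 : ∀ {a k} → a ≤ k → k < a + N → E a k ≡ 0ℤ
  E≡0 a≤k k<a+N = ℤ.≤-antisym (E≤0 k<a+N) (0≤E a≤k)

  E≡-1 : ∀ {a k} → k < a → a ≤ k + N → E a k ≡ -1ℤ
  E≡-1 k<a a≤k+N = ℤ.≤-antisym (E≤-1 k<a) (-1≤E a≤k+N)

  E-self : ∀ k → E k k ≡ 0ℤ
  E-self k = E≡0 ℤ.≤-refl (lia 2 (k , N) (λ k N → # 0 :< N ⊢ k :< k :+ N) 0<N)

  -- Sums over residue classes.

  Periodic : (ℤ → ℤ) → Set
  Periodic h = ∀ {i j} → i ≋ j → h i ≡ h j

  S : (ℤ → ℤ) → ℤ
  S h = ∑[ i < n ] h ⌜ i ⌝

  S-cong : ∀ {g h} → g ≗ h → S g ≡ S h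
  S-cong g≗h = sum-cong-≗ (g≗h ∘ ⌜_⌝)

  S-+ : ∀ g h → S (λ i → g i + h i) ≡ S g + S h
  S-+ g h = ∑-distrib-+ (g ∘ ⌜_⌝) (h ∘ ⌜_⌝)

  S-- : ∀ g h → S (λ i → g i - h i) ≡ S g - S h
  S-- g h = lia 3 (S (λ i → g i - h i) , S h , S g) (λ d h g → d :+ h :≡ g ⊢ d :≡ g :- h)
    (trans (sym (S-+ (λ i → g i - h i) h)) (S-cong λ i → lia 2 (g i , h i) λ g h → ⊢ g :- h :+ h :≡ g))

  S-mono : ∀ g h → (∀ i → g i ≤ h i) → S g ≤ S h
  S-mono g h g≤h = sum-mono _ _ (g≤h ∘ ⌜_⌝)

  private
    at-class : ∀ h → Periodic h → ∀ a → h ⌜ class a ⌝ ≡ h a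
    at-class h h-per a = h-per (≋-sym (≋-class a))

    class-≢ : ∀ {i a} → i ≢ class a → ¬ ⌜ i ⌝ ≋ a
    class-≢ {i} {a} i≢ i≋a = i≢ (⌜⌝-injective (≋-trans i≋a (≋-class a)))

    class-≢₂ : ∀ {a b} → ¬ a ≋ b → class a ≢ class b
    class-≢₂ {a} {b} ¬a≋b eq = ¬a≋b (≋-trans (≋-class a) (≋-trans (≋-reflexive (cong ⌜_⌝ eq)) (≋-sym (≋-class b))))

  S-single : ∀ h → Periodic h → ∀ a → (∀ i → ¬ i ≋ a → h i ≡ 0ℤ) → S h ≡ h a
  S-single h h-per a h≡0 = trans
    (sum-single (h ∘ ⌜_⌝) (class a) (λ i i≢ → h≡0 ⌜ i ⌝ (class-≢ i≢)))
    (at-class h h-per a)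

  S-two : ∀ h → Periodic h → ∀ a b → ¬ a ≋ b → (∀ i → ¬ i ≋ a → ¬ i ≋ b → h i ≡ 0ℤ) → S h ≡ h a + h b
  S-two h h-per a b ¬a≋b h≡0 = trans
    (sum-two (h ∘ ⌜_⌝) (class a) (class b) (class-≢₂ ¬a≋b)
      (λ i i≢ i≢′ → h≡0 ⌜ i ⌝ (class-≢ i≢) (class-≢ i≢′)))
    (cong₂ _+_ (at-class h h-per a) (at-class h h-per b))

  term≤S : ∀ h → Periodic h → (∀ i → 0ℤ ≤ h i) → ∀ a → h a ≤ S h
  term≤S h h-per 0≤h a = ℤ.≤-trans (ℤ.≤-reflexive (sym (at-class h h-per a)))
    (term≤sum (h ∘ ⌜_⌝) (0≤h ∘ ⌜_⌝) (class a))

  two-terms≤S : ∀ h → Periodic h → (∀ i → 0ℤ ≤ h i) → ∀ a b → ¬ a ≋ b → h a + h b ≤ S h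
  two-terms≤S h h-per 0≤h a b ¬a≋b =
    ℤ.≤-trans (ℤ.≤-reflexive (sym (cong₂ _+_ (at-class h h-per a) (at-class h h-per b))))
    (two-terms≤sum (h ∘ ⌜_⌝) (0≤h ∘ ⌜_⌝) (class a) (class b) (class-≢₂ ¬a≋b))

  -- By integrality a positive term is at least 1 and exhausts the sum, which squeezes every other
  -- class to 0. Later this singles out the one class that moves up and the one that moves down.
  S-one : ∀ h → Periodic h → (∀ i → 0ℤ ≤ h i) → S h ≡ 1ℤ →
          ∃ λ a → h a ≡ 1ℤ × (∀ i → ¬ i ≋ a → h i ≡ 0ℤ)
  S-one h h-per 0≤h S≡1 with r , 0<hr ← positive-term (h ∘ ⌜_⌝) (subst (0ℤ <_) (sym S≡1) (ℤ.+<+ (s≤s z≤n))) =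
    a , ℤ.≤-antisym (ℤ.≤-trans (term≤S h h-per 0≤h a) (ℤ.≤-reflexive S≡1)) (ℤ.i<j⇒suc[i]≤j 0<hr) ,
    λ i ¬i≋a → ℤ.≤-antisym
      (lia 3 (h i , h a , S h) (λ x y s → x :+ y :≤ s , s :≡ # 1 , # 0 :< y ⊢ x :≤ # 0)
        (two-terms≤S h h-per 0≤h i a ¬i≋a) S≡1 0<hr)
      (0≤h i)
    where a = ⌜ r ⌝

  S-δ : ∀ h → Periodic h → ∀ a → S (λ i → h i * δ i a) ≡ h a
  S-δ h h-per a = trans
    (S-single (λ i → h i * δ i a) (λ i≋j → cong₂ _*_ (h-per i≋j) (δ-cong i≋j ≋-refl)) a
      (λ i ¬i≋a → trans (cong (h i *_) (δ-no ¬i≋a)) (ℤ.*-zeroʳ (h i))))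
    (trans (cong (h a *_) (δ-yes (≋-refl {a}))) (ℤ.*-identityʳ (h a)))

  -- Vectors, roots and the invariant form

  infixl 8 _!_
  -- Vectors are read as periodic functions on ℤ, so that the cyclic neighbours of a node are
  -- `k - 1` and `k + 1`, also across 0.
  _!_ : Qaff → ℤ → ℤ
  μ ! k = lookup μ (class k)

  class-⌜⌝ : ∀ i → class ⌜ i ⌝ ≡ i
  class-⌜⌝ i = sym (⌜⌝-injective (≋-class ⌜ i ⌝))

  !-⌜⌝ : ∀ μ i → μ ! ⌜ i ⌝ ≡ lookup μ i
  !-⌜⌝ μ i = cong (lookup μ) (class-⌜⌝ i)

  !-periodic : ∀ μ → Periodic (μ !_)
  !-periodic μ {i} {j} i≋j = cong (lookup μ)
    (⌜⌝-injective (≋-trans (≋-sym (≋-class i)) (≋-trans i≋j (≋-class j))))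

  !-ext : ∀ {μ ν} → (∀ k → μ ! k ≡ ν ! k) → μ ≡ ν
  !-ext {μ} {ν} eq = trans (sym (Vec.tabulate∘lookup μ)) (trans
    (Vec.tabulate-cong λ i → trans (sym (!-⌜⌝ μ i)) (trans (eq ⌜ i ⌝) (!-⌜⌝ ν i))) (Vec.tabulate∘lookup ν))

  ⊕-! : ∀ μ ν k → (μ ⊕ ν) ! k ≡ μ ! k + ν ! k
  ⊕-! μ ν k = Vec.lookup-zipWith _+_ (class k) μ ν

  ⊖-! : ∀ μ ν k → (μ ⊖ ν) ! k ≡ μ ! k - ν ! k
  ⊖-! μ ν k = Vec.lookup-zipWith _-_ (class k) μ ν

  ·-! : ∀ x μ k → (x · μ) ! k ≡ x * μ ! k
  ·-! x μ k = Vec.lookup-map (class k) (x *_) μ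

  𝟎-! : ∀ k → 𝟎 ! k ≡ 0ℤ
  𝟎-! k = Vec.lookup-replicate (class k) 0ℤ

  c-! : ∀ k → c ! k ≡ 1ℤ
  c-! k = Vec.lookup-replicate (class k) 1ℤ

  tabulate-! : ∀ {h} → Periodic h → ∀ k → tabulate (h ∘ ⌜_⌝) ! k ≡ h k
  tabulate-! {h} h-per k = trans (Vec.lookup∘tabulate (h ∘ ⌜_⌝) (class k)) (h-per (≋-sym (≋-class k)))

  root : ℤ → ℤ → Qaff
  root a b = tabulate λ i → E a ⌜ i ⌝ - E b ⌜ i ⌝

  E-E-periodic : ∀ a b → Periodic (λ k → E a k - E b k)
  E-E-periodic a b {i} {j} (m , eq) = trans (cong (λ k → E a k - E b k) eq)
    (lia 5 (E a j , E b j , m , E a (j + m * N) , E b (j + m * N))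
      (λ a b m a′ b′ → a′ :≡ a :+ m , b′ :≡ b :+ m ⊢ a′ :- b′ :≡ a :- b)
      (E-shiftʳ a j m) (E-shiftʳ b j m))

  root-! : ∀ a b k → root a b ! k ≡ E a k - E b k
  root-! a b = tabulate-! (E-E-periodic a b)

  E-δ : ∀ a k → E a k - E (a + 1ℤ) k ≡ δ k a
  E-δ a k = lia 4 (E a k , E (a + 1ℤ) k , E a (k - 1ℤ) , δ k a)
    (λ x y z d → x :≡ z :+ d , y :≡ z ⊢ x :- y :≡ d) (E-jump a k) (E-suc a k)

  root-δ : ∀ a k → root a (a + 1ℤ) ! k ≡ δ k a
  root-δ a k = trans (root-! a (a + 1ℤ) k) (E-δ a k)

  α-root : ∀ i → α[ i ] ≡ root ⌜ i ⌝ (⌜ i ⌝ + 1ℤ)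
  α-root i = !-ext λ k → trans (trans (Vec.lookup∘tabulate (λ j → if ⌊ i Fin.≟ j ⌋ then 1ℤ else 0ℤ) (class k)) (at (class k)))
      (trans (δ-cong (≋-sym (≋-class k)) ≋-refl) (sym (root-δ ⌜ i ⌝ k)))
    where
    at : ∀ j → (if ⌊ i Fin.≟ j ⌋ then 1ℤ else 0ℤ) ≡ δ ⌜ j ⌝ ⌜ i ⌝
    at j with i Fin.≟ j
    ... | yes refl = sym (δ-yes ≋-refl)
    ... | no i≢j   = sym (δ-no λ j≋i → i≢j (sym (⌜⌝-injective j≋i)))

  ¬≋-1 : ∀ i → ¬ i ≋ i + 1ℤ
  ¬≋-1 i = ≋-apart (lia 1 i λ i → ⊢ i :< i :+ # 1)
    (lia 2 (i , N) (λ i N → # 3 :≤ N ⊢ i :+ # 1 :< i :+ N) 3≤N)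

  ¬≋-2 : ∀ i → ¬ i ≋ i + + 2
  ¬≋-2 i = ≋-apart (lia 1 i λ i → ⊢ i :< i :+ # 2)
    (lia 2 (i , N) (λ i N → # 3 :≤ N ⊢ i :+ # 2 :< i :+ N) 3≤N)

  -- The nested conditionals may be added up because their conditions exclude each other; for
  -- `j = i + 1` against `i = j + 1` this rests on `i` and `i + 2` being distinct modulo n, that is
  -- on n ≥ 3.
  cartan-δ : ∀ i j → cartan i j ≡ + 2 * δ ⌜ j ⌝ ⌜ i ⌝ - δ ⌜ j ⌝ (⌜ i ⌝ + 1ℤ) - δ (⌜ j ⌝ + 1ℤ) ⌜ i ⌝
  cartan-δ i j with i Fin.≟ j | j Fin.≟ next i | i Fin.≟ next j
  ... | yes refl | _ | _ = sym (trans (cong₂ _-_ (cong₂ _-_ (cong (+ 2 *_) (δ-yes ≋-refl)) (δ-no (¬≋-1 ⌜ i ⌝)))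
                             (δ-no (¬≋-1 ⌜ i ⌝ ∘ ≋-sym))) refl)
  ... | no i≢j | yes j≡ | _ = sym (cong₂ _-_ (cong₂ _-_ (cong (+ 2 *_) (δ-no (i≢j ∘ sym ∘ ⌜⌝-injective)))
                                (δ-yes j≋i+1)) (δ-no j+1≢i))
    where
    j≋i+1 : ⌜ j ⌝ ≋ ⌜ i ⌝ + 1ℤ
    j≋i+1 = ≋-trans (≋-reflexive (cong ⌜_⌝ j≡)) (next≋ i)
    j+1≢i : ¬ ⌜ j ⌝ + 1ℤ ≋ ⌜ i ⌝
    j+1≢i eq = ¬≋-2 ⌜ i ⌝ (≋-trans (≋-sym eq) (≋-trans (≋-+ 1ℤ j≋i+1) (≋-reflexive (ℤ.+-assoc ⌜ i ⌝ 1ℤ 1ℤ))))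
  ... | no i≢j | no j≢ | yes i≡ = sym (cong₂ _-_ (cong₂ _-_ (cong (+ 2 *_) (δ-no (i≢j ∘ sym ∘ ⌜⌝-injective)))
                                    (δ-no λ eq → j≢ (⌜⌝-injective (≋-trans eq (≋-sym (next≋ i))))))
                                    (δ-yes (≋-sym (≋-trans (≋-reflexive (cong ⌜_⌝ i≡)) (next≋ j)))))
  ... | no i≢j | no j≢ | no i≢ = sym (cong₂ _-_ (cong₂ _-_ (cong (+ 2 *_) (δ-no (i≢j ∘ sym ∘ ⌜⌝-injective)))
                                    (δ-no λ eq → j≢ (⌜⌝-injective (≋-trans eq (≋-sym (next≋ i))))))
                                    (δ-no λ eq → i≢ (⌜⌝-injective (≋-trans (≋-sym eq) (≋-sym (next≋ j))))))

  cartan-sym : ∀ i j → cartan i j ≡ cartan j i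
  cartan-sym i j = trans (cartan-δ i j) (trans
    (lia 6 (δ ⌜ j ⌝ ⌜ i ⌝ , δ ⌜ i ⌝ ⌜ j ⌝ , δ ⌜ j ⌝ (⌜ i ⌝ + 1ℤ) , δ (⌜ i ⌝ + 1ℤ) ⌜ j ⌝ , δ (⌜ j ⌝ + 1ℤ) ⌜ i ⌝ , δ ⌜ i ⌝ (⌜ j ⌝ + 1ℤ))
      (λ a a′ b b′ d d′ → # 2 :* a :≡ # 2 :* a′ , b :≡ b′ , d :≡ d′ ⊢
        # 2 :* a :- b :- d :≡ # 2 :* a′ :- d′ :- b′)
      (cong (+ 2 *_) (δ-sym ⌜ j ⌝ ⌜ i ⌝)) (δ-sym ⌜ j ⌝ _) (δ-sym _ ⌜ i ⌝))
    (sym (cartan-δ j i)))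

  ⟨⟩-sym : ∀ μ ν → ⟨ μ , ν ⟩ ≡ ⟨ ν , μ ⟩
  ⟨⟩-sym μ ν = trans (∑-comm λ i j → lookup μ i * cartan i j * lookup ν j)
    (sum-cong-≗ λ j → sum-cong-≗ λ i →
      trans (cong (λ x → lookup μ i * x * lookup ν j) (cartan-sym i j))
        (lia 3 (lookup μ i , cartan j i , lookup ν j) λ m x v → ⊢ m :* x :* v :≡ v :* x :* m))

  S-δ-next : ∀ h → Periodic h → ∀ a → S (λ i → h i * δ (i + 1ℤ) a) ≡ h (a - 1ℤ)
  S-δ-next h h-per a = trans (S-cong λ i → cong (h i *_) (at i)) (S-δ h h-per (a - 1ℤ))
    where
    back : ∀ {i} → i + 1ℤ ≋ a → i ≋ a - 1ℤ
    back {i} eq = ≋-trans (≋-reflexive (lia 1 i λ i → ⊢ i :≡ i :+ # 1 :+ -# 1)) (≋-+ -1ℤ eq)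
    forth : ∀ {i} → i ≋ a - 1ℤ → i + 1ℤ ≋ a
    forth {i} eq = ≋-trans (≋-+ 1ℤ eq) (≋-reflexive (lia 1 a λ a → ⊢ a :- # 1 :+ # 1 :≡ a))
    at : ∀ i → δ (i + 1ℤ) a ≡ δ i (a - 1ℤ)
    at i with i ≋? a - 1ℤ
    ... | yes eq = trans (δ-yes (forth eq)) (sym (δ-yes eq))
    ... | no neq = trans (δ-no (neq ∘ back)) (sym (δ-no neq))

  -- The coefficient of μ_i in ⟨ μ , ε_a - ε_b ⟩.
  hook : ℤ → ℤ → ℤ → ℤ
  hook a b i = (δ i a - δ i b) - (δ (i + 1ℤ) a - δ (i + 1ℤ) b)

  -- The Cartan matrix is a discrete Laplacian on the cycle: `2f(i) - f(i+1) - f(i-1)` is a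
  -- difference of two consecutive increments of `f`, and the increments of `E` are the deltas of
  -- `E-jump`.
  hook-root : ∀ a b i → + 2 * root a b ! i - root a b ! (i + 1ℤ) - root a b ! (i - 1ℤ) ≡ hook a b i
  hook-root a b i = trans
    (cong₂ _-_ (cong₂ _-_ (cong (+ 2 *_) (root-! a b i)) (root-! a b (i + 1ℤ))) (root-! a b (i - 1ℤ)))
    (lia 10 (E a i , E a (i + 1ℤ) , E a (i - 1ℤ) , δ i a , δ (i + 1ℤ) a ,
          E b i , E b (i + 1ℤ) , E b (i - 1ℤ) , δ i b , δ (i + 1ℤ) b)
      (λ a a⁺ a⁻ d d⁺ b b⁺ b⁻ e e⁺ → a :≡ a⁻ :+ d , a⁺ :≡ a :+ d⁺ , b :≡ b⁻ :+ e , b⁺ :≡ b :+ e⁺ ⊢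
        # 2 :* (a :- b) :- (a⁺ :- b⁺) :- (a⁻ :- b⁻) :≡ (d :- e) :- (d⁺ :- e⁺))
      (E-jump a i) (jump⁺ a) (E-jump b i) (jump⁺ b))
    where
    jump⁺ : ∀ a → E a (i + 1ℤ) ≡ E a i + δ (i + 1ℤ) a
    jump⁺ a = trans (E-jump a (i + 1ℤ))
      (cong (λ k → E a k + δ (i + 1ℤ) a) (lia 1 i λ i → ⊢ i :+ # 1 :- # 1 :≡ i))

  cartan-row : ∀ i ν → ∑[ j < n ] (cartan i j * lookup ν j) ≡
               + 2 * ν ! ⌜ i ⌝ - ν ! (⌜ i ⌝ + 1ℤ) - ν ! (⌜ i ⌝ - 1ℤ)
  cartan-row i ν = begin
    ∑[ j < n ] (cartan i j * lookup ν j)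
      ≡⟨ sum-cong-≗ (λ j → trans (cong₂ _*_ (cartan-δ i j) (sym (!-⌜⌝ ν j)))
           (lia 4 (δ ⌜ j ⌝ ⌜ i ⌝ , δ ⌜ j ⌝ (⌜ i ⌝ + 1ℤ) , δ (⌜ j ⌝ + 1ℤ) ⌜ i ⌝ , ν ! ⌜ j ⌝)
             (λ x y z v → ⊢ (# 2 :* x :- y :- z) :* v :≡ # 2 :* (v :* x) :- v :* y :- v :* z))) ⟩
    S (λ j → + 2 * A j - B j - C j)       ≡⟨ S-- (λ j → + 2 * A j - B j) C ⟩
    S (λ j → + 2 * A j - B j) - S C       ≡⟨ cong (_- S C) (S-- (λ j → + 2 * A j) B) ⟩
    S (λ j → + 2 * A j) - S B - S C
      ≡⟨ cong₂ (λ x y → x - y - S C) (trans (sym (*-distribˡ-sum (+ 2) (A ∘ ⌜_⌝))) (cong (+ 2 *_) (S-δ (ν !_) ν-per ⌜ i ⌝)))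
           (S-δ (ν !_) ν-per (⌜ i ⌝ + 1ℤ)) ⟩
    + 2 * ν ! ⌜ i ⌝ - ν ! (⌜ i ⌝ + 1ℤ) - S C
      ≡⟨ cong (λ z → + 2 * ν ! ⌜ i ⌝ - ν ! (⌜ i ⌝ + 1ℤ) - z) (S-δ-next (ν !_) ν-per ⌜ i ⌝) ⟩
    + 2 * ν ! ⌜ i ⌝ - ν ! (⌜ i ⌝ + 1ℤ) - ν ! (⌜ i ⌝ - 1ℤ) ∎
    where
    open ≡-Reasoning
    A B C : ℤ → ℤ
    A j = ν ! j * δ j ⌜ i ⌝
    B j = ν ! j * δ j (⌜ i ⌝ + 1ℤ)
    C j = ν ! j * δ (j + 1ℤ) ⌜ i ⌝
    ν-per : Periodic (ν !_)
    ν-per = !-periodic ν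

  ⟨⟩-root : ∀ μ a b → ⟨ μ , root a b ⟩ ≡ S (λ i → μ ! i * hook a b i)
  ⟨⟩-root μ a b = sum-cong-≗ λ i → begin
    ∑[ j < n ] (lookup μ i * cartan i j * lookup ν j) ≡⟨ sum-cong-≗ (λ j → ℤ.*-assoc (lookup μ i) (cartan i j) (lookup ν j)) ⟩
    ∑[ j < n ] (lookup μ i * (cartan i j * lookup ν j)) ≡⟨ *-distribˡ-sum (lookup μ i) (λ j → cartan i j * lookup ν j) ⟨
    lookup μ i * (∑[ j < n ] (cartan i j * lookup ν j))
      ≡⟨ cong₂ _*_ (sym (!-⌜⌝ μ i)) (trans (cartan-row i ν) (hook-root a b ⌜ i ⌝)) ⟩
    μ ! ⌜ i ⌝ * hook a b ⌜ i ⌝ ∎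
    where
    open ≡-Reasoning
    ν : Qaff
    ν = root a b

  -- `hook` turns the pairing into increments of the first root at `i` and `j`, and `E-jump` turns
  -- these into deltas: the ε of distinct classes behave as orthonormal vectors.
  ⟨root,root⟩ : ∀ a b i j → ⟨ root a b , root i j ⟩ ≡ (δ i a - δ i b) - (δ j a - δ j b)
  ⟨root,root⟩ a b i j = begin
    ⟨ root a b , root i j ⟩ ≡⟨ ⟨⟩-root (root a b) i j ⟩
    S (λ k → h k * hook i j k)
      ≡⟨ S-cong (λ k → lia 5 (h k , δ k i , δ k j , δ (k + 1ℤ) i , δ (k + 1ℤ) j)
           λ h x y z w → ⊢ h :* ((x :- y) :- (z :- w)) :≡ (h :* x :- h :* y) :- (h :* z :- h :* w)) ⟩
    S (λ k → (h k * δ k i - h k * δ k j) - (h k * δ (k + 1ℤ) i - h k * δ (k + 1ℤ) j))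
      ≡⟨ S-- (λ k → h k * δ k i - h k * δ k j) (λ k → h k * δ (k + 1ℤ) i - h k * δ (k + 1ℤ) j) ⟩
    S (λ k → h k * δ k i - h k * δ k j) - S (λ k → h k * δ (k + 1ℤ) i - h k * δ (k + 1ℤ) j)
      ≡⟨ cong₂ _-_ (trans (S-- (λ k → h k * δ k i) (λ k → h k * δ k j)) (cong₂ _-_ (S-δ h h-per i) (S-δ h h-per j)))
           (trans (S-- (λ k → h k * δ (k + 1ℤ) i) (λ k → h k * δ (k + 1ℤ) j)) (cong₂ _-_ (S-δ-next h h-per i) (S-δ-next h h-per j))) ⟩
    (h i - h j) - (h (i - 1ℤ) - h (j - 1ℤ))
      ≡⟨ cong₂ _-_ (cong₂ _-_ (root-! a b i) (root-! a b j)) (cong₂ _-_ (root-! a b (i - 1ℤ)) (root-! a b (j - 1ℤ))) ⟩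
    ((E a i - E b i) - (E a j - E b j)) - ((E a (i - 1ℤ) - E b (i - 1ℤ)) - (E a (j - 1ℤ) - E b (j - 1ℤ)))
      ≡⟨ lia 12 (E a i , E b i , E a j , E b j , E a (i - 1ℤ) , E b (i - 1ℤ) , E a (j - 1ℤ) , E b (j - 1ℤ) ,
              δ i a , δ i b , δ j a , δ j b)
           (λ ai bi aj bj ai′ bi′ aj′ bj′ dia dib dja djb →
             ai :≡ ai′ :+ dia , bi :≡ bi′ :+ dib , aj :≡ aj′ :+ dja , bj :≡ bj′ :+ djb ⊢
             ((ai :- bi) :- (aj :- bj)) :- ((ai′ :- bi′) :- (aj′ :- bj′)) :≡ (dia :- dib) :- (dja :- djb))
           (E-jump a i) (E-jump b i) (E-jump a j) (E-jump b j) ⟩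
    (δ i a - δ i b) - (δ j a - δ j b) ∎
    where
    open ≡-Reasoning
    h : ℤ → ℤ
    h k = root a b ! k
    h-per : Periodic h
    h-per = !-periodic (root a b)

  -- Affine permutations and their action

  record AffinePermutation : Set where
    field
      to from : ℤ → ℤ
      to-+    : ∀ i k → to (i + k * N) ≡ to i + k * N
      from-to : ∀ i → from (to i) ≡ i
      to-from : ∀ i → to (from i) ≡ i

    to-injective : ∀ {i j} → to i ≡ to j → i ≡ j
    to-injective {i} {j} eq = trans (sym (from-to i)) (trans (cong from eq) (from-to j))

    from-+ : ∀ i k → from (i + k * N) ≡ from i + k * N
    from-+ i k = to-injective (trans (to-from _) (sym (trans (to-+ (from i) k) (cong (_+ k * N) (to-from i)))))

    to-≋ : ∀ {i j} → i ≋ j → to i ≋ to j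
    to-≋ {i} {j} (k , eq) = k , trans (cong to eq) (to-+ j k)

    from-≋ : ∀ {i j} → i ≋ j → from i ≋ from j
    from-≋ {i} {j} (k , eq) = k , trans (cong from eq) (from-+ j k)

    to-≋⁻¹ : ∀ {i j} → to i ≋ to j → i ≋ j
    to-≋⁻¹ {i} {j} (k , eq) = k , to-injective (trans eq (sym (to-+ j k)))

    E-to-periodic : ∀ k → Periodic (λ i → E (to i) k - E (to (i + 1ℤ)) k)
    E-to-periodic k {i} {j} (m , refl) = trans
      (cong₂ (λ x y → E x k - E y k) (to-+ j m)
        (trans (cong to (lia 3 (j , m , N) λ j m N → ⊢ j :+ m :* N :+ # 1 :≡ j :+ # 1 :+ m :* N)) (to-+ (j + 1ℤ) m)))
      (trans (cong₂ _-_ (E-shiftˡ (to j) k m) (E-shiftˡ (to (j + 1ℤ)) k m))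
        (lia 3 (E (to j) k , E (to (j + 1ℤ)) k , m) λ x y m → ⊢ (x :- m) :- (y :- m) :≡ x :- y))

  open AffinePermutation

  idₚ : AffinePermutation
  idₚ = record { to = id ; from = id ; to-+ = λ _ _ → refl ; from-to = λ _ → refl ; to-from = λ _ → refl }

  infixr 9 _∙_
  _∙_ : AffinePermutation → AffinePermutation → AffinePermutation
  σ ∙ π = record
    { to      = to σ ∘ to π
    ; from    = from π ∘ from σ
    ; to-+    = λ i k → trans (cong (to σ) (to-+ π i k)) (to-+ σ (to π i) k)
    ; from-to = λ i → trans (cong (from π) (from-to σ (to π i))) (from-to π i)
    ; to-from = λ i → trans (cong (to σ) (to-from π (from σ i))) (to-from σ i)
    }

  -- The identity when a ≋ b.
  opaque
    swap : ℤ → ℤ → ℤ → ℤ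
    swap a b i = i + (b - a) * (δ i a - δ i b)

    swap-at : ∀ a b i {x y} → δ i a ≡ x → δ i b ≡ y → swap a b i ≡ i + (b - a) * (x - y)
    swap-at a b i = cong₂ (λ x y → i + (b - a) * (x - y))

  swap-≋ˡ : ∀ {a b i} → ¬ a ≋ b → i ≋ a → swap a b i ≡ i + (b - a)
  swap-≋ˡ {a} {b} {i} a≢b i≋a = trans (swap-at a b i (δ-yes i≋a) (δ-no (a≢b ∘ ≋-trans (≋-sym i≋a))))
    (lia 3 (a , b , i) λ a b i → ⊢ i :+ (b :- a) :* (# 1 :- # 0) :≡ i :+ (b :- a))

  swap-≋ʳ : ∀ {a b i} → ¬ a ≋ b → i ≋ b → swap a b i ≡ i - (b - a)
  swap-≋ʳ {a} {b} {i} a≢b i≋b = trans (swap-at a b i (δ-no (λ i≋a → a≢b (≋-trans (≋-sym i≋a) i≋b))) (δ-yes i≋b))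
    (lia 3 (a , b , i) λ a b i → ⊢ i :+ (b :- a) :* (# 0 :- # 1) :≡ i :- (b :- a))

  swap-fix : ∀ {a b i} → ¬ i ≋ a → ¬ i ≋ b → swap a b i ≡ i
  swap-fix {a} {b} {i} i≢a i≢b = trans (swap-at a b i (δ-no i≢a) (δ-no i≢b))
    (lia 3 (a , b , i) λ a b i → ⊢ i :+ (b :- a) :* (# 0 :- # 0) :≡ i)

  swap-left : ∀ {a b} → ¬ a ≋ b → swap a b a ≡ b
  swap-left {a} {b} a≢b = trans (swap-≋ˡ a≢b ≋-refl) (lia 2 (a , b) λ a b → ⊢ a :+ (b :- a) :≡ b)

  swap-right : ∀ {a b} → ¬ a ≋ b → swap a b b ≡ a
  swap-right {a} {b} a≢b = trans (swap-≋ʳ a≢b ≋-refl) (lia 2 (a , b) λ a b → ⊢ b :- (b :- a) :≡ a)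

  swap-≋ : ∀ {a b} i → a ≋ b → swap a b i ≡ i
  swap-≋ {a} {b} i a≋b = trans (swap-at a b i refl (δ-cong (≋-refl {i}) (≋-sym a≋b)))
    (lia 4 (a , b , i , δ i a) λ a b i x → ⊢ i :+ (b :- a) :* (x :- x) :≡ i)

  swap-+ : ∀ a b i k → swap a b (i + k * N) ≡ swap a b i + k * N
  swap-+ a b i k = trans (swap-at a b (i + k * N) (δ-cong (≋-+N i k) ≋-refl) (δ-cong (≋-+N i k) ≋-refl))
    (trans (lia 4 (i , k , N , (b - a) * (δ i a - δ i b)) λ i k N x → ⊢ i :+ k :* N :+ x :≡ i :+ x :+ k :* N)
      (cong (_+ k * N) (sym (swap-at a b i refl refl))))

  swap-involutive : ∀ a b i → swap a b (swap a b i) ≡ i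
  swap-involutive a b i with a ≋? b
  ... | yes a≋b = trans (cong (swap a b) (swap-≋ i a≋b)) (swap-≋ i a≋b)
  ... | no a≢b with i ≋? a | i ≋? b
  ...   | yes i≋a@(k , eq) | _ = trans (cong (swap a b) (swap-≋ˡ a≢b i≋a)) (trans
            (swap-≋ʳ a≢b (k , lia 4 (a , b , i , k * N) (λ a b i x → i :≡ a :+ x ⊢ i :+ (b :- a) :≡ b :+ x) eq))
            (lia 3 (a , b , i) λ a b i → ⊢ i :+ (b :- a) :- (b :- a) :≡ i))
  ...   | no _   | yes i≋b@(k , eq) = trans (cong (swap a b) (swap-≋ʳ a≢b i≋b)) (trans
            (swap-≋ˡ a≢b (k , lia 4 (a , b , i , k * N) (λ a b i x → i :≡ b :+ x ⊢ i :- (b :- a) :≡ a :+ x) eq))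
            (lia 3 (a , b , i) λ a b i → ⊢ i :- (b :- a) :+ (b :- a) :≡ i))
  ...   | no i≢a | no i≢b  = trans (cong (swap a b) (swap-fix i≢a i≢b)) (swap-fix i≢a i≢b)

  swapₚ : ℤ → ℤ → AffinePermutation
  swapₚ a b = record
    { to = swap a b ; from = swap a b ; to-+ = swap-+ a b
    ; from-to = swap-involutive a b ; to-from = swap-involutive a b }

  swap-cong : ∀ {a b a′ b′} → a ≋ a′ → b - a ≡ b′ - a′ → swap a b ≗ swap a′ b′
  swap-cong {a} {b} {a′} {b′} a≋a′@(k , eq) diff i = trans
    (swap-at a b i (δ-cong (≋-refl {i}) a≋a′) (δ-cong (≋-refl {i}) (k , lia 5 (a , b , a′ , b′ , k * N)
      (λ a b a′ b′ x → a :≡ a′ :+ x , b :- a :≡ b′ :- a′ ⊢ b :≡ b′ :+ x) eq diff)))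
    (trans (cong (λ z → i + z * (δ i a′ - δ i b′)) diff) (sym (swap-at a′ b′ i refl refl)))

  swap-conj : ∀ σ {a b} → ¬ a ≋ b → ∀ i → to σ (swap a b i) ≡ swap (to σ a) (to σ b) (to σ i)
  swap-conj σ {a} {b} a≢b i with i ≋? a | i ≋? b
  ... | yes i≋a@(k , eq) | _ = trans (cong (to σ) (trans (swap-≋ˡ a≢b i≋a)
          (lia 4 (a , b , i , k * N) (λ a b i x → i :≡ a :+ x ⊢ i :+ (b :- a) :≡ b :+ x) eq)))
        (trans (to-+ σ b k) (sym (trans (swap-≋ˡ (a≢b ∘ to-≋⁻¹ σ) (to-≋ σ i≋a))
          (lia 4 (to σ a , to σ b , to σ i , k * N) (λ a b i x → i :≡ a :+ x ⊢ i :+ (b :- a) :≡ b :+ x)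
            (trans (cong (to σ) eq) (to-+ σ a k))))))
  ... | no _ | yes i≋b@(k , eq) = trans (cong (to σ) (trans (swap-≋ʳ a≢b i≋b)
          (lia 4 (a , b , i , k * N) (λ a b i x → i :≡ b :+ x ⊢ i :- (b :- a) :≡ a :+ x) eq)))
        (trans (to-+ σ a k) (sym (trans (swap-≋ʳ (a≢b ∘ to-≋⁻¹ σ) (to-≋ σ i≋b))
          (lia 4 (to σ a , to σ b , to σ i , k * N) (λ a b i x → i :≡ b :+ x ⊢ i :- (b :- a) :≡ a :+ x)
            (trans (cong (to σ) eq) (to-+ σ b k))))))
  ... | no i≢a | no i≢b = trans (cong (to σ) (swap-fix i≢a i≢b))
        (sym (swap-fix (i≢a ∘ to-≋⁻¹ σ) (i≢b ∘ to-≋⁻¹ σ)))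

  -- The reflection formula before summation: on every translate of `a` or `b` the exchange changes
  -- ε_{σ i} by plus or minus ε_{σ a} - ε_{σ b}.
  E-swap : ∀ σ {a b} → ¬ a ≋ b → ∀ i k → E (to σ (swap a b i)) k ≡
           E (to σ i) k - (δ i a - δ i b) * (E (to σ a) k - E (to σ b) k)
  E-swap σ {a} {b} a≢b i k with i ≋? a | i ≋? b
  ... | yes i≋a@(m , eq) | yes i≋b = contradiction (≋-trans (≋-sym i≋a) i≋b) a≢b
  ... | yes i≋a@(m , refl) | no i≢b = begin
        E (to σ (swap a b i)) k        ≡⟨ cong (λ z → E (to σ z) k) (trans (swap-+ a b a m) (cong (_+ m * N) (swap-left a≢b))) ⟩
        E (to σ (b + m * N)) k     ≡⟨ shifted b ⟩
        E (to σ b) k - m             ≡⟨ lia 4 (E (to σ i) k , E (to σ a) k , E (to σ b) k , m)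
                                            (λ i a b m → i :≡ a :- m ⊢ b :- m :≡ i :- (# 1 :- # 0) :* (a :- b)) (shifted a) ⟩
        E (to σ i) k - (1ℤ - 0ℤ) * (E (to σ a) k - E (to σ b) k)
          ≡⟨ cong (λ d → E (to σ i) k - d * (E (to σ a) k - E (to σ b) k)) (cong₂ _-_ (δ-yes i≋a) (δ-no i≢b)) ⟨
        E (to σ i) k - (δ i a - δ i b) * (E (to σ a) k - E (to σ b) k) ∎
    where
    open ≡-Reasoning
    shifted : ∀ x → E (to σ (x + m * N)) k ≡ E (to σ x) k - m
    shifted x = trans (cong (λ z → E z k) (to-+ σ x m)) (E-shiftˡ (to σ x) k m)
  ... | no i≢a | yes i≋b@(m , refl) = begin
        E (to σ (swap a b i)) k        ≡⟨ cong (λ z → E (to σ z) k) (trans (swap-+ a b b m) (cong (_+ m * N) (swap-right a≢b))) ⟩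
        E (to σ (a + m * N)) k     ≡⟨ shifted a ⟩
        E (to σ a) k - m             ≡⟨ lia 4 (E (to σ i) k , E (to σ a) k , E (to σ b) k , m)
                                            (λ i a b m → i :≡ b :- m ⊢ a :- m :≡ i :- (# 0 :- # 1) :* (a :- b)) (shifted b) ⟩
        E (to σ i) k - (0ℤ - 1ℤ) * (E (to σ a) k - E (to σ b) k)
          ≡⟨ cong (λ d → E (to σ i) k - d * (E (to σ a) k - E (to σ b) k)) (cong₂ _-_ (δ-no i≢a) (δ-yes i≋b)) ⟨
        E (to σ i) k - (δ i a - δ i b) * (E (to σ a) k - E (to σ b) k) ∎
    where
    open ≡-Reasoning
    shifted : ∀ x → E (to σ (x + m * N)) k ≡ E (to σ x) k - m
    shifted x = trans (cong (λ z → E z k) (to-+ σ x m)) (E-shiftˡ (to σ x) k m)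
  ... | no i≢a | no i≢b = trans (cong (λ z → E (to σ z) k) (swap-fix i≢a i≢b))
        (trans (lia 3 (E (to σ i) k , E (to σ a) k , E (to σ b) k) λ i a b → ⊢ i :≡ i :- (# 0 :- # 0) :* (a :- b))
          (cong (λ d → E (to σ i) k - d * (E (to σ a) k - E (to σ b) k)) (sym (cong₂ _-_ (δ-no i≢a) (δ-no i≢b)))))

  differences-determine : ∀ (f g : ℤ → ℤ) a → f a ≡ g a →
    (∀ j → f (j + 1ℤ) - f j ≡ g (j + 1ℤ) - g j) → f ≗ g
  differences-determine f g a fa≡ga Δ≡ j with j - a in eq
  ... | + m = subst (λ z → f z ≡ g z) (lia 3 (a , + m , j) (λ a m j → j :- a :≡ m ⊢ a :+ m :≡ j) eq) (up m)
    where
    up : ∀ m → f (a + + m) ≡ g (a + + m)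
    up zero    = trans (cong f (ℤ.+-identityʳ a)) (trans fa≡ga (cong g (sym (ℤ.+-identityʳ a))))
    up (suc m) = subst (λ z → f z ≡ g z) (lia 2 (a , + m) λ a m → ⊢ a :+ m :+ # 1 :≡ a :+ (# 1 :+ m))
      (lia 4 (f (a + + m + 1ℤ) , g (a + + m + 1ℤ) , f (a + + m) , g (a + + m))
        (λ x y z w → x :- z :≡ y :- w , z :≡ w ⊢ x :≡ y) (Δ≡ (a + + m)) (up m))
  ... | -[1+ m ] = subst (λ z → f z ≡ g z) (lia 3 (a , + suc m , j) (λ a m j → j :- a :≡ neg m ⊢ a :- m :≡ j) eq) (down (suc m))
    where
    down : ∀ m → f (a - + m) ≡ g (a - + m)
    down zero    = trans (cong f (ℤ.+-identityʳ a)) (trans fa≡ga (cong g (sym (ℤ.+-identityʳ a))))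
    down (suc m) = lia 4 (f (b + 1ℤ) , g (b + 1ℤ) , f b , g b)
        (λ x y z w → x :- z :≡ y :- w , x :≡ y ⊢ z :≡ w) (Δ≡ b)
        (subst (λ z → f z ≡ g z) (lia 2 (a , + m) λ a m → ⊢ a :- m :≡ a :- (# 1 :+ m) :+ # 1) (down m))
      where
      b : ℤ
      b = a - + suc m

  -- The linear map with α_i ↦ ε_{σ i} - ε_{σ (i+1)}.
  act : (ℤ → ℤ) → Endo
  act σ μ = tabulate λ k → S (λ i → μ ! i * (E (σ i) ⌜ k ⌝ - E (σ (i + 1ℤ)) ⌜ k ⌝))

  act-! : ∀ σ μ k → act σ μ ! k ≡ S (λ i → μ ! i * (E (σ i) k - E (σ (i + 1ℤ)) k))
  act-! σ μ = tabulate-! λ {j} {k} j≋k → S-cong λ i → cong (μ ! i *_) (E-E-periodic (σ i) (σ (i + 1ℤ)) {j} {k} j≋k)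

  act-cong : ∀ {σ π} → σ ≗ π → act σ ≗ act π
  act-cong {σ} {π} σ≗π μ = !-ext λ k → trans (act-! σ μ k) (trans
    (S-cong λ i → cong₂ (λ x y → μ ! i * (E x k - E y k)) (σ≗π i) (σ≗π (i + 1ℤ)))
    (sym (act-! π μ k)))

  act-id : act id ≗ id
  act-id μ = !-ext λ k → trans (act-! id μ k) (trans
    (S-cong λ i → cong (μ ! i *_) (trans (E-δ i k) (δ-sym k i)))
    (S-δ (μ !_) (!-periodic μ) k))

  -- For fixed `a` both sides vanish at `b = a`, and both gain ε_{σ j} - ε_{σ(j+1)} when `b` goes
  -- from `j` to `j + 1`.
  act-root : ∀ σ a b → act (to σ) (root a b) ≡ root (to σ a) (to σ b)
  act-root σ a b = !-ext λ k → trans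
      (differences-determine (λ j → act (to σ) (root a j) ! k) (λ j → E (to σ a) k - E (to σ j) k) a
        (base k) (increment k) b)
      (sym (root-! (to σ a) (to σ b) k))
    where
    base : ∀ k → act (to σ) (root a a) ! k ≡ E (to σ a) k - E (to σ a) k
    base k = trans (act-! (to σ) (root a a) k) (trans
      (sum-0 (λ i → root a a ! ⌜ i ⌝ * (E (to σ ⌜ i ⌝) k - E (to σ (⌜ i ⌝ + 1ℤ)) k))
        (λ i → cong (_* (E (to σ ⌜ i ⌝) k - E (to σ (⌜ i ⌝ + 1ℤ)) k))
          (trans (root-! a a ⌜ i ⌝) (ℤ.+-inverseʳ (E a ⌜ i ⌝)))))
      (sym (ℤ.+-inverseʳ (E (to σ a) k))))
    increment : ∀ k j → act (to σ) (root a (j + 1ℤ)) ! k - act (to σ) (root a j) ! k ≡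
           (E (to σ a) k - E (to σ (j + 1ℤ)) k) - (E (to σ a) k - E (to σ j) k)
    increment k j = begin
      act (to σ) (root a (j + 1ℤ)) ! k - act (to σ) (root a j) ! k
        ≡⟨ cong₂ _-_ (act-! (to σ) (root a (j + 1ℤ)) k) (act-! (to σ) (root a j) k) ⟩
      S (λ i → root a (j + 1ℤ) ! i * e i) - S (λ i → root a j ! i * e i)
        ≡⟨ S-- (λ i → root a (j + 1ℤ) ! i * e i) (λ i → root a j ! i * e i) ⟨
      S (λ i → root a (j + 1ℤ) ! i * e i - root a j ! i * e i)
        ≡⟨ S-cong (λ i → trans (cong₂ (λ x y → x * e i - y * e i) (root-! a (j + 1ℤ) i) (root-! a j i))
             (lia 5 (E a i , E (j + 1ℤ) i , E j i , δ i j , e i)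
               (λ a j′ j d e → e :* (j :- j′) :≡ e :* d ⊢ (a :- j′) :* e :- (a :- j) :* e :≡ e :* d)
               (cong (e i *_) (E-δ j i)))) ⟩
      S (λ i → e i * δ i j)
        ≡⟨ S-δ e (E-to-periodic σ k) j ⟩
      e j
        ≡⟨ lia 3 (E (to σ a) k , E (to σ (j + 1ℤ)) k , E (to σ j) k) (λ a j′ j → ⊢ j :- j′ :≡ (a :- j′) :- (a :- j)) ⟩
      (E (to σ a) k - E (to σ (j + 1ℤ)) k) - (E (to σ a) k - E (to σ j) k) ∎
      where
      open ≡-Reasoning
      e : ℤ → ℤ
      e i = E (to σ i) k - E (to σ (i + 1ℤ)) k

  act-linear : ∀ σ μ x ν k → act σ (μ ⊖ x · ν) ! k ≡ act σ μ ! k - x * act σ ν ! k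
  act-linear σ μ x ν k = begin
    act σ (μ ⊖ x · ν) ! k
      ≡⟨ act-! σ (μ ⊖ x · ν) k ⟩
    S (λ i → (μ ⊖ x · ν) ! i * e i)
      ≡⟨ S-cong (λ i → trans (cong (_* e i) (trans (⊖-! μ (x · ν) i) (cong (λ z → μ ! i - z) (·-! x ν i))))
           (lia 4 (μ ! i , x , ν ! i , e i) λ m x v e → ⊢ (m :- x :* v) :* e :≡ m :* e :- x :* (v :* e))) ⟩
    S (λ i → μ ! i * e i - x * (ν ! i * e i))
      ≡⟨ S-- (λ i → μ ! i * e i) (λ i → x * (ν ! i * e i)) ⟩
    S (λ i → μ ! i * e i) - S (λ i → x * (ν ! i * e i))
      ≡⟨ cong₂ _-_ (sym (act-! σ μ k))
           (trans (sym (*-distribˡ-sum x (λ i → ν ! ⌜ i ⌝ * e ⌜ i ⌝))) (cong (x *_) (sym (act-! σ ν k)))) ⟩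
    act σ μ ! k - x * act σ ν ! k ∎
    where
    open ≡-Reasoning
    e : ℤ → ℤ
    e i = E (σ i) k - E (σ (i + 1ℤ)) k

  -- Summed over `i`, the corrections of `E-swap` share the factor ε_{σ a} - ε_{σ b}, the image of
  -- the root; it is multiplied by a sum of `hook` terms, which is the pairing of `μ` with the root.
  act-swap : ∀ σ {a b} → ¬ a ≋ b → act (to σ ∘ swap a b) ≗ act (to σ) ∘ refl[ root a b ]
  act-swap σ {a} {b} a≢b μ = !-ext λ k → begin
    act (to σ ∘ swap a b) μ ! k
      ≡⟨ act-! (to σ ∘ swap a b) μ k ⟩
    S (λ i → μ ! i * (E (to σ (swap a b i)) k - E (to σ (swap a b (i + 1ℤ))) k))
      ≡⟨ S-cong (λ i → trans (cong₂ (λ x y → μ ! i * (x - y)) (E-swap σ a≢b i k) (E-swap σ a≢b (i + 1ℤ) k))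
           (lia 8 (μ ! i , E (to σ i) k , E (to σ (i + 1ℤ)) k , R k , δ i a , δ i b , δ (i + 1ℤ) a , δ (i + 1ℤ) b)
             λ m x y r a b a′ b′ → ⊢ m :* ((x :- (a :- b) :* r) :- (y :- (a′ :- b′) :* r)) :≡
               m :* (x :- y) :- m :* ((a :- b) :- (a′ :- b′)) :* r)) ⟩
    S (λ i → μ ! i * (E (to σ i) k - E (to σ (i + 1ℤ)) k) - μ ! i * hook a b i * R k)
      ≡⟨ S-- (λ i → μ ! i * (E (to σ i) k - E (to σ (i + 1ℤ)) k)) (λ i → μ ! i * hook a b i * R k) ⟩
    S (λ i → μ ! i * (E (to σ i) k - E (to σ (i + 1ℤ)) k)) - S (λ i → μ ! i * hook a b i * R k)
      ≡⟨ cong₂ _-_ (sym (act-! (to σ) μ k))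
           (trans (sym (*-distribʳ-sum (R k) (λ i → μ ! ⌜ i ⌝ * hook a b ⌜ i ⌝)))
             (cong₂ _*_ (sym (⟨⟩-root μ a b)) (trans (sym (root-! (to σ a) (to σ b) k)) (cong (_! k) (sym (act-root σ a b)))))) ⟩
    act (to σ) μ ! k - ⟨ μ , root a b ⟩ * act (to σ) (root a b) ! k
      ≡⟨ act-linear (to σ) μ ⟨ μ , root a b ⟩ (root a b) k ⟨
    act (to σ) (refl[ root a b ] μ) ! k ∎
    where
    open ≡-Reasoning
    R : ℤ → ℤ
    R k = E (to σ a) k - E (to σ b) k

  -- Words and lengths

  letter : Fin n → ℤ → ℤ
  letter i = swap ⌜ i ⌝ (⌜ i ⌝ + 1ℤ)

  word : List (Fin n) → AffinePermutation
  word []       = idₚ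
  word (i ∷ is) = swapₚ ⌜ i ⌝ (⌜ i ⌝ + 1ℤ) ∙ word is

  refl-cong : ∀ {α β} → α ≡ β → ∀ μ → refl[ α ] μ ≡ refl[ β ] μ
  refl-cong refl μ = refl

  -- The prefix `σ` is an accumulator: `act-swap` appends a reflection on the right, while words
  -- grow on the left, so the first letter is handed to `σ` before the rest is treated.
  act-word : ∀ σ is → act (to σ ∘ to (word is)) ≗ act (to σ) ∘ ⟦ is ⟧
  act-word σ [] μ       = refl
  act-word σ (i ∷ is) μ = trans (act-word (σ ∙ swapₚ ⌜ i ⌝ (⌜ i ⌝ + 1ℤ)) is μ)
    (trans (act-swap σ (¬≋-1 ⌜ i ⌝) (⟦ is ⟧ μ))
      (cong (act (to σ)) (sym (refl-cong (α-root i) (⟦ is ⟧ μ)))))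

  word-act : ∀ is → ⟦ is ⟧ ≗ act (to (word is))
  word-act is μ = trans (sym (act-id (⟦ is ⟧ μ))) (sym (act-word idₚ is μ))

  ⟦⟧-++ : ∀ is js → ⟦ is ++ js ⟧ ≗ ⟦ is ⟧ ∘ ⟦ js ⟧
  ⟦⟧-++ [] js μ       = refl
  ⟦⟧-++ (i ∷ is) js μ = cong refl[ α[ i ] ] (⟦⟧-++ is js μ)

  refl-act : ∀ {a b} → ¬ a ≋ b → refl[ root a b ] ≗ act (swap a b)
  refl-act {a} {b} a≢b μ = trans (sym (act-id (refl[ root a b ] μ))) (sym (act-swap idₚ a≢b μ))

  refl-involutive : ∀ {a b} → ¬ a ≋ b → ∀ μ → refl[ root a b ] (refl[ root a b ] μ) ≡ μ
  refl-involutive {a} {b} a≢b μ = trans (refl-act a≢b (refl[ root a b ] μ)) (trans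
    (sym (act-swap (swapₚ a b) a≢b μ)) (trans (act-cong (swap-involutive a b) μ) (act-id μ)))

  inversion-≢ : ∀ σ {a b} → a < b → to σ b < to σ a → ¬ a ≋ b
  inversion-≢ σ {a} {b} a<b σb<σa (k , eq) = lia 5 (a , b , to σ a , to σ b , k * N)
    (λ a b a′ b′ x → a :≡ b :+ x , a′ :≡ b′ :+ x , a :< b , b′ :< a′ ⊢ :⊥)
    eq (trans (cong (to σ) eq) (to-+ σ b k)) a<b σb<σa

  -- A simple exchange lowers a number by at most one and raises only those in the class of `i`, by
  -- at most one; two numbers can therefore cross only if they are neighbours that it exchanges.
  letter-inverts : ∀ i {a b} → a < b → letter i b < letter i a → b ≡ a + 1ℤ × a ≋ ⌜ i ⌝
  letter-inverts i {a} {b} a<b inv with a ≋? ⌜ i ⌝ | lower | upper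
    where
    x = ⌜ i ⌝
    lower : b - 1ℤ ≤ letter i b
    lower = lia 5 (b , x , letter i b , δ b x , δ b (x + 1ℤ))
      (λ b x l d d′ → l :≡ b :+ ((x :+ # 1) :- x) :* (d :- d′) , # 0 :≤ d , d′ :≤ # 1 ⊢ b :- # 1 :≤ l)
      (swap-at x (x + 1ℤ) b refl refl) (0≤δ b x) (δ≤1 b (x + 1ℤ))
    upper : letter i a ≤ a + δ a x
    upper = lia 5 (a , x , letter i a , δ a x , δ a (x + 1ℤ))
      (λ a x l d d′ → l :≡ a :+ ((x :+ # 1) :- x) :* (d :- d′) , # 0 :≤ d′ ⊢ l :≤ a :+ d)
      (swap-at x (x + 1ℤ) a refl refl) (0≤δ a (x + 1ℤ))
  ... | yes a≋i | lower | upper = ℤ.≤-antisym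
          (lia 5 (a , b , letter i a , letter i b , δ a ⌜ i ⌝)
            (λ a b la lb d → lb :< la , b :- # 1 :≤ lb , la :≤ a :+ d , d :≤ # 1 ⊢ b :≤ a :+ # 1)
            inv lower upper (δ≤1 a ⌜ i ⌝))
          (lia 2 (a , b) (λ a b → a :< b ⊢ a :+ # 1 :≤ b) a<b) , a≋i
  ... | no a≢i | lower | upper = ⊥-elim (lia 5 (a , b , letter i a , letter i b , δ a ⌜ i ⌝)
          (λ a b la lb d → a :< b , lb :< la , b :- # 1 :≤ lb , la :≤ a :+ d , d :≡ # 0 ⊢ :⊥)
          a<b inv lower upper (δ-no a≢i))

  exchange : ∀ is {a b} → a < b → to (word is) b < to (word is) a →
             ∃ λ js → length is ≡ suc (length js) × to (word js) ≗ to (word is) ∘ swap a b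
  exchange [] a<b b<a = contradiction b<a (ℤ.<-asym a<b)
  exchange (i ∷ is) {a} {b} a<b inv with ℤ.<-cmp (to (word is) a) (to (word is) b)
  ... | tri> _ _ b′<a′ with js , len , eq ← exchange is a<b b′<a′ = i ∷ js , cong suc len , λ x → cong (letter i) (eq x)
  ... | tri≈ _ a′≡b′ _ = contradiction (to-injective (word is) a′≡b′) (λ a≡b → ℤ.<-irrefl a≡b a<b)
  ... | tri< a′<b′ _ _ with b′≡ , a′≋i ← letter-inverts i a′<b′ inv = is , refl , λ x → sym (begin
          letter i (σ (swap a b x))
            ≡⟨ cong (letter i) (swap-conj (word is) (inversion-≢ (word (i ∷ is)) a<b inv) x) ⟩
          letter i (swap (σ a) (σ b) (σ x))
            ≡⟨ swap-cong (≋-sym a′≋i) (lia 3 (⌜ i ⌝ , σ a , σ b)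
                 (λ i a b → b :≡ a :+ # 1 ⊢ i :+ # 1 :- i :≡ b :- a) b′≡) (swap (σ a) (σ b) (σ x)) ⟩
          swap (σ a) (σ b) (swap (σ a) (σ b) (σ x))
            ≡⟨ swap-involutive (σ a) (σ b) (σ x) ⟩
          σ x ∎)
    where
    open ≡-Reasoning
    σ : ℤ → ℤ
    σ = to (word is)

  -- The sign of a root shows in a single coefficient: at `k = σ a` the image under σ is positive,
  -- whereas `π b ≤ π a` would make it non-positive. Thus a word for a transformation inherits the
  -- inversions of any permutation that represents it.
  act-order : ∀ σ π → act (to σ) ≗ act (to π) → ∀ {a b} → to σ a < to σ b → to π a < to π b
  act-order σ π σ≗π {a} {b} σa<σb = ℤ.≰⇒> λ πb≤πa →
    lia 4 (E (to σ a) k , E (to σ b) k , E (to π a) k , E (to π b) k)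
      (λ x y z w → x :≡ # 0 , y :≤ -# 1 , z :≤ w , x :- y :≡ z :- w ⊢ :⊥)
      (E-self k) (E≤-1 σa<σb)
      (E-anti k πb≤πa)
      (trans (sym (root-! (to σ a) (to σ b) k)) (trans
        (cong (_! k) (trans (sym (act-root σ a b)) (trans (σ≗π (root a b)) (act-root π a b))))
        (root-! (to π a) (to π b) k)))
    where
    k : ℤ
    k = to σ a

  HasLength-cong : ∀ {v w k} → v ≗ w → HasLength v k → HasLength w k
  HasLength-cong v≗w ((is , v≗ , len) , minimal) =
    (is , (λ μ → trans (sym (v≗w μ)) (v≗ μ)) , len) , λ js w≗ → minimal js (λ μ → trans (v≗w μ) (w≗ μ))

  HasLength-unique : ∀ {w k l} → HasLength w k → HasLength w l → k ≡ l
  HasLength-unique ((is , is≗ , refl) , is-min) ((js , js≗ , refl) , js-min) =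
    ℕ.≤-antisym (is-min js js≗) (js-min is is≗)

  -- `σ` is not unique: adding n to all its values leaves every ε_{σ i} - ε_{σ j} unchanged.
  record Represents (w : Endo) (σ : AffinePermutation) : Set where
    constructor represents
    field
      w≗act : w ≗ act (to σ)
  open Represents

  represents-cong : ∀ {v w σ π} → v ≗ w → to σ ≗ to π → Represents v σ → Represents w π
  represents-cong v≗w σ≗π (represents v≗) =
    represents λ μ → trans (sym (v≗w μ)) (trans (v≗ μ) (act-cong σ≗π μ))

  represents-id : Represents id idₚ
  represents-id = represents λ μ → sym (act-id μ)

  represents-refl : ∀ {w σ a b} → ¬ a ≋ b → Represents w σ → Represents (w ∘ refl[ root a b ]) (σ ∙ swapₚ a b)
  represents-refl {σ = σ} {a} {b} a≢b (represents w≗) =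
    represents λ μ → trans (w≗ (refl[ root a b ] μ)) (sym (act-swap σ a≢b μ))

  same-action : ∀ {v w σ π} → Represents v σ → Represents w π → to σ ≗ to π → v ≗ w
  same-action (represents v≗) (represents w≗) σ≗π μ = trans (v≗ μ) (trans (act-cong σ≗π μ) (sym (w≗ μ)))

  -- Whatever permutation the word spells, it inverts `a` and `b` by `act-order`, because
  -- `σ ∙ swapₚ a b` does; `exchange` then removes one letter together with the reflection.
  shorten : ∀ {v σ a b} → Represents v σ → ¬ a ≋ b → a < b → to σ a < to σ b →
            ∀ is → v ∘ refl[ root a b ] ≗ ⟦ is ⟧ → ∃ λ js → length is ≡ suc (length js) × v ≗ ⟦ js ⟧
  shorten {v} {σ} {a} {b} vσ a≢b a<b σa<σb is eq
    = let js , len , js≗ = exchange is a<b descent in js , len , λ μ → begin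
      v μ                                    ≡⟨ cong v (refl-involutive a≢b μ) ⟨
      v (refl[ root a b ] (refl[ root a b ] μ)) ≡⟨ trans (eq (refl[ root a b ] μ)) (word-act is (refl[ root a b ] μ)) ⟩
      act (to (word is)) (refl[ root a b ] μ) ≡⟨ act-swap (word is) a≢b μ ⟨
      act (to (word is) ∘ swap a b) μ        ≡⟨ act-cong js≗ μ ⟨
      act (to (word js)) μ                   ≡⟨ word-act js μ ⟨
      ⟦ js ⟧ μ                               ∎
    where
    open ≡-Reasoning
    same : act (to (σ ∙ swapₚ a b)) ≗ act (to (word is))
    same μ = trans (act-swap σ a≢b μ) (trans (sym (w≗act vσ (refl[ root a b ] μ))) (trans (eq μ) (word-act is μ)))
    descent : to (word is) b < to (word is) a
    descent = act-order (σ ∙ swapₚ a b) (word is) same {b} {a}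
      (subst₂ _<_ (cong (to σ) (sym (swap-right a≢b))) (cong (to σ) (sym (swap-left a≢b))) σa<σb)

  length-< : ∀ {v σ a b k l} → Represents v σ → ¬ a ≋ b → a < b → to σ a < to σ b →
             HasLength v k → HasLength (v ∘ refl[ root a b ]) l → k ℕ.< l
  length-< vσ a≢b a<b σa<σb (_ , k-min) ((is , is≗ , length≡l) , _) =
    let js , len , js≗ = shorten vσ a≢b a<b σa<σb is is≗
    in ℕ.≤-trans (s≤s (k-min js js≗)) (ℕ.≤-reflexive (trans (sym len) length≡l))

  root-cong : ∀ {a b a′ b′} → a ≋ a′ → b - a ≡ b′ - a′ → root a b ≡ root a′ b′
  root-cong {a} {b} {a′} {b′} (m , eq) diff = !-ext λ k → trans (root-! a b k) (trans
    (lia 5 (E a k , E b k , E a′ k , E b′ k , m) (λ a b a′ b′ m → a :≡ a′ :- m , b :≡ b′ :- m ⊢ a :- b :≡ a′ :- b′)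
      (trans (cong (λ z → E z k) eq) (E-shiftˡ a′ k m))
      (trans (cong (λ z → E z k) (lia 5 (a , b , a′ , b′ , m * N)
        (λ a b a′ b′ x → a :≡ a′ :+ x , b :- a :≡ b′ :- a′ ⊢ b :≡ b′ :+ x) eq diff)) (E-shiftˡ b′ k m)))
    (sym (root-! a′ b′ k)))

  suc-minus : ∀ i j → i + 1ℤ - i ≡ j + 1ℤ - j
  suc-minus i j = lia 2 (i , j) λ i j → ⊢ i :+ # 1 :- i :≡ j :+ # 1 :- j

  α-class : ∀ j → α[ class j ] ≡ root j (j + 1ℤ)
  α-class j = trans (α-root (class j)) (root-cong (≋-sym (≋-class j)) (suc-minus ⌜ class j ⌝ j))

  append-letter : ∀ {w} j is → w ≗ ⟦ is ⟧ → w ∘ refl[ root j (j + 1ℤ) ] ≗ ⟦ is ++ class j ∷ [] ⟧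
  append-letter j is w≗ μ = trans (w≗ (refl[ root j (j + 1ℤ) ] μ))
    (trans (cong ⟦ is ⟧ (refl-cong (sym (α-class j)) μ)) (sym (⟦⟧-++ is (class j ∷ []) μ)))

  length-snoc : ∀ (is : List (Fin n)) j → length (is ++ j ∷ []) ≡ suc (length is)
  length-snoc is j = trans (List.length-++ is) (ℕ.+-comm (length is) 1)

  i<i+1 : ∀ i → i < i + 1ℤ
  i<i+1 i = lia 1 i λ i → ⊢ i :< i :+ # 1

  -- Appending the letter gives the upper bound, `shorten` the lower one.
  ascend : ∀ {v σ k} j → Represents v σ → to σ j < to σ (j + 1ℤ) → HasLength v k →
           HasLength (v ∘ refl[ root j (j + 1ℤ) ]) (suc k)
  ascend {v} {σ} {k} j vσ σj<σj+1 ((is , is≗ , length≡k) , minimal) =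
    (is ++ class j ∷ [] , append-letter j is is≗ , trans (length-snoc is (class j)) (cong suc length≡k)) , minimal′
    where
    minimal′ : ∀ js → v ∘ refl[ root j (j + 1ℤ) ] ≗ ⟦ js ⟧ → suc k ℕ.≤ length js
    minimal′ js js≗ =
      let ks , len , ks≗ = shorten vσ (¬≋-1 j) (i<i+1 j) σj<σj+1 js js≗
      in ℕ.≤-trans (s≤s (minimal ks ks≗)) (ℕ.≤-reflexive (sym len))

  descend : ∀ {v σ k} j → Represents v σ → to σ (j + 1ℤ) < to σ j → HasLength v k →
            ∃ λ l → HasLength (v ∘ refl[ root j (j + 1ℤ) ]) l
  descend {v} {σ} {k} j vσ σj+1<σj ((is , is≗ , length≡k) , minimal) =
    let js , len , js≗ = shorten (represents-refl (¬≋-1 j) vσ) (¬≋-1 j) (i<i+1 j) ascent is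
          (λ μ → trans (twice μ) (is≗ μ))
    in length js , (js , js≗ , refl) , λ ks ks≗ → ℕ.s≤s⁻¹ (ℕ.≤-trans (ℕ.≤-reflexive (trans (sym len) length≡k)) (minimal′ ks ks≗))
    where
    s : Endo
    s = refl[ root j (j + 1ℤ) ]
    twice : v ∘ s ∘ s ≗ v
    twice μ = cong v (refl-involutive (¬≋-1 j) μ)
    ascent : to (σ ∙ swapₚ j (j + 1ℤ)) j < to (σ ∙ swapₚ j (j + 1ℤ)) (j + 1ℤ)
    ascent = subst₂ _<_ (cong (to σ) (sym (swap-left (¬≋-1 j)))) (cong (to σ) (sym (swap-right (¬≋-1 j)))) σj+1<σj
    minimal′ : ∀ ks → v ∘ s ≗ ⟦ ks ⟧ → k ℕ.≤ suc (length ks)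
    minimal′ ks ks≗ = ℕ.≤-trans
      (minimal (ks ++ class j ∷ []) λ μ → trans (sym (twice μ)) (append-letter j ks ks≗ μ))
      (ℕ.≤-reflexive (length-snoc ks (class j)))

  -- Instead of a search among all words, the minimum is updated letter by letter: each letter moves
  -- it up or down according to the order of two adjacent values.
  hasLength-∘ : ∀ {v σ k} → Represents v σ → HasLength v k → ∀ js → ∃ λ l → HasLength (v ∘ ⟦ js ⟧) l
  hasLength-∘ vσ vk [] = _ , vk
  hasLength-∘ {v} {σ} vσ vk (j ∷ js) = by-cases (ℤ.<-cmp (to σ ⌜ j ⌝) (to σ (⌜ j ⌝ + 1ℤ)))
    where
    s : Endo
    s = refl[ root ⌜ j ⌝ (⌜ j ⌝ + 1ℤ) ]
    continue : (∃ λ l → HasLength (v ∘ s) l) → ∃ λ l → HasLength (v ∘ ⟦ j ∷ js ⟧) l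
    continue (_ , vsl) =
      let m , vsm = hasLength-∘ (represents-refl (¬≋-1 ⌜ j ⌝) vσ) vsl js
      in m , HasLength-cong (λ μ → cong v (refl-cong (sym (α-root j)) (⟦ js ⟧ μ))) vsm
    by-cases : Tri (to σ ⌜ j ⌝ < to σ (⌜ j ⌝ + 1ℤ)) (to σ ⌜ j ⌝ ≡ to σ (⌜ j ⌝ + 1ℤ)) (to σ (⌜ j ⌝ + 1ℤ) < to σ ⌜ j ⌝) →
               ∃ λ l → HasLength (v ∘ ⟦ j ∷ js ⟧) l
    by-cases (tri≈ _ eq _) = contradiction (to-injective σ eq) (ℤ.<⇒≢ (i<i+1 ⌜ j ⌝))
    by-cases (tri< lt _ _) = continue (_ , ascend ⌜ j ⌝ vσ lt vk)
    by-cases (tri> _ _ gt) = continue (descend ⌜ j ⌝ vσ gt vk)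

  hasLength-id : HasLength id 0
  hasLength-id = ([] , (λ _ → refl) , refl) , λ _ _ → z≤n

  hasLength : ∀ {w} → w ∈ Waff → ∃ λ k → HasLength w k
  hasLength (is , w≗) =
    let k , wk = hasLength-∘ represents-id hasLength-id is
    in k , HasLength-cong (λ μ → sym (w≗ μ)) wk

  word-++ : ∀ is js → to (word (is ++ js)) ≗ to (word is) ∘ to (word js)
  word-++ [] js x       = refl
  word-++ (i ∷ is) js x = cong (letter i) (word-++ is js x)

  letter-class : ∀ j → letter (class j) ≗ swap j (j + 1ℤ)
  letter-class j = swap-cong (≋-sym (≋-class j)) (suc-minus ⌜ class j ⌝ j)

  conjugate-word : ∀ j a b → ¬ a ≋ b → ∀ is → to (word is) ≗ swap a b →
    to (word (class j ∷ is ++ class j ∷ [])) ≗ swap (swap j (j + 1ℤ) a) (swap j (j + 1ℤ) b)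
  conjugate-word j a b a≢b is is≗ x = begin
    letter (class j) (to (word (is ++ class j ∷ [])) x)  ≡⟨ letter-class j _ ⟩
    s (to (word (is ++ class j ∷ [])) x)                 ≡⟨ cong s (word-++ is (class j ∷ []) x) ⟩
    s (to (word is) (letter (class j) x))                ≡⟨ cong s (trans (is≗ _) (cong (swap a b) (letter-class j x))) ⟩
    s (swap a b (s x))                                   ≡⟨ swap-conj (swapₚ j (j + 1ℤ)) a≢b (s x) ⟩
    swap (s a) (s b) (s (s x))                           ≡⟨ cong (swap (s a) (s b)) (swap-involutive j (j + 1ℤ) x) ⟩
    swap (s a) (s b) x                                   ∎
    where
    open ≡-Reasoning
    s : ℤ → ℤ
    s = swap j (j + 1ℤ)

  sucℤ-< : ∀ {a b} → a < b → a + 1ℤ ≢ b → a + 1ℤ < b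
  sucℤ-< {a} {b} a<b a+1≢b = ℤ.≤∧≢⇒< (lia 2 (a , b) (λ a b → a :< b ⊢ a :+ # 1 :≤ b) a<b) a+1≢b

  ≋-<⇒+N≤ : ∀ {a b} → a < b → a ≋ b → a + N ≤ b
  ≋-<⇒+N≤ a<b a≋b = ℤ.≮⇒≥ λ b<a+N → ≋-apart a<b b<a+N a≋b

  b-1+1 : ∀ b → b - 1ℤ + 1ℤ ≡ b
  b-1+1 b = lia 1 b λ b → ⊢ b :- # 1 :+ # 1 :≡ b

  -- Conjugating by a simple reflection brings a and b closer together.
  swap-word : ∀ d {a b} → a < b → b ≤ a + + d → ¬ a ≋ b → ∃ λ is → to (word is) ≗ swap a b
  swap-word zero {a} {b} a<b b≤ a≢b = ⊥-elim (lia 2 (a , b) (λ a b → a :< b , b :≤ a :+ # 0 ⊢ :⊥) a<b b≤)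
  swap-word (suc d) {a} {b} a<b b≤ a≢b = by-cases (a + 1ℤ ℤ.≟ b) (a ≋? b - 1ℤ)
    where
    by-cases : Dec (a + 1ℤ ≡ b) → Dec (a ≋ b - 1ℤ) → ∃ λ is → to (word is) ≗ swap a b
    by-cases (yes refl) _ = class a ∷ [] , letter-class a
    by-cases (no a+1≢b) (no a≢b-1) =
      let is , is≗ = swap-word d {a} {b - 1ℤ}
            (lia 2 (a , b) (λ a b → a :+ # 1 :< b ⊢ a :< b :- # 1) (sucℤ-< a<b a+1≢b))
            (lia 3 (a , b , + d) (λ a b d → b :≤ a :+ (# 1 :+ d) ⊢ b :- # 1 :≤ a :+ d) b≤) a≢b-1
      in class (b - 1ℤ) ∷ is ++ class (b - 1ℤ) ∷ [] ,
         λ x → trans (conjugate-word (b - 1ℤ) a (b - 1ℤ) a≢b-1 is is≗ x)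
           (cong₂ (λ y z → swap y z x) (swap-fix a≢b-1 (a≢b ∘ λ e → ≋-trans e (≋-reflexive (b-1+1 b))))
             (trans (swap-left (¬≋-1 (b - 1ℤ))) (b-1+1 b)))
    -- Exchanging `b - 1` and `b` would move `a` as well, which is congruent to `b - 1`. Conjugation
    -- by the exchange of `a` and `a + 1` moves both ends at once, from `(a + 1 , b - 1)` to
    -- `(a , b)`.
    by-cases (no a+1≢b) (yes a≋b-1) =
      let is , is≗ = swap-word d {a + 1ℤ} {b - 1ℤ}
            (lia 3 (a , b , N) (λ a b N → a :+ N :≤ b :- # 1 , # 3 :≤ N ⊢ a :+ # 1 :< b :- # 1)
              (≋-<⇒+N≤ a<b-1 a≋b-1) 3≤N)
            (lia 3 (a , b , + d) (λ a b d → b :≤ a :+ (# 1 :+ d) ⊢ b :- # 1 :≤ a :+ # 1 :+ d) b≤) a+1≢b-1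
      in class a ∷ is ++ class a ∷ [] ,
         λ x → trans (conjugate-word a (a + 1ℤ) (b - 1ℤ) a+1≢b-1 is is≗ x)
           (cong₂ (λ y z → swap y z x) (swap-right (¬≋-1 a)) (trans (swap-≋ˡ (¬≋-1 a) (≋-sym a≋b-1))
             (lia 2 (a , b) λ a b → ⊢ b :- # 1 :+ (a :+ # 1 :- a) :≡ b)))
      where
      a+1≢b-1 : ¬ a + 1ℤ ≋ b - 1ℤ
      a+1≢b-1 e = ¬≋-1 a (≋-trans a≋b-1 (≋-sym e))
      a<b-1 : a < b - 1ℤ
      a<b-1 = lia 2 (a , b) (λ a b → a :+ # 1 :< b ⊢ a :< b :- # 1) (sucℤ-< a<b a+1≢b)

  waff-refl : ∀ {v a b} → a < b → ¬ a ≋ b → v ∈ Waff → v ∘ refl[ root a b ] ∈ Waff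
  waff-refl {v} {a} {b} a<b a≢b (is , v≗) =
      let js , js≗ = swap-word ℤ.∣ b - a ∣ a<b
           (lia 3 (a , b , + ℤ.∣ b - a ∣) (λ a b d → d :≡ b :- a ⊢ b :≤ a :+ d)
             (ℤ.0≤i⇒+∣i∣≡i (ℤ.i≤j⇒0≤j-i (ℤ.<⇒≤ a<b)))) a≢b
      in is ++ js , λ μ → trans (v≗ (refl[ root a b ] μ)) (trans
        (cong ⟦ is ⟧ (trans (refl-act a≢b μ) (trans (sym (act-cong js≗ μ)) (sym (word-act js μ)))))
        (sym (⟦⟧-++ is js μ)))

  -- Flows

  pos : ℤ → ℤ
  pos x = x ℤ.⊔ 0ℤ

  0≤pos : ∀ x → 0ℤ ≤ pos x
  0≤pos x = ℤ.i≤j⊔i x 0ℤ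

  -- For i ≤ j, the coefficient at α_k of ε_i - ε_j: how often a jump from i to j passes a translate of (k , k+1).
  crossing : ℤ → ℤ → ℤ → ℤ
  crossing i j k = pos (E i k - E j k)

  0≤crossing : ∀ i j k → 0ℤ ≤ crossing i j k
  0≤crossing i j k = 0≤pos (E i k - E j k)

  crossing-≤ : ∀ {i j} k → i ≤ j → crossing i j k ≡ E i k - E j k
  crossing-≤ k i≤j = ℤ.i≥j⇒i⊔j≡i (ℤ.i≤j⇒0≤j-i (E-anti k i≤j))

  crossing-≥ : ∀ {i j} k → j ≤ i → crossing i j k ≡ 0ℤ
  crossing-≥ k j≤i = ℤ.i≤j⇒i⊔j≡j (ℤ.i≤j⇒i-j≤0 (E-anti k j≤i))

  crossing-+ : ∀ k i j m → crossing (i + m * N) (j + m * N) k ≡ crossing i j k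
  crossing-+ k i j m = cong pos (trans (cong₂ _-_ (E-shiftˡ i k m) (E-shiftˡ j k m))
    (lia 3 (E i k , E j k , m) λ x y m → ⊢ (x :- m) :- (y :- m) :≡ x :- y))

  crossing-periodic : ∀ i j → Periodic (crossing i j)
  crossing-periodic i j k≋l = cong pos (E-E-periodic i j k≋l)

  E≤crossing : ∀ i j k → E i k - E j k ≤ crossing i j k
  E≤crossing i j k = ℤ.i≤i⊔j (E i k - E j k) 0ℤ

  crossing-flip : ∀ i j k → crossing i j k - crossing j i k ≡ E i k - E j k
  crossing-flip i j k with ℤ.≤-total i j
  ... | inj₁ i≤j = trans (cong₂ _-_ (crossing-≤ k i≤j) (crossing-≥ k i≤j)) (ℤ.+-identityʳ _)
  ... | inj₂ j≤i = trans (cong₂ _-_ (crossing-≥ k j≤i) (crossing-≤ k j≤i))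
    (lia 2 (E i k , E j k) λ x y → ⊢ # 0 :- (y :- x) :≡ x :- y)

  Translation-invariant : (ℤ → ℤ → ℤ) → Set
  Translation-invariant φ = ∀ i j m → φ (i + m * N) (j + m * N) ≡ φ i j

  statistic-periodic : ∀ φ → Translation-invariant φ → ∀ σ → Periodic (λ i → φ i (to σ i))
  statistic-periodic φ φ-+ σ {i} {j} (m , refl) = trans (cong (φ (j + m * N)) (to-+ σ j m)) (φ-+ j (to σ j) m)

  -- Flow, balance and energy are all sums of this form. An exchange touches two classes only, and
  -- translation invariance lets their terms be read off at `a` and `b` themselves.
  S-swap : ∀ φ → Translation-invariant φ → ∀ σ {a b} → ¬ a ≋ b →
    S (λ i → φ i (to σ (swap a b i))) ≡
    S (λ i → φ i (to σ i)) + ((φ a (to σ b) + φ b (to σ a)) - (φ a (to σ a) + φ b (to σ b)))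
  S-swap φ φ-+ σ {a} {b} a≢b = lia 9
      (S (λ i → φ i (to σ (swap a b i))) , S (λ i → φ i (to σ i)) , S D , D a , D b ,
       φ a (to σ b) , φ b (to σ a) , φ a (to σ a) , φ b (to σ b))
      (λ s′ s d da db ab ba aa bb → d :≡ s′ :- s , d :≡ da :+ db , da :≡ ab :- aa , db :≡ ba :- bb ⊢
        s′ :≡ s :+ ((ab :+ ba) :- (aa :+ bb)))
      (S-- (λ i → φ i (to σ (swap a b i))) (λ i → φ i (to σ i)))
      (S-two D D-per a b a≢b λ i i≢a i≢b → trans (cong (λ z → φ i (to σ z) - φ i (to σ i)) (swap-fix i≢a i≢b))
        (ℤ.+-inverseʳ (φ i (to σ i))))
      (cong (λ z → φ a (to σ z) - φ a (to σ a)) (swap-left a≢b))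
      (cong (λ z → φ b (to σ z) - φ b (to σ b)) (swap-right a≢b))
    where
    D : ℤ → ℤ
    D i = φ i (to σ (swap a b i)) - φ i (to σ i)
    D-per : Periodic D
    D-per i≋j = cong₂ _-_ (statistic-periodic φ φ-+ (σ ∙ swapₚ a b) i≋j) (statistic-periodic φ φ-+ σ i≋j)

  -- Grouping the pairs `a ≤ k < σ a` by the class of `a` makes the count a finite sum: `crossing`
  -- counts the translates of one jump that pass `k`. `coflow` counts downward jumps in the same
  -- way.
  flow coflow : AffinePermutation → ℤ → ℤ
  flow σ k = S (λ i → crossing i (to σ i) k)
  coflow σ k = S (λ i → crossing (to σ i) i k)

  crossing-to-periodic : ∀ σ k → Periodic (λ i → crossing i (to σ i) k)
  crossing-to-periodic σ k = statistic-periodic (λ i j → crossing i j k) (crossing-+ k) σ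

  cocrossing-to-periodic : ∀ σ k → Periodic (λ i → crossing (to σ i) i k)
  cocrossing-to-periodic σ k = statistic-periodic (λ i j → crossing j i k) (λ i j → crossing-+ k j i) σ

  flow-periodic : ∀ σ → Periodic (flow σ)
  flow-periodic σ k≋l = S-cong λ i → crossing-periodic i (to σ i) k≋l

  0≤flow : ∀ σ k → 0ℤ ≤ flow σ k
  0≤flow σ k = sum-nonneg _ λ i → 0≤crossing ⌜ i ⌝ (to σ ⌜ i ⌝) k

  -- The window-sum condition on affine permutations of type A, put as a conservation law: at every
  -- `k` as many jumps pass upwards as downwards.
  Balanced : AffinePermutation → Set
  Balanced σ = ∀ k → S (λ i → E i k - E (to σ i) k) ≡ 0ℤ

  balanced-id : Balanced idₚ
  balanced-id k = sum-0 (λ i → E ⌜ i ⌝ k - E ⌜ i ⌝ k) λ i → ℤ.+-inverseʳ (E ⌜ i ⌝ k)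

  balanced-swap : ∀ σ {a b} → ¬ a ≋ b → Balanced σ → Balanced (σ ∙ swapₚ a b)
  balanced-swap σ {a} {b} a≢b bal k = trans
    (S-swap (λ i j → E i k - E j k) (λ i j m → trans (cong₂ _-_ (E-shiftˡ i k m) (E-shiftˡ j k m))
      (lia 3 (E i k , E j k , m) λ x y m → ⊢ (x :- m) :- (y :- m) :≡ x :- y)) σ a≢b)
    (lia 5 (S (λ i → E i k - E (to σ i) k) , E a k , E b k , E (to σ a) k , E (to σ b) k)
      (λ s a b a′ b′ → s :≡ # 0 ⊢ s :+ ((a :- b′ :+ (b :- a′)) :- (a :- a′ :+ (b :- b′))) :≡ # 0) (bal k))

  balanced⇒coflow≡flow : ∀ σ → Balanced σ → ∀ k → coflow σ k ≡ flow σ k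
  balanced⇒coflow≡flow σ bal k = lia 2 (flow σ k , coflow σ k) (λ f g → f :- g :≡ # 0 ⊢ g :≡ f)
    (trans (sym (S-- (λ i → crossing i (to σ i) k) (λ i → crossing (to σ i) i k)))
      (trans (S-cong λ i → crossing-flip i (to σ i) k) (bal k)))

  flow-swap : ∀ σ {a b} → ¬ a ≋ b → ∀ k → flow (σ ∙ swapₚ a b) k ≡ flow σ k +
    ((crossing a (to σ b) k + crossing b (to σ a) k) - (crossing a (to σ a) k + crossing b (to σ b) k))
  flow-swap σ a≢b k = S-swap (λ i j → crossing i j k) (crossing-+ k) σ a≢b

  flow-id : ∀ k → flow idₚ k ≡ 0ℤ
  flow-id k = sum-0 (λ i → crossing ⌜ i ⌝ ⌜ i ⌝ k) λ i → crossing-≥ {⌜ i ⌝} k ℤ.≤-refl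

  pos-lipschitz : ∀ x y z → x ≤ z → pos (z - y) - pos (x - y) ≤ z - x
  pos-lipschitz x y z x≤z with ℤ.≤-total z y
  ... | inj₁ z≤y = lia 4 (x , z , pos (z - y) , pos (x - y))
        (λ x z p q → p :≡ # 0 , # 0 :≤ q , x :≤ z ⊢ p :- q :≤ z :- x)
        (ℤ.i≤j⇒i⊔j≡j (ℤ.i≤j⇒i-j≤0 z≤y)) (0≤pos (x - y)) x≤z
  ... | inj₂ y≤z = lia 5 (x , y , z , pos (z - y) , pos (x - y))
        (λ x y z p q → p :≡ z :- y , x :- y :≤ q ⊢ p :- q :≤ z :- x)
        (ℤ.i≥j⇒i⊔j≡i (ℤ.i≤j⇒0≤j-i y≤z)) (ℤ.i≤i⊔j (x - y) 0ℤ)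

  -- The jump to `σ b` now starts at `a` instead of `b`, which gains at most the coefficient of the
  -- root because `pos` is 1-Lipschitz; the jump to `σ a` now starts further right and gains
  -- nothing.
  flow-chain : ∀ σ {a b} → a < b → ¬ a ≋ b → ∀ k → flow (σ ∙ swapₚ a b) k ≤ flow σ k + (E a k - E b k)
  flow-chain σ {a} {b} a<b a≢b k = lia 8
      (flow (σ ∙ swapₚ a b) k , flow σ k , E a k , E b k ,
       crossing a (to σ b) k , crossing b (to σ a) k , crossing a (to σ a) k , crossing b (to σ b) k)
      (λ f′ f z x ab ba aa bb → f′ :≡ f :+ ((ab :+ ba) :- (aa :+ bb)) , ab :- bb :≤ z :- x , ba :≤ aa ⊢ f′ :≤ f :+ (z :- x))
      (flow-swap σ a≢b k) (pos-lipschitz (E b k) (E (to σ b) k) (E a k) Eb≤Ea)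
      (ℤ.⊔-monoˡ-≤ 0ℤ (ℤ.+-monoˡ-≤ (- E (to σ a) k) Eb≤Ea))
    where
    Eb≤Ea : E b k ≤ E a k
    Eb≤Ea = E-anti k (ℤ.<⇒≤ a<b)

  crossing-split : ∀ {i j l} k → i ≤ j → j ≤ l → crossing i l k ≡ crossing i j k + crossing j l k
  crossing-split {i} {j} {l} k i≤j j≤l = lia 6 (E i k , E j k , E l k , crossing i l k , crossing i j k , crossing j l k)
    (λ i j l il ij jl → il :≡ i :- l , ij :≡ i :- j , jl :≡ j :- l ⊢ il :≡ ij :+ jl)
    (crossing-≤ k (ℤ.≤-trans i≤j j≤l)) (crossing-≤ k i≤j) (crossing-≤ k j≤l)

  -- The two old and the two new jumps all point the same way. Upwards, crossings are differences of
  -- `E` and the two sums agree; downwards, all crossings are zero.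
  flow-free-swap : ∀ σ {a b} → ¬ a ≋ b → a < b → to σ a < to σ b → b ≤ to σ a ⊎ to σ b ≤ a →
                   ∀ k → flow (σ ∙ swapₚ a b) k ≡ flow σ k
  flow-free-swap σ {a} {b} a≢b a<b σa<σb free k = lia 6
      (flow (σ ∙ swapₚ a b) k , flow σ k , crossing a (to σ b) k , crossing b (to σ a) k , crossing a (to σ a) k , crossing b (to σ b) k)
      (λ f′ f ab ba aa bb → f′ :≡ f :+ ((ab :+ ba) :- (aa :+ bb)) , ab :+ ba :≡ aa :+ bb ⊢ f′ :≡ f)
      (flow-swap σ a≢b k) (unchanged free)
    where
    unchanged : b ≤ to σ a ⊎ to σ b ≤ a →
      crossing a (to σ b) k + crossing b (to σ a) k ≡ crossing a (to σ a) k + crossing b (to σ b) k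
    unchanged (inj₁ b≤σa) = lia 8
      (E a k , E b k , E (to σ a) k , E (to σ b) k , crossing a (to σ b) k , crossing b (to σ a) k , crossing a (to σ a) k , crossing b (to σ b) k)
      (λ a b a′ b′ ab ba aa bb → ab :≡ a :- b′ , ba :≡ b :- a′ , aa :≡ a :- a′ , bb :≡ b :- b′ ⊢ ab :+ ba :≡ aa :+ bb)
      (crossing-≤ k (ℤ.<⇒≤ (ℤ.<-trans (ℤ.<-≤-trans a<b b≤σa) σa<σb))) (crossing-≤ k b≤σa)
      (crossing-≤ k (ℤ.<⇒≤ (ℤ.<-≤-trans a<b b≤σa))) (crossing-≤ k (ℤ.<⇒≤ (ℤ.≤-<-trans b≤σa σa<σb)))
    unchanged (inj₂ σb≤a) = trans
      (cong₂ _+_ (crossing-≥ k σb≤a) (crossing-≥ k (ℤ.<⇒≤ (ℤ.<-trans σa<σb (ℤ.≤-<-trans σb≤a a<b)))))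
      (sym (cong₂ _+_ (crossing-≥ k (ℤ.<⇒≤ (ℤ.<-≤-trans σa<σb σb≤a))) (crossing-≥ k (ℤ.<⇒≤ (ℤ.≤-<-trans σb≤a a<b)))))

  crossing-unit : ∀ k₀ k → crossing k₀ (k₀ + 1ℤ) k ≡ δ k k₀
  crossing-unit k₀ k = trans (crossing-≤ k (ℤ.<⇒≤ (i<i+1 k₀))) (E-δ k₀ k)

  -- The new jump from `a` to `σ b` splits at the gap from `k₀` to `k₀ + 1`. The ends lying at the
  -- gap make the old jumps cover just the two outer pieces, so only the gap itself is added; the
  -- new jump from `b` goes down.
  flow-unit-swap : ∀ σ {a b k₀} → ¬ a ≋ b → a ≤ k₀ → to σ a ≤ k₀ → a ≡ k₀ ⊎ to σ a ≡ k₀ →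
    k₀ + 1ℤ ≤ b → k₀ + 1ℤ ≤ to σ b → b ≡ k₀ + 1ℤ ⊎ to σ b ≡ k₀ + 1ℤ →
    ∀ k → flow (σ ∙ swapₚ a b) k ≡ flow σ k + δ k k₀
  flow-unit-swap σ {a} {b} {k₀} a≢b a≤ σa≤ a∨ ≤b ≤σb b∨ k = lia 10
      (flow (σ ∙ swapₚ a b) k , flow σ k , δ k k₀ , crossing a (to σ b) k , crossing b (to σ a) k ,
       crossing a (to σ a) k , crossing b (to σ b) k , crossing a k₀ k , crossing k₀ (k₀ + 1ℤ) k , crossing (k₀ + 1ℤ) (to σ b) k)
      (λ f′ f d ab ba aa bb l u r → f′ :≡ f :+ ((ab :+ ba) :- (aa :+ bb)) , ab :≡ l :+ (u :+ r) , ba :≡ # 0 , aa :≡ l , bb :≡ r , u :≡ d ⊢ f′ :≡ f :+ d)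
      (flow-swap σ a≢b k)
      (trans (crossing-split k a≤ (ℤ.≤-trans k₀≤ ≤σb)) (cong (λ z → crossing a k₀ k + z) (crossing-split k k₀≤ ≤σb)))
      (crossing-≥ k (ℤ.≤-trans σa≤ (ℤ.≤-trans k₀≤ ≤b)))
      (left a∨) (right b∨) (crossing-unit k₀ k)
    where
    k₀≤ : k₀ ≤ k₀ + 1ℤ
    k₀≤ = ℤ.<⇒≤ (i<i+1 k₀)
    left : a ≡ k₀ ⊎ to σ a ≡ k₀ → crossing a (to σ a) k ≡ crossing a k₀ k
    left (inj₁ refl)  = trans (crossing-≥ k σa≤) (sym (crossing-≥ {k₀} k ℤ.≤-refl))
    left (inj₂ σa≡k₀) = cong (λ z → crossing a z k) σa≡k₀
    right : b ≡ k₀ + 1ℤ ⊎ to σ b ≡ k₀ + 1ℤ → crossing b (to σ b) k ≡ crossing (k₀ + 1ℤ) (to σ b) k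
    right (inj₁ refl) = refl
    right (inj₂ eq)   = trans (crossing-≥ k (ℤ.≤-trans (ℤ.≤-reflexive eq) ≤b))
      (sym (crossing-≥ k (ℤ.≤-reflexive eq)))

  -- Change of the flow from one position to the next.

  crossing-step : ℤ → ℤ → ℤ → ℤ
  crossing-step j i l = crossing i l j - crossing i l (j - 1ℤ)

  crossing-step-≤ : ∀ {i l} j → i ≤ l → crossing-step j i l ≡ δ j i - δ j l
  crossing-step-≤ {i} {l} j i≤l = lia 8
    (crossing i l j , crossing i l (j - 1ℤ) , E i j , E i (j - 1ℤ) , E l j , E l (j - 1ℤ) , δ j i , δ j l)
    (λ x y i i⁻ l l⁻ d e → x :≡ i :- l , y :≡ i⁻ :- l⁻ , i :≡ i⁻ :+ d , l :≡ l⁻ :+ e ⊢ x :- y :≡ d :- e)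
    (crossing-≤ j i≤l) (crossing-≤ (j - 1ℤ) i≤l) (E-jump i j) (E-jump l j)

  crossing-step-≥ : ∀ {i l} j → l ≤ i → crossing-step j i l ≡ 0ℤ
  crossing-step-≥ j l≤i = cong₂ _-_ (crossing-≥ j l≤i) (crossing-≥ (j - 1ℤ) l≤i)

  crossing-step-0 : ∀ {i l} j → δ j i ≡ δ j l → crossing-step j i l ≡ 0ℤ
  crossing-step-0 {i} {l} j eq with ℤ.≤-total i l
  ... | inj₁ i≤l = trans (crossing-step-≤ j i≤l) (ℤ.i≡j⇒i-j≡0 eq)
  ... | inj₂ l≤i = crossing-step-≥ j l≤i

  module _ (σ : AffinePermutation) (j : ℤ) where
    private
      s : ℤ
      s = from σ j

      steps : ℤ → ℤ
      steps i = crossing-step j i (to σ i)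

      steps-per : Periodic steps
      steps-per i≋l = cong₂ _-_ (crossing-to-periodic σ j i≋l) (crossing-to-periodic σ (j - 1ℤ) i≋l)

      flow-steps : flow σ j - flow σ (j - 1ℤ) ≡ S steps
      flow-steps = sym (S-- (λ i → crossing i (to σ i) j) (λ i → crossing i (to σ i) (j - 1ℤ)))

      no-step : ∀ {i} → ¬ i ≋ j → ¬ i ≋ s → steps i ≡ 0ℤ
      no-step {i} i≢j i≢s = crossing-step-0 j (trans (δ-no (i≢j ∘ ≋-sym)) (sym (δ-no λ j≋σi →
        i≢s (≋-trans (≋-reflexive (sym (from-to σ i))) (from-≋ σ (≋-sym j≋σi))))))

    from-≋⇒to-≋ : s ≋ j → to σ j ≋ j
    from-≋⇒to-≋ s≋j = ≋-trans (to-≋ σ (≋-sym s≋j)) (≋-reflexive (to-from σ j))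

    to-≋⇒from-≋ : to σ j ≋ j → s ≋ j
    to-≋⇒from-≋ σj≋j = ≋-sym (≋-trans (≋-reflexive (sym (from-to σ j))) (from-≋ σ σj≋j))

    flow-through : s ≋ j → flow σ j ≡ flow σ (j - 1ℤ)
    flow-through s≋j = ℤ.i-j≡0⇒i≡j _ _ (trans flow-steps (trans
      (S-single steps steps-per j λ i i≢j → no-step i≢j λ i≋s → i≢j (≋-trans i≋s s≋j))
      (crossing-step-0 j (δ-cong ≋-refl (≋-sym (from-≋⇒to-≋ s≋j))))))

    private
      flow-change : ¬ s ≋ j → ∀ {x y} → steps j ≡ x → steps s ≡ y → flow σ j ≡ flow σ (j - 1ℤ) + (x + y)
      flow-change s≢j refl refl = lia 4 (flow σ j , flow σ (j - 1ℤ) , steps j , steps s)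
        (λ f f⁻ x y → f :- f⁻ :≡ x :+ y ⊢ f :≡ f⁻ :+ (x :+ y))
        (trans flow-steps (S-two steps steps-per j s (s≢j ∘ ≋-sym) λ i → no-step))

      out-step : ¬ s ≋ j → j < to σ j → steps j ≡ 1ℤ
      out-step s≢j j<σj = trans (crossing-step-≤ j (ℤ.<⇒≤ j<σj))
        (cong₂ _-_ (δ-yes ≋-refl) (δ-no λ j≋σj → s≢j (to-≋⇒from-≋ (≋-sym j≋σj))))

      in-step : ¬ s ≋ j → s < j → steps s ≡ -1ℤ
      in-step s≢j s<j = trans (cong (crossing-step j s) (to-from σ j)) (trans (crossing-step-≤ j (ℤ.<⇒≤ s<j))
        (cong₂ _-_ (δ-no (s≢j ∘ ≋-sym)) (δ-yes (≋-refl {j}))))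

      in-step-≥ : j < s → steps s ≡ 0ℤ
      in-step-≥ j<s = trans (cong (crossing-step j s) (to-from σ j)) (crossing-step-≥ j (ℤ.<⇒≤ j<s))

    -- `j` is compared with its two neighbours under σ, `σ j` and `s = σ⁻¹ j`. Only upward jumps
    -- count in `flow`: at a valley one starts and none ends, at a peak the reverse. At a pass, `s`
    -- and `j` can be exchanged without changing the flow. In the case `through`, σ maps the class
    -- of `j` to itself.
    data Local : Set where
      through   : s ≋ j → flow σ j ≡ flow σ (j - 1ℤ) → Local
      valley    : ¬ s ≋ j → j < to σ j → j < s → flow σ j ≡ flow σ (j - 1ℤ) + 1ℤ → Local
      peak      : ¬ s ≋ j → to σ j < j → s < j → flow σ j ≡ flow σ (j - 1ℤ) - 1ℤ → Local
      pass-up   : ¬ s ≋ j → j < to σ j → s < j → Local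
      pass-down : ¬ s ≋ j → to σ j < j → j < s → Local

    local : Local
    local with s ≋? j
    ... | yes s≋j = through s≋j (flow-through s≋j)
    ... | no s≢j with ℤ.<-cmp s j | ℤ.<-cmp (to σ j) j
    ...   | tri≈ _ s≡j _ | _            = contradiction (≋-reflexive s≡j) s≢j
    ...   | _            | tri≈ _ eq _  = contradiction (to-≋⇒from-≋ (≋-reflexive eq)) s≢j
    ...   | tri< s<j _ _ | tri< σj<j _ _ = peak s≢j σj<j s<j (flow-change s≢j (crossing-step-≥ j (ℤ.<⇒≤ σj<j)) (in-step s≢j s<j))
    ...   | tri< s<j _ _ | tri> _ _ j<σj = pass-up s≢j j<σj s<j
    ...   | tri> _ _ j<s | tri< σj<j _ _ = pass-down s≢j σj<j j<s
    ...   | tri> _ _ j<s | tri> _ _ j<σj = valley s≢j j<σj j<s (flow-change s≢j (out-step s≢j j<σj) (in-step-≥ j<s))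

  -- Raising an affine permutation within the degree bound

  find-or-all : ∀ {m} {A : Set} {P : Fin m → Set} → (∀ i → A ⊎ P i) → A ⊎ (∀ i → P i)
  find-or-all {zero} f = inj₂ λ ()
  find-or-all {suc m} f with f zero | find-or-all (f ∘ suc)
  ... | inj₁ a  | _       = inj₁ a
  ... | inj₂ _  | inj₁ a  = inj₁ a
  ... | inj₂ p₀ | inj₂ ps = inj₂ λ { zero → p₀ ; (suc i) → ps i }

  representative : ∀ b z → ∃ λ z′ → z ≋ z′ × b ≤ z′ × z′ < b + N
  representative b z = z - m * N , (m , lia 2 (z , m * N) λ z x → ⊢ z :≡ z :- x :+ x) ,
    lia 3 (b , z , m * N) (λ b z x → b :+ x :≤ z ⊢ b :≤ z :- x) (proj₁ (E-spec b z)) ,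
    lia 4 (b , z , m , N) (λ b z m N → z :< b :+ (m :+ # 1) :* N ⊢ z :- m :* N :< b :+ N) (proj₂ (E-spec b z))
    where
    m : ℤ
    m = E b z

  -- The permutation behind `t[ root x y ]`: for incongruent `x` and `y` the class of `x` rises by n
  -- and that of `y` falls by n.
  translation : ℤ → ℤ → ℤ → ℤ
  translation x y v = v + (δ v x - δ v y) * N

  module Raising (p q : ℤ) (p<q : p < q) (q<p+N : q < p + N) where

    p≢q : ¬ p ≋ q
    p≢q = ≋-apart p<q q<p+N

    -- The coefficients of c + (ε_p - ε_q).
    d : ℤ → ℤ
    d k = 1ℤ + (E p k - E q k)

    d-periodic : Periodic d
    d-periodic k≋l = cong (λ z → 1ℤ + z) (E-E-periodic p q k≋l)

    1≤d : ∀ k → 1ℤ ≤ d k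
    1≤d k = lia 2 (E p k , E q k) (λ x y → y :≤ x ⊢ # 1 :≤ # 1 :+ (x :- y)) (E-anti k (ℤ.<⇒≤ p<q))

    d≤2 : ∀ k → d k ≤ + 2
    d≤2 k = lia 3 (E p k , E q k , E (p + 1ℤ * N) k) (λ x y x′ → x′ :≡ x :- # 1 , x′ :≤ y ⊢ # 1 :+ (x :- y) :≤ # 2)
      (E-shiftˡ p k 1ℤ) (E-anti k (lia 3 (p , q , N) (λ p q N → q :< p :+ N ⊢ q :≤ p :+ # 1 :* N) q<p+N))

    d-step : ∀ j → d j ≡ d (j - 1ℤ) + (δ j p - δ j q)
    d-step j = lia 6 (E p j , E p (j - 1ℤ) , δ j p , E q j , E q (j - 1ℤ) , δ j q)
      (λ x x⁻ a y y⁻ b → x :≡ x⁻ :+ a , y :≡ y⁻ :+ b ⊢ # 1 :+ (x :- y) :≡ # 1 :+ (x⁻ :- y⁻) :+ (a :- b))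
      (E-jump p j) (E-jump q j)

    record Raise (σ : AffinePermutation) : Set where
      field
        {a b} : ℤ
        a<b   : a < b
        a≢b   : ¬ a ≋ b
        σa<σb : to σ a < to σ b
        flow≤ : ∀ k → flow (σ ∙ swapₚ a b) k ≤ d k

    -- With `α = root p q` these windows encode the two alternatives for β′: `x < y` gives an arc
    -- that avoids α, `y < x` an arc that wraps around and contains α without sharing an end with
    -- it.
    record Terminal (σ : AffinePermutation) : Set where
      field
        {x y}  : ℤ
        q≤x    : q ≤ x
        x<p+N  : x < p + N
        q<y    : q < y
        y≤p+N  : y ≤ p + N
        x≢y    : ¬ x ≋ y
        to≗    : to σ ≗ translation x y ∘ swap p q

    module _ (σ : AffinePermutation) (bal : Balanced σ) (flow≤d : ∀ k → flow σ k ≤ d k) where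

      free-raise : ∀ {a b} → ¬ a ≋ b → a < b → to σ a < to σ b → b ≤ to σ a ⊎ to σ b ≤ a → Raise σ
      free-raise a≢b a<b σa<σb free = record { a<b = a<b ; a≢b = a≢b ; σa<σb = σa<σb
        ; flow≤ = λ k → ℤ.≤-trans (ℤ.≤-reflexive (flow-free-swap σ a≢b a<b σa<σb free k)) (flow≤d k) }

      unit-raise : ∀ {a b} k₀ → flow σ k₀ < d k₀ → ¬ a ≋ b → a ≤ k₀ → to σ a ≤ k₀ → a ≡ k₀ ⊎ to σ a ≡ k₀ →
        k₀ + 1ℤ ≤ b → k₀ + 1ℤ ≤ to σ b → b ≡ k₀ + 1ℤ ⊎ to σ b ≡ k₀ + 1ℤ → Raise σ
      unit-raise {a} {b} k₀ slack a≢b a≤ σa≤ a∨ ≤b ≤σb b∨ = record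
        { a<b = across a≤ ≤b ; a≢b = a≢b ; σa<σb = across σa≤ ≤σb
        ; flow≤ = λ k → ℤ.≤-trans (ℤ.≤-reflexive (flow-unit-swap σ a≢b a≤ σa≤ a∨ ≤b ≤σb b∨ k)) (bound k) }
        where
        across : ∀ {i j} → i ≤ k₀ → k₀ + 1ℤ ≤ j → i < j
        across i≤ ≤j = ℤ.≤-<-trans i≤ (ℤ.<-≤-trans (i<i+1 k₀) ≤j)
        bound : ∀ k → flow σ k + δ k k₀ ≤ d k
        bound k with k ≋? k₀
        ... | yes k≋k₀ = lia 5 (flow σ k , δ k k₀ , d k , flow σ k₀ , d k₀)
              (λ f δ d f₀ d₀ → f :≡ f₀ , d :≡ d₀ , δ :≤ # 1 , f₀ :< d₀ ⊢ f :+ δ :≤ d)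
              (flow-periodic σ k≋k₀) (d-periodic k≋k₀) (δ≤1 k k₀) slack
        ... | no k≢k₀  = lia 3 (flow σ k , δ k k₀ , d k) (λ f δ d → δ :≡ # 0 , f :≤ d ⊢ f :+ δ :≤ d)
              (δ-no k≢k₀) (flow≤d k)

      pass-up-raise : ∀ {j} → ¬ from σ j ≋ j → j < to σ j → from σ j < j → Raise σ
      pass-up-raise {j} s≢j j<σj s<j = free-raise s≢j s<j
        (ℤ.≤-<-trans (ℤ.≤-reflexive (to-from σ j)) j<σj) (inj₁ (ℤ.≤-reflexive (sym (to-from σ j))))

      pass-down-raise : ∀ {j} → ¬ from σ j ≋ j → to σ j < j → j < from σ j → Raise σ
      pass-down-raise {j} s≢j σj<j j<s = free-raise (s≢j ∘ ≋-sym) j<s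
        (ℤ.<-≤-trans σj<j (ℤ.≤-reflexive (sym (to-from σ j)))) (inj₂ (ℤ.≤-reflexive (to-from σ j)))

      through-up : ∀ {j} → from σ j ≋ j → j < to σ j → from σ j < j
      through-up {j} (m , eq) j<σj = lia 4 (from σ j , j , to σ j , m * N)
        (λ s j σj x → s :≡ j :+ x , j :≡ σj :+ x , j :< σj ⊢ s :< j)
        eq (trans (sym (to-from σ j)) (trans (cong (to σ) eq) (to-+ σ j m))) j<σj

      through-down : ∀ {j} → from σ j ≋ j → to σ j < j → j < from σ j
      through-down {j} (m , eq) σj<j = lia 4 (from σ j , j , to σ j , m * N)
        (λ s j σj x → s :≡ j :+ x , j :≡ σj :+ x , σj :< j ⊢ j :< s)
        eq (trans (sym (to-from σ j)) (trans (cong (to σ) eq) (to-+ σ j m))) σj<j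

      -- A flow that does not grow at `j` yields an index, `j` or `σ⁻¹ j`, that lies at or below `j`
      -- together with its value, one of the two being `j`: the left partner of a unit exchange.
      -- `not-peak` supplies the right partner.
      not-valley : ∀ j → flow σ j ≤ flow σ (j - 1ℤ) → to σ j ≤ j ⊎ from σ j ≤ j
      not-valley j flow≤ with local σ j | ℤ.≤-total (to σ j) j
      ... | _ | inj₁ σj≤j = inj₁ σj≤j
      ... | through s≋j _ | inj₂ _ with ℤ.<-cmp (to σ j) j
      ...   | tri< σj<j _ _ = inj₁ (ℤ.<⇒≤ σj<j)
      ...   | tri≈ _ eq _   = inj₁ (ℤ.≤-reflexive eq)
      ...   | tri> _ _ j<σj = inj₂ (ℤ.<⇒≤ (through-up s≋j j<σj))
      not-valley j flow≤ | valley _ _ _ eq | inj₂ _ = ⊥-elim (lia 2 (flow σ j , flow σ (j - 1ℤ))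
        (λ f f⁻ → f :≤ f⁻ , f :≡ f⁻ :+ # 1 ⊢ :⊥) flow≤ eq)
      not-valley j flow≤ | peak _ _ s<j _  | inj₂ _ = inj₂ (ℤ.<⇒≤ s<j)
      not-valley j flow≤ | pass-up _ _ s<j | inj₂ _ = inj₂ (ℤ.<⇒≤ s<j)
      not-valley j flow≤ | pass-down _ σj<j _ | inj₂ _ = inj₁ (ℤ.<⇒≤ σj<j)

      not-peak : ∀ j → flow σ (j - 1ℤ) ≤ flow σ j → j ≤ to σ j ⊎ j ≤ from σ j
      not-peak j flow≤ with local σ j | ℤ.≤-total (to σ j) j
      ... | _ | inj₂ j≤σj = inj₁ j≤σj
      ... | through s≋j _ | inj₁ _ with ℤ.<-cmp (to σ j) j
      ...   | tri< σj<j _ _ = inj₂ (ℤ.<⇒≤ (through-down s≋j σj<j))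
      ...   | tri≈ _ eq _   = inj₁ (ℤ.≤-reflexive (sym eq))
      ...   | tri> _ _ j<σj = inj₁ (ℤ.<⇒≤ j<σj)
      not-peak j flow≤ | peak _ _ _ eq | inj₁ _ = ⊥-elim (lia 2 (flow σ j , flow σ (j - 1ℤ))
        (λ f f⁻ → f⁻ :≤ f , f :≡ f⁻ :- # 1 ⊢ :⊥) flow≤ eq)
      not-peak j flow≤ | valley _ _ j<s _  | inj₁ _ = inj₂ (ℤ.<⇒≤ j<s)
      not-peak j flow≤ | pass-down _ _ j<s | inj₁ _ = inj₂ (ℤ.<⇒≤ j<s)
      not-peak j flow≤ | pass-up _ j<σj _ | inj₁ _ = inj₁ (ℤ.<⇒≤ j<σj)

      ¬≋-1′ : ∀ {i k} → i ≋ k → ¬ i ≋ k + 1ℤ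
      ¬≋-1′ {i} {k} i≋k i≋k+1 = ¬≋-1 k (≋-trans (≋-sym i≋k) i≋k+1)

      -- Partners for a unit exchange across the gap from `k` to `k + 1` exist on both sides, and
      -- the only obstacle is that they may be congruent. Then either `k` and `k + 1` themselves
      -- serve as partners, or one of them is a pass and allows a free exchange.
      local-minimum-raise : ∀ k → flow σ k < d k →
        flow σ k ≤ flow σ (k - 1ℤ) → flow σ k ≤ flow σ (k + 1ℤ) → Raise σ
      local-minimum-raise k slack left right = by-cases (not-valley k left)
          (not-peak j (ℤ.≤-trans (ℤ.≤-reflexive (cong (flow σ) j-1)) right))
        where
        j : ℤ
        j = k + 1ℤ
        j-1 : j - 1ℤ ≡ k
        j-1 = lia 1 k λ k → ⊢ k :+ # 1 :- # 1 :≡ k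
        straight : to σ k ≤ k → j ≤ to σ j → Raise σ
        straight σk≤k j≤σj = unit-raise k slack (¬≋-1 k) ℤ.≤-refl σk≤k (inj₁ refl) ℤ.≤-refl j≤σj (inj₁ refl)
        by-cases : to σ k ≤ k ⊎ from σ k ≤ k → j ≤ to σ j ⊎ j ≤ from σ j → Raise σ
        by-cases (inj₁ σk≤k) (inj₁ j≤σj) = straight σk≤k j≤σj
        by-cases (inj₂ s≤k) (inj₂ j≤s′) = unit-raise k slack
          (λ s≋s′ → ¬≋-1 k (≋-trans (≋-reflexive (sym (to-from σ k))) (≋-trans (to-≋ σ s≋s′) (≋-reflexive (to-from σ j)))))
          s≤k (ℤ.≤-reflexive (to-from σ k)) (inj₂ (to-from σ k)) j≤s′ (ℤ.≤-reflexive (sym (to-from σ j))) (inj₂ (to-from σ j))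
        by-cases (inj₁ σk≤k) (inj₂ j≤s′) with k ≋? from σ j | j ℤ.≤? to σ j
        ... | no k≢s′ | _ = unit-raise k slack k≢s′ ℤ.≤-refl σk≤k (inj₁ refl) j≤s′ (ℤ.≤-reflexive (sym (to-from σ j))) (inj₂ (to-from σ j))
        ... | yes _ | yes j≤σj = straight σk≤k j≤σj
        ... | yes k≋s′ | no j≰σj = pass-down-raise (¬≋-1′ (≋-sym k≋s′)) (ℤ.≰⇒> j≰σj)
              (ℤ.≤∧≢⇒< j≤s′ λ j≡s′ → ¬≋-1 k (≋-trans k≋s′ (≋-reflexive (sym j≡s′))))
        by-cases (inj₂ s≤k) (inj₁ j≤σj) with from σ k ≋? j | to σ k ℤ.≤? k
        ... | no s≢j | _ = unit-raise k slack s≢j s≤k (ℤ.≤-reflexive (to-from σ k)) (inj₂ (to-from σ k)) ℤ.≤-refl j≤σj (inj₁ refl)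
        ... | yes _ | yes σk≤k = straight σk≤k j≤σj
        ... | yes s≋j | no σk≰k = pass-up-raise (λ s≋k → ¬≋-1′ s≋k s≋j) (ℤ.≰⇒> σk≰k)
              (ℤ.≤∧≢⇒< s≤k λ s≡k → ¬≋-1 k (≋-trans (≋-reflexive (sym s≡k)) s≋j))

      below-raise : ∀ k → flow σ k < d k → ∀ l → flow σ l < flow σ k → Raise σ
      below-raise k slack l below = local-minimum-raise l
          (lia 4 (flow σ l , flow σ k , d k , d l)
            (λ l k dk dl → l :< k , k :< dk , dk :≤ # 2 , # 1 :≤ dl ⊢ l :< dl) below slack (d≤2 k) (1≤d l))
          (minimal (l - 1ℤ)) (minimal (l + 1ℤ))
        where
        minimal : ∀ i → flow σ l ≤ flow σ i
        minimal i = lia 4 (flow σ l , flow σ k , d k , flow σ i)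
          (λ l k dk i → l :< k , k :< dk , dk :≤ # 2 , # 0 :≤ i ⊢ l :≤ i) below slack (d≤2 k) (0≤flow σ i)

      -- A neighbour with smaller flow has flow 0, and is then a local minimum with slack itself.
      slack-raise : ∀ k → flow σ k < d k → Raise σ
      slack-raise k slack with flow σ (k - 1ℤ) ℤ.<? flow σ k | flow σ (k + 1ℤ) ℤ.<? flow σ k
      ... | yes below | _         = below-raise k slack (k - 1ℤ) below
      ... | no _      | yes below = below-raise k slack (k + 1ℤ) below
      ... | no above  | no above′ = local-minimum-raise k slack (ℤ.≮⇒≥ above) (ℤ.≮⇒≥ above′)

      saturated? : Raise σ ⊎ (∀ k → flow σ k ≡ d k)
      saturated? with find-or-all {P = λ i → flow σ ⌜ i ⌝ ≡ d ⌜ i ⌝} at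
        where
        at : ∀ i → Raise σ ⊎ flow σ ⌜ i ⌝ ≡ d ⌜ i ⌝
        at i with ℤ.<-cmp (flow σ ⌜ i ⌝) (d ⌜ i ⌝)
        ... | tri< slack _ _ = inj₁ (slack-raise ⌜ i ⌝ slack)
        ... | tri≈ _ eq _    = inj₂ eq
        ... | tri> _ _ d<f   = contradiction (flow≤d ⌜ i ⌝) (ℤ.<⇒≱ d<f)
      ... | inj₁ raise = inj₁ raise
      ... | inj₂ all   = inj₂ λ k → trans (flow-periodic σ (≋-class k)) (trans (all (class k)) (d-periodic (≋-sym (≋-class k))))

      module _ (saturated : ∀ k → flow σ k ≡ d k) where

        flow-step : ∀ j → flow σ j ≡ flow σ (j - 1ℤ) + (δ j p - δ j q)
        flow-step j = trans (saturated j) (trans (d-step j) (cong (_+ (δ j p - δ j q)) (sym (saturated (j - 1ℤ)))))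

        Class-preserved : ℤ → Set
        Class-preserved j = ¬ j ≋ p → ¬ j ≋ q → to σ j ≋ j

        -- Away from `p` and `q` the saturated flow does not change at `j`, which excludes valleys
        -- and peaks; a pass allows a free exchange, so a preserved class is all that is left.
        preserves? : ∀ j → Raise σ ⊎ Class-preserved j
        preserves? j with local σ j
        ... | through s≋j _ = inj₂ λ _ _ → from-≋⇒to-≋ σ j s≋j
        ... | pass-up s≢j j<σj s<j   = inj₁ (pass-up-raise s≢j j<σj s<j)
        ... | pass-down s≢j σj<j j<s = inj₁ (pass-down-raise s≢j σj<j j<s)
        ... | valley _ _ _ eq = inj₂ λ j≢p j≢q → ⊥-elim (lia 4 (flow σ j , flow σ (j - 1ℤ) , δ j p , δ j q)
              (λ f f⁻ x y → f :≡ f⁻ :+ # 1 , f :≡ f⁻ :+ (x :- y) , x :≡ # 0 , y :≡ # 0 ⊢ :⊥) eq (flow-step j) (δ-no j≢p) (δ-no j≢q))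
        ... | peak _ _ _ eq = inj₂ λ j≢p j≢q → ⊥-elim (lia 4 (flow σ j , flow σ (j - 1ℤ) , δ j p , δ j q)
              (λ f f⁻ x y → f :≡ f⁻ :- # 1 , f :≡ f⁻ :+ (x :- y) , x :≡ # 0 , y :≡ # 0 ⊢ :⊥) eq (flow-step j) (δ-no j≢p) (δ-no j≢q))

        all-preserved? : Raise σ ⊎ (∀ j → Class-preserved j)
        all-preserved? with find-or-all {P = λ i → Class-preserved ⌜ i ⌝} (preserves? ∘ ⌜_⌝)
        ... | inj₁ raise = inj₁ raise
        ... | inj₂ all   = inj₂ λ j j≢p j≢q → ≋-trans (to-≋ σ (≋-class j)) (≋-trans
              (all (class j) (j≢p ∘ ≋-trans (≋-class j)) (j≢q ∘ ≋-trans (≋-class j))) (≋-sym (≋-class j)))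

        -- The saturated flow grows by one at `p`, so a valley is the only case that is neither
        -- contradictory nor open to a free exchange; `peak-at-q` is the mirror image.
        valley-at-p : Raise σ ⊎ (¬ from σ p ≋ p × p < to σ p)
        valley-at-p with local σ p
        ... | valley s≢p p<σp _ _ = inj₂ (s≢p , p<σp)
        ... | through _ eq = ⊥-elim (lia 4 (flow σ p , flow σ (p - 1ℤ) , δ p p , δ p q)
              (λ f f⁻ x y → f :≡ f⁻ , f :≡ f⁻ :+ (x :- y) , x :≡ # 1 , y :≡ # 0 ⊢ :⊥) eq (flow-step p) (δ-yes ≋-refl) (δ-no p≢q))
        ... | peak _ _ _ eq = ⊥-elim (lia 4 (flow σ p , flow σ (p - 1ℤ) , δ p p , δ p q)
              (λ f f⁻ x y → f :≡ f⁻ :- # 1 , f :≡ f⁻ :+ (x :- y) , x :≡ # 1 , y :≡ # 0 ⊢ :⊥) eq (flow-step p) (δ-yes ≋-refl) (δ-no p≢q))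
        ... | pass-up s≢j j<σj s<j   = inj₁ (pass-up-raise s≢j j<σj s<j)
        ... | pass-down s≢j σj<j j<s = inj₁ (pass-down-raise s≢j σj<j j<s)

        peak-at-q : Raise σ ⊎ (¬ from σ q ≋ q × to σ q < q)
        peak-at-q with local σ q
        ... | peak s≢q σq<q _ _ = inj₂ (s≢q , σq<q)
        ... | through _ eq = ⊥-elim (lia 4 (flow σ q , flow σ (q - 1ℤ) , δ q p , δ q q)
              (λ f f⁻ x y → f :≡ f⁻ , f :≡ f⁻ :+ (x :- y) , x :≡ # 0 , y :≡ # 1 ⊢ :⊥) eq (flow-step q) (δ-no (p≢q ∘ ≋-sym)) (δ-yes ≋-refl))
        ... | valley _ _ _ eq = ⊥-elim (lia 4 (flow σ q , flow σ (q - 1ℤ) , δ q p , δ q q)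
              (λ f f⁻ x y → f :≡ f⁻ :+ # 1 , f :≡ f⁻ :+ (x :- y) , x :≡ # 0 , y :≡ # 1 ⊢ :⊥) eq (flow-step q) (δ-no (p≢q ∘ ≋-sym)) (δ-yes ≋-refl))
        ... | pass-up s≢j j<σj s<j   = inj₁ (pass-up-raise s≢j j<σj s<j)
        ... | pass-down s≢j σj<j j<s = inj₁ (pass-down-raise s≢j σj<j j<s)

        module _ (preserved : ∀ j → Class-preserved j)
                 (σp≢p : ¬ to σ p ≋ p) (p<σp : p < to σ p) (σq≢q : ¬ to σ q ≋ q) (σq<q : to σ q < q) where

          τ : ℤ → ℤ
          τ = swap p q

          -- Every class other than those of `p` and `q` is already its own image, so by injectivity
          -- `σ p` cannot land there.
          σp≋q : to σ p ≋ q
          σp≋q with to σ p ≋? q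
          ... | yes eq = eq
          ... | no neq = contradiction (to-≋⁻¹ σ (preserved (to σ p) σp≢p neq)) σp≢p

          σq≋p : to σ q ≋ p
          σq≋p with to σ q ≋? p
          ... | yes eq = eq
          ... | no neq = contradiction (to-≋⁻¹ σ (preserved (to σ q) neq σq≢q)) σq≢q

          τ-≋p : ∀ {v} → v ≋ p → τ v ≋ q
          τ-≋p v≋p = ≋-trans (to-≋ (swapₚ p q) v≋p) (≋-reflexive (swap-left p≢q))

          τ-≋q : ∀ {v} → v ≋ q → τ v ≋ p
          τ-≋q v≋q = ≋-trans (to-≋ (swapₚ p q) v≋q) (≋-reflexive (swap-right p≢q))

          στ-≋ : ∀ v → to σ (τ v) ≋ v
          στ-≋ v with v ≋? p | v ≋? q
          ... | yes v≋p | _ = ≋-trans (to-≋ σ (τ-≋p v≋p)) (≋-trans σq≋p (≋-sym v≋p))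
          ... | no _ | yes v≋q = ≋-trans (to-≋ σ (τ-≋q v≋q)) (≋-trans σp≋q (≋-sym v≋q))
          ... | no v≢p | no v≢q = ≋-trans (≋-reflexive (cong (to σ) (swap-fix v≢p v≢q))) (preserved v v≢p v≢q)

          Ep≡0 : E p q ≡ 0ℤ
          Ep≡0 = E≡0 (ℤ.<⇒≤ p<q) q<p+N

          -- The point of observation is `q` because ε_p and ε_q have the same coefficient there,
          -- which makes the exchange of `p` and `q` invisible.
          E-τ : ∀ v → E (τ v) q ≡ E v q
          E-τ v = trans (E-swap idₚ p≢q v q) (lia 6 (E v q , E p q , E q q , (δ v p - δ v q) * E p q , (δ v p - δ v q) * E q q , δ v p - δ v q)
            (λ e x y dx dy d → d :* x :≡ # 0 , d :* y :≡ # 0 ⊢ e :- d :* (x :- y) :≡ e)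
            (trans (cong ((δ v p - δ v q) *_) Ep≡0) (ℤ.*-zeroʳ (δ v p - δ v q)))
            (trans (cong ((δ v p - δ v q) *_) (E-self q)) (ℤ.*-zeroʳ (δ v p - δ v q))))

          up down : ℤ → ℤ
          up i   = crossing i (to σ i) q
          down i = crossing (to σ i) i q

          -- `σ τ` preserves every class, so it moves `v` by a multiple of n; by `E-τ` that multiple
          -- is the net number of crossings at `q`.
          στ-shift : ∀ v → to σ (τ v) ≡ v + (up (τ v) - down (τ v)) * N
          στ-shift v with e , eq ← στ-≋ v = trans eq (cong (λ z → v + z * N) (sym (begin
            up (τ v) - down (τ v)             ≡⟨ crossing-flip (τ v) (to σ (τ v)) q ⟩
            E (τ v) q - E (to σ (τ v)) q      ≡⟨ cong₂ _-_ (E-τ v) (trans (cong (λ z → E z q) eq) (E-shiftˡ v q e)) ⟩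
            E v q - (E v q - e)             ≡⟨ lia 2 (E v q , e) (λ x e → ⊢ x :- (x :- e) :≡ e) ⟩
            e                                   ∎)))
            where open ≡-Reasoning

          up∨down : ∀ i → up i ≡ 0ℤ ⊎ down i ≡ 0ℤ
          up∨down i with ℤ.≤-total i (to σ i)
          ... | inj₁ i≤σi = inj₂ (crossing-≥ q i≤σi)
          ... | inj₂ σi≤i = inj₁ (crossing-≥ q σi≤i)

          -- α has coefficient 0 at `q`, which leaves the 1 contributed by c. With the balance,
          -- exactly one class rises and one falls, each by a single n.
          flow≡1 : flow σ q ≡ 1ℤ
          flow≡1 = trans (saturated q) (cong₂ (λ x y → 1ℤ + (x - y)) Ep≡0 (E-self q))

          shift-by : ∀ v {u w} → up (τ v) ≡ u → down (τ v) ≡ w → to σ (τ v) ≡ v + (u - w) * N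
          shift-by v u w = trans (στ-shift v) (cong₂ (λ u w → v + (u - w) * N) u w)

          +1N : ∀ v → v + (1ℤ - 0ℤ) * N ≡ v + N
          +1N v = lia 2 (v , N) λ v N → ⊢ v :+ (# 1 :- # 0) :* N :≡ v :+ N
          -1N : ∀ v → v + (0ℤ - 1ℤ) * N ≡ v - N
          -1N v = lia 2 (v , N) λ v N → ⊢ v :+ (# 0 :- # 1) :* N :≡ v :- N
          +0N : ∀ v → v + (0ℤ - 0ℤ) * N ≡ v
          +0N v = lia 2 (v , N) λ v N → ⊢ v :+ (# 0 :- # 0) :* N :≡ v

          module _ {i₀ j₀ x y : ℤ} (up₁ : up i₀ ≡ 1ℤ) (up₀ : ∀ i → ¬ i ≋ i₀ → up i ≡ 0ℤ)
                   (down₁ : down j₀ ≡ 1ℤ) (down₀ : ∀ i → ¬ i ≋ j₀ → down i ≡ 0ℤ)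
                   (τi₀≋x : τ i₀ ≋ x) (p≤x : p ≤ x) (x<p+N : x < p + N)
                   (τj₀≋y : τ j₀ ≋ y) (p+1≤y : p + 1ℤ ≤ y) (y<p+1+N : y < p + 1ℤ + N) where

            τx≋i₀ : τ x ≋ i₀
            τx≋i₀ = ≋-trans (to-≋ (swapₚ p q) (≋-sym τi₀≋x)) (≋-reflexive (swap-involutive p q i₀))
            τy≋j₀ : τ y ≋ j₀
            τy≋j₀ = ≋-trans (to-≋ (swapₚ p q) (≋-sym τj₀≋y)) (≋-reflexive (swap-involutive p q j₀))
            τ-≢ : ∀ {v w i} → τ w ≋ i → ¬ v ≋ w → ¬ τ v ≋ i
            τ-≢ τw≋i v≢w τv≋i = v≢w (to-≋⁻¹ (swapₚ p q) (≋-trans τv≋i (≋-sym τw≋i)))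
            up-x : ∀ {v} → v ≋ x → up (τ v) ≡ 1ℤ
            up-x v≋x = trans (crossing-to-periodic σ q (≋-trans (to-≋ (swapₚ p q) v≋x) τx≋i₀)) up₁
            down-y : ∀ {v} → v ≋ y → down (τ v) ≡ 1ℤ
            down-y v≋y = trans (cocrossing-to-periodic σ q (≋-trans (to-≋ (swapₚ p q) v≋y) τy≋j₀)) down₁
            down-x : ∀ {v} → v ≋ x → down (τ v) ≡ 0ℤ
            down-x {v} v≋x with up∨down (τ v)
            ... | inj₁ up≡0   = contradiction (trans (sym (up-x v≋x)) up≡0) λ ()
            ... | inj₂ down≡0 = down≡0
            x≢y : ¬ x ≋ y
            x≢y x≋y = contradiction (trans (sym (down-y x≋y)) (down-x ≋-refl)) λ ()
            up-0 : ∀ {v} → ¬ v ≋ x → up (τ v) ≡ 0ℤ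
            up-0 v≢x = up₀ _ (τ-≢ τx≋i₀ v≢x)
            down-0 : ∀ {v} → ¬ v ≋ y → down (τ v) ≡ 0ℤ
            down-0 v≢y = down₀ _ (τ-≢ τy≋j₀ v≢y)

            at-x : ∀ {v} → v ≋ x → to σ (τ v) ≡ v + N
            at-x {v} v≋x = trans (shift-by v (up-x v≋x) (down-x v≋x)) (+1N v)
            at-y : ∀ {v} → v ≋ y → to σ (τ v) ≡ v - N
            at-y {v} v≋y = trans (shift-by v (up-0 λ v≋x → x≢y (≋-trans (≋-sym v≋x) v≋y)) (down-y v≋y)) (-1N v)
            elsewhere : ∀ {v} → ¬ v ≋ x → ¬ v ≋ y → to σ (τ v) ≡ v
            elsewhere {v} v≢x v≢y = trans (shift-by v (up-0 v≢x) (down-0 v≢y)) (+0N v)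

            στ≗ : ∀ v → to σ (τ v) ≡ translation x y v
            στ≗ v with v ≋? x | v ≋? y
            ... | yes v≋x | yes v≋y = contradiction (≋-trans (≋-sym v≋x) v≋y) x≢y
            ... | yes v≋x | no v≢y  = trans (shift-by v (up-x v≋x) (down-0 v≢y)) (sym (cong₂ (λ a b → v + (a - b) * N) (δ-yes v≋x) (δ-no v≢y)))
            ... | no v≢x  | yes v≋y = trans (shift-by v (up-0 v≢x) (down-y v≋y)) (sym (cong₂ (λ a b → v + (a - b) * N) (δ-no v≢x) (δ-yes v≋y)))
            ... | no v≢x  | no v≢y  = trans (shift-by v (up-0 v≢x) (down-0 v≢y)) (sym (cong₂ (λ a b → v + (a - b) * N) (δ-no v≢x) (δ-no v≢y)))

            -- Raising the class of `p` would put `σ q` at `p + n`, beyond `q`. Likewise, in `q≢y`,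
            -- lowering the class of `q` would put `σ p` at `q - n`, below `p`.
            p≢x : p ≢ x
            p≢x p≡x = lia 4 (p , q , to σ q , N) (λ p q z N → z :≡ p :+ N , z :< q , q :< p :+ N ⊢ :⊥)
              (trans (cong (to σ) (sym (swap-left p≢q))) (at-x (≋-reflexive p≡x))) σq<q q<p+N
            q≢y : q ≢ y
            q≢y q≡y = lia 4 (p , q , to σ p , N) (λ p q z N → z :≡ q :- N , p :< z , q :< p :+ N ⊢ :⊥)
              (trans (cong (to σ) (sym (swap-right p≢q))) (at-y (≋-reflexive q≡y))) p<σp q<p+N
            p<x : p < x
            p<x = ℤ.≤∧≢⇒< p≤x p≢x
            p<y : p < y
            p<y = lia 2 (p , y) (λ p y → p :+ # 1 :≤ y ⊢ p :< y) p+1≤y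
            y≤p+N : y ≤ p + N
            y≤p+N = lia 3 (p , y , N) (λ p y N → y :< p :+ # 1 :+ N ⊢ y :≤ p :+ N) y<p+1+N

            -- Here `p < x < σ p = q < σ x = x + n`, so all jumps involved go up and exchanging `p`
            -- and `x` leaves the flow unchanged.
            raise-x : x < q → Raise σ
            raise-x x<q = free-raise p≢x′ p<x
                (subst₂ _<_ (sym σp) (sym σx) (lia 4 (p , q , x , N) (λ p q x N → p :< x , q :< p :+ N ⊢ q :< x :+ N) p<x q<p+N))
                (inj₁ (ℤ.≤-trans (ℤ.<⇒≤ x<q) (ℤ.≤-reflexive (sym σp))))
              where
              p≢x′ : ¬ p ≋ x
              p≢x′ = ≋-apart p<x x<p+N
              q≢x′ : ¬ q ≋ x
              q≢x′ q≋x = ≋-apart x<q (lia 4 (p , q , x , N) (λ p q x N → p :< x , q :< p :+ N ⊢ q :< x :+ N) p<x q<p+N) (≋-sym q≋x)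
              σp : to σ p ≡ q
              σp with q ≋? y
              ... | yes q≋y = contradiction (trans (cong (to σ) (sym (swap-right p≢q))) (at-y q≋y))
                    λ eq → lia 4 (p , q , to σ p , N) (λ p q z N → z :≡ q :- N , p :< z , q :< p :+ N ⊢ :⊥) eq p<σp q<p+N
              ... | no q≢y′ = trans (cong (to σ) (sym (swap-right p≢q))) (elsewhere q≢x′ q≢y′)
              σx : to σ x ≡ x + N
              σx = trans (cong (to σ) (sym (swap-fix (p≢x′ ∘ ≋-sym) (q≢x′ ∘ ≋-sym)))) (at-x ≋-refl)

            -- Here `σ y = y - n < σ q = p < y < q`, so all jumps involved go down and exchanging
            -- `y` and `q` is free.
            raise-y : y < q → Raise σ
            raise-y y<q = free-raise (q≢y′ ∘ ≋-sym) y<q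
                (subst₂ _<_ (sym σy) (sym σq) (lia 4 (p , q , y , N) (λ p q y N → y :< q , q :< p :+ N ⊢ y :- N :< p) y<q q<p+N))
                (inj₂ (ℤ.≤-trans (ℤ.≤-reflexive σq) (ℤ.<⇒≤ p<y)))
              where
              p≢y′ : ¬ p ≋ y
              p≢y′ = ≋-apart p<y (lia 4 (p , q , y , N) (λ p q y N → y :< q , q :< p :+ N ⊢ y :< p :+ N) y<q q<p+N)
              q≢y′ : ¬ q ≋ y
              q≢y′ q≋y = ≋-apart y<q (lia 4 (p , q , y , N) (λ p q y N → p :< y , q :< p :+ N ⊢ q :< y :+ N) p<y q<p+N) (≋-sym q≋y)
              σq : to σ q ≡ p
              σq with p ≋? x
              ... | yes p≋x = contradiction (trans (cong (to σ) (sym (swap-left p≢q))) (at-x p≋x))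
                    λ eq → lia 4 (p , q , to σ q , N) (λ p q z N → z :≡ p :+ N , z :< q , q :< p :+ N ⊢ :⊥) eq σq<q q<p+N
              ... | no p≢x′ = trans (cong (to σ) (sym (swap-left p≢q))) (elsewhere p≢x′ p≢y′)
              σy : to σ y ≡ y - N
              σy = trans (cong (to σ) (sym (swap-fix (p≢y′ ∘ ≋-sym) (q≢y′ ∘ ≋-sym)))) (at-y ≋-refl)

            conclude : Raise σ ⊎ Terminal σ
            conclude with x ℤ.<? q | y ℤ.<? q
            ... | yes x<q | _       = inj₁ (raise-x x<q)
            ... | no _    | yes y<q = inj₁ (raise-y y<q)
            ... | no x≮q  | no y≮q  = inj₂ record
                  { q≤x = ℤ.≮⇒≥ x≮q ; x<p+N = x<p+N ; q<y = ℤ.≤∧≢⇒< (ℤ.≮⇒≥ y≮q) q≢y ; y≤p+N = y≤p+N ; x≢y = x≢y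
                  ; to≗ = λ i → trans (cong (to σ) (sym (swap-involutive p q i))) (στ≗ (τ i)) }

          terminal-or-raise : Raise σ ⊎ Terminal σ
          terminal-or-raise =
            let i₀ , up₁ , up₀ = S-one up (crossing-to-periodic σ q) (λ i → 0≤crossing i (to σ i) q) flow≡1
                j₀ , down₁ , down₀ = S-one down (cocrossing-to-periodic σ q) (λ i → 0≤crossing (to σ i) i q)
                                       (trans (balanced⇒coflow≡flow σ bal q) flow≡1)
                x , τi₀≋x , p≤x , x<p+N = representative p (τ i₀)
                -- For `y` the class of `p` has to be represented by `p + n`, the upper end allowed
                -- in `Terminal`; hence its window starts at `p + 1`.
                y , τj₀≋y , p+1≤y , y<p+1+N = representative (p + 1ℤ) (τ j₀)
            in conclude up₁ up₀ down₁ down₀ τi₀≋x p≤x x<p+N τj₀≋y p+1≤y y<p+1+N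

      raise-or-terminal : Raise σ ⊎ Terminal σ
      raise-or-terminal with saturated?
      ... | inj₁ raise = inj₁ raise
      ... | inj₂ sat with all-preserved? sat | valley-at-p sat | peak-at-q sat
      ...   | inj₁ raise | _ | _ = inj₁ raise
      ...   | inj₂ _ | inj₁ raise | _ = inj₁ raise
      ...   | inj₂ _ | inj₂ _ | inj₁ raise = inj₁ raise
      ...   | inj₂ preserved | inj₂ (s≢p , p<σp) | inj₂ (s≢q , σq<q) =
              terminal-or-raise sat preserved (s≢p ∘ to-≋⇒from-≋ σ p) p<σp (s≢q ∘ to-≋⇒from-≋ σ q) σq<q

  -- Bruhat order and chains

  0≤* : ∀ {a b} → 0ℤ ≤ a → 0ℤ ≤ b → 0ℤ ≤ a * b
  0≤* {a} {b} 0≤a 0≤b = ℤ.≤-trans (ℤ.≤-reflexive (sym (ℤ.*-zeroʳ a)))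
    (ℤ.*-monoˡ-≤-nonNeg a {{ℤ.nonNegative 0≤a}} 0≤b)

  -- The termination measure of the climb: an exchange adds `2 (b - a) (σ b - σ a)`.
  energy : AffinePermutation → ℤ
  energy σ = S λ i → (to σ i - i) * (to σ i - i)

  energy-swap : ∀ σ {a b} → ¬ a ≋ b → a < b → to σ a < to σ b → energy σ < energy (σ ∙ swapₚ a b)
  energy-swap σ {a} {b} a≢b a<b σa<σb = lia 6
    (energy (σ ∙ swapₚ a b) , energy σ , a , b , to σ a , to σ b)
    (λ e′ e a b a′ b′ →
      e′ :≡ e :+ (((b′ :- a) :* (b′ :- a) :+ (a′ :- b) :* (a′ :- b)) :- ((a′ :- a) :* (a′ :- a) :+ (b′ :- b) :* (b′ :- b))) ,
      -- The increase is twice a product and each hypothesis counts once, so the product and both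
      -- inequalities are supplied twice.
      # 0 :≤ (b :- a :- # 1) :* (b′ :- a′ :- # 1) , # 0 :≤ (b :- a :- # 1) :* (b′ :- a′ :- # 1) ,
      a :< b , a :< b , a′ :< b′ , a′ :< b′ ⊢ e :< e′)
    (S-swap (λ i j → (j - i) * (j - i)) (λ i j m → lia 3 (i , j , m * N)
      λ i j x → ⊢ (j :+ x :- (i :+ x)) :* (j :+ x :- (i :+ x)) :≡ (j :- i) :* (j :- i)) σ a≢b)
    product product a<b a<b σa<σb σa<σb
    where
    gap : ∀ {i j} → i < j → 0ℤ ≤ j - i - 1ℤ
    gap {i} {j} i<j = lia 2 (i , j) (λ i j → i :< j ⊢ # 0 :≤ j :- i :- # 1) i<j
    product : 0ℤ ≤ (b - a - 1ℤ) * (to σ b - to σ a - 1ℤ)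
    product = 0≤* (gap a<b) (gap σa<σb)

  -- A jump of more than 2n would pass some point three times, against flow at most 2; for downward
  -- jumps the balance transfers the bound to `coflow`. So each of the n squares is at most (2n)².
  energy-bound : ∀ σ → Balanced σ → (∀ k → flow σ k ≤ + 2) → energy σ ≤ N * (+ 4 * N * N)
  energy-bound σ bal flow≤2 = ℤ.≤-trans
      (S-mono (λ i → (to σ i - i) * (to σ i - i)) (λ _ → + 4 * N * N) square≤)
      (ℤ.≤-reflexive (sum-const n (+ 4 * N * N)))
    where
    forward : ∀ i → to σ i ≤ i + + 2 * N
    forward i = ℤ.≮⇒≥ λ far → lia 4 (flow σ i , crossing i (to σ i) i , E i i , E (to σ i) i)
      (λ f x e e′ → f :≤ # 2 , x :≤ f , e :- e′ :≤ x , e :≡ # 0 , e′ :< -# 2 ⊢ :⊥)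
      (flow≤2 i) (term≤S (λ j → crossing j (to σ j) i) (crossing-to-periodic σ i) (λ j → 0≤crossing j (to σ j) i) i)
      (E≤crossing i (to σ i) i) (E-self i)
      (E-< (to σ i) i ℤ.-[1+ 1 ] (lia 3 (i , to σ i , N) (λ i j N → i :+ # 2 :* N :< j ⊢ i :< j :+ -# 2 :* N) far))
    -- A downward jump from `i` passes the gap between `i - 1` and `i`, hence the measurement at
    -- `i - 1`.
    backward : ∀ i → i ≤ to σ i + + 2 * N
    backward i = ℤ.≮⇒≥ λ far → lia 7
      (coflow σ k , flow σ k , crossing (to σ i) i k , E (to σ i) k , E i k , E i i , δ i i)
      (λ g f x e′ e e₀ d → g :≡ f , f :≤ # 2 , x :≤ g , e′ :- e :≤ x , e₀ :≡ e :+ d , e₀ :≡ # 0 , d :≡ # 1 , # 2 :≤ e′ ⊢ :⊥)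
      (balanced⇒coflow≡flow σ bal k) (flow≤2 k)
      (term≤S (λ j → crossing (to σ j) j k) (cocrossing-to-periodic σ k) (λ j → 0≤crossing (to σ j) j k) i)
      (E≤crossing (to σ i) i k) (E-jump i i) (E-self i) (δ-yes ≋-refl)
      (E-≥ (to σ i) k (+ 2) (lia 3 (i , to σ i , N) (λ i j N → j :+ # 2 :* N :< i ⊢ j :+ # 2 :* N :≤ i :- # 1) far))
      where
      k : ℤ
      k = i - 1ℤ
    square≤ : ∀ i → (to σ i - i) * (to σ i - i) ≤ + 4 * N * N
    square≤ i = lia 3 (i , to σ i , N)
      (λ i j N → # 0 :≤ (i :+ # 2 :* N :- j) :* (j :+ # 2 :* N :- i) ⊢ (j :- i) :* (j :- i) :≤ # 4 :* N :* N)
      (0≤* (ℤ.i≤j⇒0≤j-i (forward i)) (ℤ.i≤j⇒0≤j-i (backward i)))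

  -- Positive real roots as differences ε_a - ε_b.

  ⌜class⌝ : ∀ {z} → 0ℤ ≤ z → z < N → ⌜ class z ⌝ ≡ z
  ⌜class⌝ {z} 0≤z z<N = ≋-close (≋-sym (≋-class z))
    (lia 3 (z , ⌜ class z ⌝ , N) (λ z k N → k :< N , # 0 :≤ z ⊢ k :< z :+ N) ⌜ class z ⌝<N 0≤z)
    (lia 3 (z , ⌜ class z ⌝ , N) (λ z k N → z :< N , # 0 :≤ k ⊢ z :< k :+ N) z<N 0≤⌜ class z ⌝)

  interval-root : ∀ a b → 1 ℕ.≤ toℕ a → toℕ a ℕ.≤ toℕ b → interval a b ≡ root ⌜ a ⌝ (⌜ b ⌝ + 1ℤ)
  interval-root a b 1≤a a≤b = Vec.tabulate-cong at
    where
    A B : ℤ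
    A = ⌜ a ⌝
    B = ⌜ b ⌝ + 1ℤ
    below : ∀ {z} k → z ≤ N → z ≤ ⌜ k ⌝ + N
    below {z} k z≤N = lia 3 (z , ⌜ k ⌝ , N) (λ z k N → z :≤ N , # 0 :≤ k ⊢ z :≤ k :+ N) z≤N 0≤⌜ k ⌝
    above : ∀ {z} k → 0ℤ ≤ z → ⌜ k ⌝ < z + N
    above {z} k 0≤z = lia 3 (z , ⌜ k ⌝ , N) (λ z k N → # 0 :≤ z , k :< N ⊢ k :< z :+ N) 0≤z ⌜ k ⌝<N
    B≤N : B ≤ N
    B≤N = lia 2 (⌜ b ⌝ , N) (λ b N → b :< N ⊢ b :+ # 1 :≤ N) ⌜ b ⌝<N
    <B : ∀ k → toℕ k ℕ.≤ toℕ b → ⌜ k ⌝ < B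
    <B k k≤b = ℤ.≤-<-trans (ℤ.+≤+ k≤b) (i<i+1 ⌜ b ⌝)
    at : ∀ k → (if ⌊ toℕ a ℕ.≤? toℕ k ⌋ ∧ ⌊ toℕ k ℕ.≤? toℕ b ⌋ then 1ℤ else 0ℤ) ≡ E A ⌜ k ⌝ - E B ⌜ k ⌝
    at k with toℕ a ℕ.≤? toℕ k | toℕ k ℕ.≤? toℕ b
    ... | yes a≤k | yes k≤b = sym (cong₂ _-_ (E≡0 (ℤ.+≤+ a≤k) (above k 0≤⌜ a ⌝)) (E≡-1 (<B k k≤b) (below k B≤N)))
    ... | yes a≤k | no k≰b  = sym (cong₂ _-_ (E≡0 (ℤ.+≤+ a≤k) (above k 0≤⌜ a ⌝))
          (E≡0 (lia 2 (⌜ b ⌝ , ⌜ k ⌝) (λ b k → b :< k ⊢ b :+ # 1 :≤ k) (ℤ.+<+ (ℕ.≰⇒> k≰b)))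
            (above k (ℤ.+-mono-≤ 0≤⌜ b ⌝ (ℤ.+≤+ z≤n)))))
    ... | no a≰k  | _       = sym (cong₂ _-_ (E≡-1 (ℤ.+<+ (ℕ.≰⇒> a≰k)) (below k (ℤ.<⇒≤ ⌜ a ⌝<N)))
          (E≡-1 (<B k (ℕ.≤-trans (ℕ.<⇒≤ (ℕ.≰⇒> a≰k)) a≤b)) (below k B≤N)))

  root-⊕ : ∀ a b m → root a b ⊕ m · c ≡ root a (b + m * N)
  root-⊕ a b m = !-ext λ k → trans (⊕-! (root a b) (m · c) k) (trans
    (lia 6 (root a b ! k , E a k , E b k , (m · c) ! k , m , E (b + m * N) k)
      (λ r a b mc m b′ → r :≡ a :- b , mc :≡ m :* # 1 , b′ :≡ b :- m ⊢ r :+ mc :≡ a :- b′)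
      (root-! a b k) (trans (·-! m c k) (cong (m *_) (c-! k))) (E-shiftˡ b k m))
    (sym (root-! a (b + m * N) k)))

  𝟎⊖root : ∀ a b → 𝟎 ⊖ root a b ≡ root b a
  𝟎⊖root a b = !-ext λ k → trans (⊖-! 𝟎 (root a b) k) (trans (cong₂ _-_ (𝟎-! k) (root-! a b k))
    (trans (lia 2 (E a k , E b k) λ x y → ⊢ # 0 :- (x :- y) :≡ y :- x) (sym (root-! b a k))))

  𝟎⊖𝟎⊖ : ∀ μ → 𝟎 ⊖ (𝟎 ⊖ μ) ≡ μ
  𝟎⊖𝟎⊖ μ = !-ext λ k → trans (⊖-! 𝟎 (𝟎 ⊖ μ) k) (trans
    (cong₂ _-_ (𝟎-! k) (trans (⊖-! 𝟎 μ k) (cong (_- μ ! k) (𝟎-! k))))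
    (lia 1 (μ ! k) λ x → ⊢ # 0 :- (# 0 :- x) :≡ x))

  record Positive-root (β : Qaff) : Set where
    constructor positive-root
    field
      a b    : ℤ
      a<b    : a < b
      a≢b    : ¬ a ≋ b
      β≡root : β ≡ root a b

  finite-root : ∀ {γ} → γ ∈ Π⁺ → ∃₂ λ a b → 1ℤ ≤ a × a < b × b ≤ N × γ ≡ root a b
  finite-root (i , j , 1≤i , i≤j , eq) = ⌜ i ⌝ , ⌜ j ⌝ + 1ℤ , ℤ.+≤+ 1≤i ,
    lia 2 (⌜ i ⌝ , ⌜ j ⌝) (λ i j → i :≤ j ⊢ i :< j :+ # 1) (ℤ.+≤+ i≤j) ,
    lia 2 (⌜ j ⌝ , N) (λ j N → j :< N ⊢ j :+ # 1 :≤ N) ⌜ j ⌝<N ,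
    trans eq (interval-root i j 1≤i i≤j)

  finite-root⁻¹ : ∀ {a b} → 1ℤ ≤ a → a < b → b ≤ N → root a b ∈ Π⁺
  finite-root⁻¹ {a} {b} 1≤a a<b b≤N = class a , class (b - 1ℤ) , 1≤a′ , a′≤b′ ,
      sym (trans (interval-root (class a) (class (b - 1ℤ)) 1≤a′ a′≤b′)
        (cong₂ root a≡ (trans (cong (_+ 1ℤ) b≡) (b-1+1 b))))
    where
    a≡ : ⌜ class a ⌝ ≡ a
    a≡ = ⌜class⌝ (lia 1 a (λ a → # 1 :≤ a ⊢ # 0 :≤ a) 1≤a) (ℤ.<-≤-trans a<b b≤N)
    b≡ : ⌜ class (b - 1ℤ) ⌝ ≡ b - 1ℤ
    b≡ = ⌜class⌝ (lia 2 (a , b) (λ a b → # 1 :≤ a , a :< b ⊢ # 0 :≤ b :- # 1) 1≤a a<b)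
      (lia 2 (b , N) (λ b N → b :≤ N ⊢ b :- # 1 :< N) b≤N)
    1≤a′ : 1 ℕ.≤ toℕ (class a)
    1≤a′ = ℤ.drop‿+≤+ (subst (1ℤ ≤_) (sym a≡) 1≤a)
    a′≤b′ : toℕ (class a) ℕ.≤ toℕ (class (b - 1ℤ))
    a′≤b′ = ℤ.drop‿+≤+ (subst₂ _≤_ (sym a≡) (sym b≡) (lia 2 (a , b) (λ a b → a :< b ⊢ a :≤ b :- # 1) a<b))

  N≤*N : ∀ {m} → 0ℤ < m → N ≤ m * N
  N≤*N {m} 0<m = lia 2 (m , N) (λ m N → # 0 :≤ (m :- # 1) :* N ⊢ N :≤ m :* N)
    (0≤* (lia 1 m (λ m → # 0 :< m ⊢ # 0 :≤ m :- # 1) 0<m) (ℤ.<⇒≤ 0<N))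

  -- Adding `m c` moves the second index up by `m n`. For negative γ the indices come in reverse
  -- order and a positive `m` restores `a < b`; `m = 0` would require γ to be a positive root as
  -- well.
  Πre⁺⇒root : ∀ {β} → β ∈ Πre⁺ → Positive-root β
  Πre⁺⇒root (γ , m , inj₁ γ∈Π⁺ , β≡ , m>0∨) =
    let a , b , 1≤a , a<b , b≤N , γ≡ = finite-root γ∈Π⁺
        b≤b+mN = lia 2 (b , m * N) (λ b x → # 0 :≤ x ⊢ b :≤ b :+ x) (0≤* 0≤m (ℤ.<⇒≤ 0<N))
        b<a+N = lia 3 (a , b , N) (λ a b N → # 1 :≤ a , b :≤ N ⊢ b :< a :+ N) 1≤a b≤N
    in positive-root a (b + m * N) (ℤ.<-≤-trans a<b b≤b+mN)
         (λ a≋b+ → ≋-apart a<b b<a+N (≋-trans a≋b+ (≋-+N b m)))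
         (trans β≡ (trans (cong (_⊕ m · c) γ≡) (root-⊕ a b m)))
    where
    0≤m : 0ℤ ≤ m
    0≤m = non-negative m>0∨
      where
      non-negative : (0ℤ < m ⊎ (m ≡ 0ℤ × γ ∈ Π⁺)) → 0ℤ ≤ m
      non-negative (inj₁ 0<m)       = ℤ.<⇒≤ 0<m
      non-negative (inj₂ (m≡0 , _)) = ℤ.≤-reflexive (sym m≡0)
  Πre⁺⇒root (γ , m , inj₂ γ∈Π⁻ , β≡ , m>0∨) =
    let a , b , 1≤a , a<b , b≤N , γ≡ = finite-root γ∈Π⁻
        γ≡root = trans (sym (𝟎⊖𝟎⊖ γ)) (trans (cong (𝟎 ⊖_) γ≡) (𝟎⊖root a b))
        b<a+N = lia 3 (a , b , N) (λ a b N → # 1 :≤ a , b :≤ N ⊢ b :< a :+ N) 1≤a b≤N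
        b<a+mN = lia 4 (a , b , N , m * N) (λ a b N x → b :< a :+ N , N :≤ x ⊢ b :< a :+ x) b<a+N
                   (N≤*N (positive a<b γ≡root m>0∨))
    in positive-root b (a + m * N) b<a+mN
         (λ b≋a+ → ≋-apart a<b b<a+N (≋-sym (≋-trans b≋a+ (≋-+N a m))))
         (trans β≡ (trans (cong (_⊕ m · c) γ≡root) (root-⊕ b a m)))
    where
    positive : ∀ {a b} → a < b → γ ≡ root b a → (0ℤ < m ⊎ (m ≡ 0ℤ × γ ∈ Π⁺)) → 0ℤ < m
    positive _ _ (inj₁ 0<m) = 0<m
    positive {a} {b} a<b γ≡ (inj₂ (_ , γ∈Π⁺)) =
      let i , j , _ , i<j , _ , γ≡′ = finite-root γ∈Π⁺
      in ⊥-elim (lia 4 (E i i , E j i , E a i , E b i)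
        (λ x y z w → x :≡ # 0 , y :≤ -# 1 , w :≤ z , w :- z :≡ x :- y ⊢ :⊥)
        (E-self i) (E≤-1 i<j)
        (E-anti i (ℤ.<⇒≤ a<b))
        (trans (sym (root-! b a i)) (trans (cong (_! i) (trans (sym γ≡) γ≡′)) (root-! i j i))))

  root⇒Πre⁺ : ∀ {a b} → a < b → ¬ a ≋ b → root a b ∈ Πre⁺
  root⇒Πre⁺ {a} {b} a<b a≢b =
    -- In the window 1, ..., n the finite positive roots are the ε_{a′} - ε_{b′} with `a′ < b′`; the
    -- quotients `k` and `l` supply the multiple of c.
    let a′ , (k , a≡) , 1≤a′ , a′<1+N = representative 1ℤ a
        b′ , (l , b≡) , 1≤b′ , b′<1+N = representative 1ℤ b
    in root a′ b′ , l - k , by-cases a′ b′ k l a≡ b≡ 1≤a′ a′<1+N 1≤b′ b′<1+N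
    where
    by-cases : ∀ a′ b′ k l → a ≡ a′ + k * N → b ≡ b′ + l * N →
      1ℤ ≤ a′ → a′ < 1ℤ + N → 1ℤ ≤ b′ → b′ < 1ℤ + N →
      root a′ b′ ∈ Π × root a b ≡ root a′ b′ ⊕ (l - k) · c × (0ℤ < l - k ⊎ (l - k ≡ 0ℤ × root a′ b′ ∈ Π⁺))
    by-cases a′ b′ k l a≡ b≡ 1≤a′ a′<1+N 1≤b′ b′<1+N = cases (ℤ.<-cmp a′ b′)
      where
      ≤N : ∀ z → z < 1ℤ + N → z ≤ N
      ≤N z z<1+N = lia 2 (z , N) (λ z N → z :< # 1 :+ N ⊢ z :≤ N) z<1+N
      eq : root a b ≡ root a′ b′ ⊕ (l - k) · c
      eq = trans (root-cong (k , a≡) (lia 7 (a , b , a′ , b′ , k , l , N)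
        (λ a b a′ b′ k l N → a :≡ a′ :+ k :* N , b :≡ b′ :+ l :* N ⊢ b :- a :≡ b′ :+ (l :- k) :* N :- a′) a≡ b≡))
        (sym (root-⊕ a′ b′ (l - k)))
      cases : Tri (a′ < b′) (a′ ≡ b′) (b′ < a′) → root a′ b′ ∈ Π × root a b ≡ root a′ b′ ⊕ (l - k) · c ×
        (0ℤ < l - k ⊎ (l - k ≡ 0ℤ × root a′ b′ ∈ Π⁺))
      cases (tri≈ _ refl _) = contradiction (≋-trans {a} {a′} {b} (k , a≡) (≋-sym (l , b≡))) a≢b
      cases (tri> _ _ b′<a′) = inj₂ (subst (_∈ Π⁺) (sym (𝟎⊖root a′ b′)) (finite-root⁻¹ 1≤b′ b′<a′ (≤N a′ a′<1+N))) , eq ,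
        inj₁ (cancel-N 0ℤ (l - k) (lia 7 (a , b , a′ , b′ , k , l , N)
          (λ a b a′ b′ k l N → a :≡ a′ :+ k :* N , b :≡ b′ :+ l :* N , a :< b , b′ :< a′ ⊢ # 0 :* N :< (l :- k) :* N)
          a≡ b≡ a<b b′<a′))
      cases (tri< a′<b′ _ _) = inj₁ γ∈Π⁺ , eq , sign (ℤ.<-cmp 0ℤ (l - k))
        where
        γ∈Π⁺ : root a′ b′ ∈ Π⁺
        γ∈Π⁺ = finite-root⁻¹ 1≤a′ a′<b′ (≤N b′ b′<1+N)
        -1<l-k : -1ℤ < l - k
        -1<l-k = cancel-N -1ℤ (l - k) (lia 7 (a , b , a′ , b′ , k , l , N)
          (λ a b a′ b′ k l N → a :≡ a′ :+ k :* N , b :≡ b′ :+ l :* N , a :< b , # 1 :≤ a′ , b′ :< # 1 :+ N ⊢ -# 1 :* N :< (l :- k) :* N)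
          a≡ b≡ a<b 1≤a′ b′<1+N)
        sign : Tri (0ℤ < l - k) (0ℤ ≡ l - k) (l - k < 0ℤ) → 0ℤ < l - k ⊎ (l - k ≡ 0ℤ × root a′ b′ ∈ Π⁺)
        sign (tri< 0<m _ _) = inj₁ 0<m
        sign (tri≈ _ 0≡m _) = inj₂ (sym 0≡m , γ∈Π⁺)
        sign (tri> _ _ m<0) = ⊥-elim (lia 1 (l - k) (λ m → -# 1 :< m , m :< # 0 ⊢ :⊥) -1<l-k m<0)

  Bruhat-raise : ∀ {u v σ a b} → v ∈ Waff → Represents v σ → a < b → ¬ a ≋ b → to σ a < to σ b →
    u ≤B v → u ≤B (v ∘ refl[ root a b ])
  Bruhat-raise {u} {v} {σ} {a} {b} v∈W vσ a<b a≢b σa<σb u≤v =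
    let k , vk = hasLength v∈W
        l , wl = hasLength (waff-refl a<b a≢b v∈W)
    in step u≤v (root⇒Πre⁺ a<b a≢b) (λ _ → refl) vk wl (length-< vσ a≢b a<b σa<σb vk wl)

  module Climbing (p q : ℤ) (p<q : p < q) (q<p+N : q < p + N) where
    open Raising p q p<q q<p+N

    record Climb (u : Endo) : Set where
      field
        {top} : Endo
        {π}   : AffinePermutation
        u≤top : u ≤B top
        top∈W : top ∈ Waff
        topπ  : Represents top π
        final : Terminal π

    -- `m` exceeds the room left below the energy bound, and each exchange uses up at least one unit
    -- of that room.
    climb : ∀ m {u v σ} → N * (+ 4 * N * N) - energy σ < + m → u ≤B v → v ∈ Waff → Represents v σ →
      Balanced σ → (∀ k → flow σ k ≤ d k) → Climb u
    climb zero {σ = σ} fuel u≤v v∈W vσ bal flow≤d =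
      ⊥-elim (lia 2 (N * (+ 4 * N * N) , energy σ) (λ B e → B :- e :< # 0 , e :≤ B ⊢ :⊥) fuel
        (energy-bound σ bal λ k → ℤ.≤-trans (flow≤d k) (d≤2 k)))
    climb (suc m) {u} {v} {σ} fuel u≤v v∈W vσ bal flow≤d = continue (raise-or-terminal σ bal flow≤d)
      where
      continue : Raise σ ⊎ Terminal σ → Climb u
      continue (inj₂ terminal) = record { u≤top = u≤v ; top∈W = v∈W ; topπ = vσ ; final = terminal }
      continue (inj₁ raise) = climb m
          (lia 4 (N * (+ 4 * N * N) , energy σ , energy (σ ∙ swapₚ a b) , + m)
            (λ B e e′ m → B :- e :< # 1 :+ m , e :< e′ ⊢ B :- e′ :< m) fuel (energy-swap σ a≢b a<b σa<σb))
          (Bruhat-raise v∈W vσ a<b a≢b σa<σb u≤v) (waff-refl a<b a≢b v∈W) (represents-refl a≢b vσ)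
          (balanced-swap σ a≢b bal) flow≤
        where open Raise raise

  -- Translations and lengths

  δ-to : ∀ σ i x → δ (to σ i) (to σ x) ≡ δ i x
  δ-to σ i x with i ≋? x
  ... | yes i≋x = trans (δ-yes (to-≋ σ i≋x)) (sym (δ-yes i≋x))
  ... | no i≢x  = trans (δ-no (i≢x ∘ to-≋⁻¹ σ)) (sym (δ-no i≢x))

  translation-cong : ∀ {x y x′ y′} → x ≋ x′ → y ≋ y′ → translation x y ≗ translation x′ y′
  translation-cong x≋ y≋ v = cong₂ (λ a b → v + (a - b) * N) (δ-cong ≋-refl x≋) (δ-cong ≋-refl y≋)

  translation-inverse : ∀ x y v → translation y x (translation x y v) ≡ v
  translation-inverse x y v = trans
    (cong₂ (λ a b → translation x y v + (a - b) * N) (δ-cong (≋-+N v (δ v x - δ v y)) ≋-refl) (δ-cong (≋-+N v (δ v x - δ v y)) ≋-refl))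
    (lia 4 (v , δ v x , δ v y , N) λ v a b N → ⊢ v :+ (a :- b) :* N :+ (b :- a) :* N :≡ v)

  translationₚ : ℤ → ℤ → AffinePermutation
  translationₚ x y = record
    { to = translation x y ; from = translation y x
    ; to-+ = λ i k → trans
        (cong₂ (λ a b → i + k * N + (a - b) * N) (δ-cong (≋-+N i k) ≋-refl) (δ-cong (≋-+N i k) ≋-refl))
        (lia 5 (i , k , δ i x , δ i y , N) λ i k a b N → ⊢ i :+ k :* N :+ (a :- b) :* N :≡ i :+ (a :- b) :* N :+ k :* N)
    ; from-to = translation-inverse x y ; to-from = translation-inverse y x }

  translation-conj : ∀ σ x y i → to σ (translation x y i) ≡ translation (to σ x) (to σ y) (to σ i)
  translation-conj σ x y i = trans (to-+ σ i (δ i x - δ i y))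
    (sym (cong₂ (λ a b → to σ i + (a - b) * N) (δ-to σ i x) (δ-to σ i y)))

  -- Raising an index by n lowers `E` by one at every `k` alike, so the change is a multiple of c,
  -- and the multiplicities sum up to the pairing with the root.
  act-translation : ∀ x y → act (translation x y) ≗ t[ root x y ]
  act-translation x y μ = !-ext λ k → begin
    act (translation x y) μ ! k
      ≡⟨ act-! (translation x y) μ k ⟩
    S (λ i → μ ! i * (E (translation x y i) k - E (translation x y (i + 1ℤ)) k))
      ≡⟨ S-cong (λ i → trans
           (cong₂ (λ u v → μ ! i * (u - v)) (E-shiftˡ i k (δ i x - δ i y)) (E-shiftˡ (i + 1ℤ) k (δ (i + 1ℤ) x - δ (i + 1ℤ) y)))
           (lia 8 (μ ! i , E i k , E (i + 1ℤ) k , δ i k , δ i x , δ i y , δ (i + 1ℤ) x , δ (i + 1ℤ) y)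
             (λ m e e′ d a b a′ b′ → m :* (e :- e′) :≡ m :* d ⊢
               m :* ((e :- (a :- b)) :- (e′ :- (a′ :- b′))) :≡ m :* d :- m :* ((a :- b) :- (a′ :- b′)))
             (cong (μ ! i *_) (trans (E-δ i k) (δ-sym k i))))) ⟩
    S (λ i → μ ! i * δ i k - μ ! i * hook x y i)
      ≡⟨ S-- (λ i → μ ! i * δ i k) (λ i → μ ! i * hook x y i) ⟩
    S (λ i → μ ! i * δ i k) - S (λ i → μ ! i * hook x y i)
      ≡⟨ cong₂ _-_ (S-δ (μ !_) (!-periodic μ) k) (trans (sym (⟨⟩-root μ x y)) (⟨⟩-sym μ (root x y))) ⟩
    μ ! k - ⟨ root x y , μ ⟩
      ≡⟨ cong (λ z → μ ! k - z) (sym (trans (·-! ⟨ root x y , μ ⟩ c k) (trans (cong (⟨ root x y , μ ⟩ *_) (c-! k)) (ℤ.*-identityʳ ⟨ root x y , μ ⟩)))) ⟩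
    μ ! k - (⟨ root x y , μ ⟩ · c) ! k
      ≡⟨ ⊖-! μ (⟨ root x y , μ ⟩ · c) k ⟨
    t[ root x y ] μ ! k ∎
    where open ≡-Reasoning

  represents-t-refl : ∀ x y {p q} → ¬ p ≋ q → Represents (t[ root x y ] ∘ refl[ root p q ]) (translationₚ x y ∙ swapₚ p q)
  represents-t-refl x y {p} {q} p≢q = represents λ μ →
    trans (sym (act-translation x y (refl[ root p q ] μ))) (sym (act-swap (translationₚ x y) p≢q μ))

  -- The roots of the two reflections, `root y (x + N)` and `root x y`, add up to c: this is how a
  -- chain reaches the translation with degree c.
  translation-swaps : ∀ {x y} → ¬ x ≋ y → swap y (x + N) ∘ swap x y ≗ translation x y
  translation-swaps {x} {y} x≢y v = by-cases (v ≋? x) (v ≋? y)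
    where
    x+N≋x : x + N ≋ x
    x+N≋x = 1ℤ , lia 2 (x , N) λ x N → ⊢ x :+ N :≡ x :+ # 1 :* N
    y≢x+N : ¬ y ≋ x + N
    y≢x+N e = x≢y (≋-sym (≋-trans e x+N≋x))
    by-cases : Dec (v ≋ x) → Dec (v ≋ y) → swap y (x + N) (swap x y v) ≡ translation x y v
    by-cases (yes v≋x@(k , eq)) _ = trans (cong (swap y (x + N)) (swap-≋ˡ x≢y v≋x)) (trans
      (swap-≋ˡ y≢x+N (k , lia 4 (v , x , y , k * N) (λ v x y z → v :≡ x :+ z ⊢ v :+ (y :- x) :≡ y :+ z) eq))
      (trans (lia 4 (v , x , y , N) λ v x y N → ⊢ v :+ (y :- x) :+ (x :+ N :- y) :≡ v :+ (# 1 :- # 0) :* N)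
        (sym (cong₂ (λ a b → v + (a - b) * N) (δ-yes v≋x) (δ-no λ v≋y → x≢y (≋-trans (≋-sym v≋x) v≋y))))))
    by-cases (no v≢x) (yes v≋y@(k , eq)) = trans (cong (swap y (x + N)) (swap-≋ʳ x≢y v≋y)) (trans
      (swap-≋ʳ y≢x+N (k - 1ℤ , lia 5 (v , x , y , k , N) (λ v x y k N → v :≡ y :+ k :* N ⊢ v :- (y :- x) :≡ x :+ N :+ (k :- # 1) :* N) eq))
      (trans (lia 4 (v , x , y , N) λ v x y N → ⊢ v :- (y :- x) :- (x :+ N :- y) :≡ v :+ (# 0 :- # 1) :* N)
        (sym (cong₂ (λ a b → v + (a - b) * N) (δ-no v≢x) (δ-yes v≋y)))))
    by-cases (no v≢x) (no v≢y) = trans (cong (swap y (x + N)) (swap-fix v≢x v≢y)) (trans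
      (swap-fix v≢y λ e → v≢x (≋-trans e x+N≋x))
      (trans (lia 2 (v , N) λ v N → ⊢ v :≡ v :+ (# 0 :- # 0) :* N)
        (sym (cong₂ (λ a b → v + (a - b) * N) (δ-no v≢x) (δ-no v≢y)))))

  ≤B-id : ∀ {u} → u ≤B id → u ≗ id
  ≤B-id (equal u≗id) = u≗id
  ≤B-id (step _ _ _ _ (_ , l-min) k<l) = contradiction (ℕ.<-≤-trans k<l (l-min [] λ _ → refl)) λ ()

  -- The identity has flow 0, each edge adds at most its degree by `flow-chain`, and exchanges keep
  -- the balance.
  chain-flow : ∀ {u v} (π : Chain u v) → u ≗ id →
    ∃ λ σ → Represents v σ × Balanced σ × (∀ k → flow σ k ≤ degree π ! k)
  chain-flow (empty u≗v) u≗id =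
    idₚ , represents-cong {σ = idₚ} (λ μ → trans (sym (u≗id μ)) (u≗v μ)) (λ _ → refl) represents-id , balanced-id ,
    λ k → ℤ.≤-reflexive (trans (flow-id k) (sym (𝟎-! k)))
  chain-flow (edge {v} {w} π α α∈ w≗) u≗id =
    let σ , vσ , bal , flow≤ = chain-flow π u≗id
        positive-root a b a<b a≢b α≡ = Πre⁺⇒root α∈
    in σ ∙ swapₚ a b ,
       represents-cong {σ = σ ∙ swapₚ a b} (λ μ → sym (trans (w≗ μ) (cong v (refl-cong α≡ μ)))) (λ _ → refl) (represents-refl a≢b vσ) ,
       balanced-swap σ a≢b bal ,
       λ k → lia 6 (flow (σ ∙ swapₚ a b) k , flow σ k , E a k - E b k , degree π ! k , α ! k , (degree π ⊕ α) ! k)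
         (λ f′ f r D A D+A → f′ :≤ f :+ r , f :≤ D , A :≡ r , D+A :≡ D :+ A ⊢ f′ :≤ D+A)
         (flow-chain σ a<b a≢b k) (flow≤ k) (trans (cong (_! k) α≡) (root-! a b k)) (⊕-! (degree π) α k)

  reachable-target : ∀ {x y p q w} → p < q → ¬ p ≋ q → x < y → y < x + N →
    w ≗ t[ root x y ] ∘ refl[ root p q ] → w ∈ Reachable (c ⊕ root p q) id
  reachable-target {x} {y} {p} {q} {w} p<q p≢q x<y y<x+N w≗ =
      (proj₁ v₃∈W , λ μ → trans (w≗v₃ μ) (proj₂ v₃∈W μ)) , id , id∈W , equal (λ _ → refl) , chain ,
      λ i → subst₂ _≤_ (!-⌜⌝ (degree chain) i) (!-⌜⌝ (c ⊕ root p q) i) (ℤ.≤-reflexive (degree≡ ⌜ i ⌝))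
    where
    x≢y : ¬ x ≋ y
    x≢y = ≋-apart x<y y<x+N
    y≢x+N : ¬ y ≋ x + N
    y≢x+N = ≋-apart y<x+N (ℤ.+-monoˡ-< N x<y)
    v₁ v₂ v₃ : Endo
    v₁ = id ∘ refl[ root y (x + N) ]
    v₂ = v₁ ∘ refl[ root x y ]
    v₃ = v₂ ∘ refl[ root p q ]
    id∈W : id ∈ Waff
    id∈W = [] , λ _ → refl
    v₃∈W : v₃ ∈ Waff
    v₃∈W = waff-refl p<q p≢q (waff-refl x<y x≢y (waff-refl y<x+N y≢x+N id∈W))
    v₃σ : Represents v₃ (((idₚ ∙ swapₚ y (x + N)) ∙ swapₚ x y) ∙ swapₚ p q)
    v₃σ = represents-refl {σ = (idₚ ∙ swapₚ y (x + N)) ∙ swapₚ x y} p≢q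
      (represents-refl {σ = idₚ ∙ swapₚ y (x + N)} x≢y (represents-refl {σ = idₚ} y≢x+N represents-id))
    w≗v₃ : w ≗ v₃
    w≗v₃ μ = trans (w≗ μ) (same-action (represents-t-refl x y p≢q) v₃σ (λ i → sym (translation-swaps x≢y (swap p q i))) μ)
    chain : Chain id w
    chain = edge (edge (edge (empty λ _ → refl) (root y (x + N)) (root⇒Πre⁺ y<x+N y≢x+N) λ _ → refl)
      (root x y) (root⇒Πre⁺ x<y x≢y) λ _ → refl) (root p q) (root⇒Πre⁺ p<q p≢q) w≗v₃
    degree≡ : ∀ k → degree chain ! k ≡ (c ⊕ root p q) ! k
    degree≡ k = trans (⊕-! ((𝟎 ⊕ root y (x + N)) ⊕ root x y) (root p q) k) (trans
      (cong (_+ root p q ! k) (trans (⊕-! (𝟎 ⊕ root y (x + N)) (root x y) k)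
        (lia 8 ((𝟎 ⊕ root y (x + N)) ! k , 𝟎 ! k , root y (x + N) ! k , root x y ! k , c ! k , E x k , E y k , E (x + N) k)
          (λ s z r r′ c x y x′ → s :≡ z :+ r , z :≡ # 0 , r :≡ y :- x′ , r′ :≡ x :- y , x′ :≡ x :- # 1 , c :≡ # 1 ⊢ s :+ r′ :≡ c)
          (⊕-! 𝟎 (root y (x + N)) k) (𝟎-! k) (root-! y (x + N) k) (root-! x y k)
          (trans (cong (λ z → E z k) (lia 2 (x , N) λ x N → ⊢ x :+ N :≡ x :+ # 1 :* N)) (E-shiftˡ x k 1ℤ)) (c-! k))))
      (sym (⊕-! c (root p q) k)))

  -- Moving one value past n - 1 others.

  record Moved (k : ℕ) (P : AffinePermutation → Set) : Set where
    constructor moved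
    field
      {v}    : Endo
      {σ}    : AffinePermutation
      vσ     : Represents v σ
      length≡ : HasLength v k
      prop   : P σ

  -- The value at a moves m places to the left past smaller values.
  MovedLeft : AffinePermutation → ℤ → ℤ → AffinePermutation → Set
  MovedLeft σ a m π = to π (a - m) ≡ to σ a ×
    (∀ j → a - N < j → j < a - m → to π j ≡ to σ j) ×
    (∀ j → a - m < j → j ≤ a → to π j ≡ to σ (j - 1ℤ))

  -- Each step exchanges adjacent positions of which the left one holds a smaller value, an ascent
  -- that adds exactly one to the length. With `m < n` the positions touched are pairwise
  -- incongruent, so periodic copies do not interfere.
  move-left : ∀ m {v σ k} a → + m < N → Represents v σ → HasLength v k →
    (∀ j → a - N < j → j < a → to σ j < to σ a) → Moved (m ℕ.+ k) (MovedLeft σ a (+ m))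
  move-left zero {σ = σ} a _ vσ vk _ = moved vσ vk (cong (to σ) (ℤ.+-identityʳ a) , (λ _ _ _ → refl) ,
    λ j lo hi → ⊥-elim (lia 2 (a , j) (λ a j → a :- # 0 :< j , j :≤ a ⊢ :⊥) lo hi))
  move-left (suc m) {v} {σ} {k} a m<N vσ vk smaller = extend (move-left m a
      (lia 2 (+ m , N) (λ m N → # 1 :+ m :< N ⊢ m :< N) m<N) vσ vk smaller)
    where
    j : ℤ
    j = a - + suc m
    j+1 : j + 1ℤ ≡ a - + m
    j+1 = lia 2 (a , + m) λ a m → ⊢ a :- (# 1 :+ m) :+ # 1 :≡ a :- m
    a-N<j : a - N < j
    a-N<j = lia 3 (a , + m , N) (λ a m N → # 1 :+ m :< N ⊢ a :- N :< a :- (# 1 :+ m)) m<N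
    0≤m : 0ℤ ≤ + m
    0≤m = ℤ.+≤+ z≤n
    j<a : j < a
    j<a = lia 2 (a , + m) (λ a m → # 0 :≤ m ⊢ a :- (# 1 :+ m) :< a) 0≤m
    j<a-m : j < a - + m
    j<a-m = ℤ.<-≤-trans (i<i+1 j) (ℤ.≤-reflexive j+1)
    extend : Moved (m ℕ.+ k) (MovedLeft σ a (+ m)) → Moved (suc m ℕ.+ k) (MovedLeft σ a (+ suc m))
    extend (moved {v′} {π} vπ vl (here , left , right)) = moved (represents-refl (¬≋-1 j) vπ)
        (ascend j vπ (subst₂ _<_ (sym (left j a-N<j j<a-m)) (sym (trans (cong (to π) j+1) here)) (smaller j a-N<j j<a)) vl)
        (trans (cong (to π) (trans (swap-left (¬≋-1 j)) j+1)) here , left′ , right′)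
      where
      left′ : ∀ i → a - N < i → i < j → to π (swap j (j + 1ℤ) i) ≡ to σ i
      left′ i lo hi = trans (cong (to π) (swap-fix
          (≋-apart hi (lia 4 (i , j , a , N) (λ i j a N → a :- N :< i , j :< a ⊢ j :< i :+ N) lo j<a))
          (≋-apart (ℤ.<-trans hi (i<i+1 j)) (lia 4 (i , j , a , N) (λ i j a N → a :- N :< i , j :< a ⊢ j :+ # 1 :< i :+ N) lo j<a))))
        (left i lo (ℤ.<-trans hi j<a-m))
      right′ : ∀ i → j < i → i ≤ a → to π (swap j (j + 1ℤ) i) ≡ to σ (i - 1ℤ)
      right′ i lo hi with i ℤ.≟ j + 1ℤ
      ... | yes refl = trans (cong (to π) (swap-right (¬≋-1 j))) (trans (left j a-N<j j<a-m)
            (cong (to σ) (lia 1 j λ j → ⊢ j :≡ j :+ # 1 :- # 1)))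
      ... | no i≢j+1 = trans (cong (to π) (swap-fix
          (≋-apart lo (lia 4 (i , j , a , N) (λ i j a N → a :- N :< j , i :≤ a ⊢ i :< j :+ N) a-N<j hi) ∘ ≋-sym)
          (≋-apart j+1<i (lia 4 (i , j , a , N) (λ i j a N → a :- N :< j , i :≤ a ⊢ i :< j :+ # 1 :+ N) a-N<j hi) ∘ ≋-sym)))
        (right i (ℤ.≤-<-trans (ℤ.≤-reflexive (sym j+1)) j+1<i) hi)
        where
        j+1<i : j + 1ℤ < i
        j+1<i = sucℤ-< lo (i≢j+1 ∘ sym)

  MovedRight : AffinePermutation → ℤ → ℤ → AffinePermutation → Set
  MovedRight σ a m π = to π (a + m) ≡ to σ a ×
    (∀ j → a + m < j → j < a + N → to π j ≡ to σ j) ×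
    (∀ j → a ≤ j → j < a + m → to π j ≡ to σ (j + 1ℤ))

  move-right : ∀ m {v σ k} a → + m < N → Represents v σ → HasLength v k →
    (∀ j → a < j → j < a + N → to σ a < to σ j) → Moved (m ℕ.+ k) (MovedRight σ a (+ m))
  move-right zero {σ = σ} a _ vσ vk _ = moved vσ vk (cong (to σ) (ℤ.+-identityʳ a) , (λ _ _ _ → refl) ,
    λ j lo hi → ⊥-elim (lia 2 (a , j) (λ a j → a :≤ j , j :< a :+ # 0 ⊢ :⊥) lo hi))
  move-right (suc m) {v} {σ} {k} a m<N vσ vk larger = extend (move-right m a
      (lia 2 (+ m , N) (λ m N → # 1 :+ m :< N ⊢ m :< N) m<N) vσ vk larger)
    where
    j : ℤ
    j = a + + m
    j+1 : a + + suc m ≡ j + 1ℤ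
    j+1 = lia 2 (a , + m) λ a m → ⊢ a :+ (# 1 :+ m) :≡ a :+ m :+ # 1
    j+1<a+N : j + 1ℤ < a + N
    j+1<a+N = lia 3 (a , + m , N) (λ a m N → # 1 :+ m :< N ⊢ a :+ m :+ # 1 :< a :+ N) m<N
    a≤j : a ≤ j
    a≤j = lia 2 (a , + m) (λ a m → # 0 :≤ m ⊢ a :≤ a :+ m) (ℤ.+≤+ z≤n)
    extend : Moved (m ℕ.+ k) (MovedRight σ a (+ m)) → Moved (suc m ℕ.+ k) (MovedRight σ a (+ suc m))
    extend (moved {v′} {π} vπ vl (here , right , left)) = moved (represents-refl (¬≋-1 j) vπ)
        (ascend j vπ (subst₂ _<_ (sym here) (sym (right (j + 1ℤ) (i<i+1 j) j+1<a+N)) (larger (j + 1ℤ) (ℤ.≤-<-trans a≤j (i<i+1 j)) j+1<a+N)) vl)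
        (trans (cong (to π ∘ swap j (j + 1ℤ)) j+1) (trans (cong (to π) (swap-right (¬≋-1 j))) here) , right′ , left′)
      where
      right′ : ∀ i → a + + suc m < i → i < a + N → to π (swap j (j + 1ℤ) i) ≡ to σ i
      right′ i lo hi = trans (cong (to π) (swap-fix
          (≋-apart (ℤ.<-trans (i<i+1 j) j+1<i) (lia 4 (i , j , a , N) (λ i j a N → i :< a :+ N , a :≤ j ⊢ i :< j :+ N) hi a≤j) ∘ ≋-sym)
          (≋-apart j+1<i (lia 4 (i , j , a , N) (λ i j a N → i :< a :+ N , a :≤ j ⊢ i :< j :+ # 1 :+ N) hi a≤j) ∘ ≋-sym)))
        (right i (ℤ.<-trans (i<i+1 j) j+1<i) hi)
        where
        j+1<i : j + 1ℤ < i
        j+1<i = ℤ.≤-<-trans (ℤ.≤-reflexive (sym j+1)) lo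
      left′ : ∀ i → a ≤ i → i < a + + suc m → to π (swap j (j + 1ℤ) i) ≡ to σ (i + 1ℤ)
      left′ i lo hi with i ℤ.≟ j
      ... | yes refl = trans (cong (to π) (swap-left (¬≋-1 j))) (right (j + 1ℤ) (i<i+1 j) j+1<a+N)
      ... | no i≢j = trans (cong (to π) (swap-fix
          (≋-apart i<j (lia 4 (i , j , a , N) (λ i j a N → a :≤ i , j :+ # 1 :< a :+ N ⊢ j :< i :+ N) lo j+1<a+N))
          (≋-apart (ℤ.<-trans i<j (i<i+1 j)) (lia 4 (i , j , a , N) (λ i j a N → a :≤ i , j :+ # 1 :< a :+ N ⊢ j :+ # 1 :< i :+ N) lo j+1<a+N))))
        (left i lo i<j)
        where
        i<j : i < j
        i<j = ℤ.≤∧≢⇒< (lia 2 (i , j) (λ i j → i :< j :+ # 1 ⊢ i :≤ j) (ℤ.<-≤-trans hi (ℤ.≤-reflexive j+1))) i≢j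

  N≡ : N ≡ 1ℤ + + (n ℕ.∸ 1)
  N≡ = cong +_ (sym (ℕ.m+[n∸m]≡n (ℕ.≤-trans (s≤s z≤n) n≥3)))

  n-1<N : + (n ℕ.∸ 1) < N
  n-1<N = lia 2 (+ (n ℕ.∸ 1) , N) (λ m N → N :≡ # 1 :+ m ⊢ m :< N) N≡

  Equivariant : (ℤ → ℤ) → Set
  Equivariant f = ∀ i k → f (i + k * N) ≡ f i + k * N

  equivariant-≗ : ∀ {f g} → Equivariant f → Equivariant g → ∀ b → (∀ j → b ≤ j → j < b + N → f j ≡ g j) → f ≗ g
  equivariant-≗ {f} {g} f-+ g-+ b f≡g i =
    let j , (k , i≡) , b≤j , j<b+N = representative b i
    in trans (cong f i≡) (trans (f-+ j k) (trans (cong (_+ k * N) (f≡g j b≤j j<b+N))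
         (sym (trans (cong g i≡) (g-+ j k)))))

  -- After n - 1 steps the moved value sits at `a - (n - 1)` or `a + (n - 1)`, congruent to `a + 1`
  -- or `a - 1`; the delta corrects that one class, while all others slide by one place.
  left-cycle right-cycle : ℤ → ℤ → ℤ
  left-cycle a i  = i - 1ℤ + δ i (a + 1ℤ) * N
  right-cycle a i = i + 1ℤ - δ i (a - 1ℤ) * N

  left-cycle-+ : ∀ a → Equivariant (left-cycle a)
  left-cycle-+ a i k = trans (cong (λ z → i + k * N - 1ℤ + z * N) (δ-cong (≋-+N i k) ≋-refl))
    (lia 4 (i , k , δ i (a + 1ℤ) , N) λ i k d N → ⊢ i :+ k :* N :- # 1 :+ d :* N :≡ i :- # 1 :+ d :* N :+ k :* N)

  right-cycle-+ : ∀ a → Equivariant (right-cycle a)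
  right-cycle-+ a i k = trans (cong (λ z → i + k * N + 1ℤ - z * N) (δ-cong (≋-+N i k) ≋-refl))
    (lia 4 (i , k , δ i (a - 1ℤ) , N) λ i k d N → ⊢ i :+ k :* N :+ # 1 :- d :* N :≡ i :+ # 1 :- d :* N :+ k :* N)

  equivariant-∘ : ∀ σ {f} → Equivariant f → Equivariant (to σ ∘ f)
  equivariant-∘ σ {f} f-+ i k = trans (cong (to σ) (f-+ i k)) (to-+ σ (f i) k)

  moved-left-≗ : ∀ σ a π → MovedLeft σ a (+ (n ℕ.∸ 1)) π → to π ≗ to σ ∘ left-cycle a
  moved-left-≗ σ a π (here , _ , right) = equivariant-≗ (to-+ π) (equivariant-∘ σ (left-cycle-+ a)) (a - M) at
    where
    M : ℤ
    M = + (n ℕ.∸ 1)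
    a-M≋a+1 : a - M ≋ a + 1ℤ
    a-M≋a+1 = -1ℤ , lia 3 (a , M , N) (λ a M N → N :≡ # 1 :+ M ⊢ a :- M :≡ a :+ # 1 :+ -# 1 :* N) N≡
    at : ∀ j → a - M ≤ j → j < a - M + N → to π j ≡ to σ (left-cycle a j)
    at j lo hi with j ℤ.≟ a - M
    ... | yes refl = trans here (cong (to σ) (sym (trans (cong (λ z → j - 1ℤ + z * N) (δ-yes a-M≋a+1))
          (lia 3 (a , M , N) (λ a M N → N :≡ # 1 :+ M ⊢ a :- M :- # 1 :+ # 1 :* N :≡ a) N≡))))
    ... | no j≢ = trans (right j lo′ (lia 4 (a , j , M , N) (λ a j M N → j :< a :- M :+ N , N :≡ # 1 :+ M ⊢ j :≤ a) hi N≡))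
          (cong (to σ) (sym (trans (cong (λ z → j - 1ℤ + z * N) (δ-no λ j≋ → ≋-apart lo′ hi (≋-sym (≋-trans j≋ (≋-sym a-M≋a+1)))))
            (lia 2 (j , N) λ j N → ⊢ j :- # 1 :+ # 0 :* N :≡ j :- # 1))))
      where
      lo′ : a - M < j
      lo′ = ℤ.≤∧≢⇒< lo (j≢ ∘ sym)

  moved-right-≗ : ∀ σ a π → MovedRight σ a (+ (n ℕ.∸ 1)) π → to π ≗ to σ ∘ right-cycle a
  moved-right-≗ σ a π (here , _ , left) = equivariant-≗ (to-+ π) (equivariant-∘ σ (right-cycle-+ a)) a at
    where
    M : ℤ
    M = + (n ℕ.∸ 1)
    a+M≋a-1 : a + M ≋ a - 1ℤ
    a+M≋a-1 = 1ℤ , lia 3 (a , M , N) (λ a M N → N :≡ # 1 :+ M ⊢ a :+ M :≡ a :- # 1 :+ # 1 :* N) N≡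
    at : ∀ j → a ≤ j → j < a + N → to π j ≡ to σ (right-cycle a j)
    at j lo hi with j ℤ.≟ a + M
    ... | yes refl = trans here (cong (to σ) (sym (trans (cong (λ z → j + 1ℤ - z * N) (δ-yes a+M≋a-1))
          (lia 3 (a , M , N) (λ a M N → N :≡ # 1 :+ M ⊢ a :+ M :+ # 1 :- # 1 :* N :≡ a) N≡))))
    ... | no j≢ = trans (left j lo hi′)
          (cong (to σ) (sym (trans (cong (λ z → j + 1ℤ - z * N) (δ-no λ j≋ → ≋-apart hi′ hi″ (≋-trans j≋ (≋-sym a+M≋a-1))))
            (lia 2 (j , N) λ j N → ⊢ j :+ # 1 :- # 0 :* N :≡ j :+ # 1))))
      where
      hi′ : j < a + M
      hi′ = ℤ.≤∧≢⇒< (lia 4 (a , j , M , N) (λ a j M N → j :< a :+ N , N :≡ # 1 :+ M ⊢ j :≤ a :+ M) hi N≡) j≢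
      hi″ : a + M < j + N
      hi″ = lia 4 (a , j , M , N) (λ a j M N → a :≤ j , N :≡ # 1 :+ M ⊢ a :+ M :< j :+ N) lo N≡

  -- The two slides cancel and the two wrap-arounds remain, one raising the class of `a` and one
  -- lowering that of `b`. This is the origin of the 2(n - 1) in the length.
  left-right-cycle : ∀ a b i → left-cycle a (right-cycle (b + 1ℤ) i) ≡ translation a b i
  left-right-cycle a b i = trans
    (cong₂ (λ d e → i + 1ℤ - d * N - 1ℤ + e * N)
      (δ-cong ≋-refl (≋-reflexive (lia 1 b λ b → ⊢ b :+ # 1 :- # 1 :≡ b))) first)
    (lia 4 (i , δ i a , δ i b , N) λ i x y N → ⊢ i :+ # 1 :- y :* N :- # 1 :+ x :* N :≡ i :+ (x :- y) :* N)
    where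
    j : ℤ
    j = right-cycle (b + 1ℤ) i
    j≋i+1 : j ≋ i + 1ℤ
    j≋i+1 = - δ i (b + 1ℤ - 1ℤ) ,
      lia 3 (i , δ i (b + 1ℤ - 1ℤ) , N) λ i d N → ⊢ i :+ # 1 :- d :* N :≡ i :+ # 1 :+ neg d :* N
    cancel : ∀ k → k + 1ℤ + -1ℤ ≡ k
    cancel k = lia 1 k λ k → ⊢ k :+ # 1 :+ -# 1 :≡ k
    first : δ j (a + 1ℤ) ≡ δ i a
    first with i ≋? a
    ... | yes i≋a = trans (δ-yes (≋-trans j≋i+1 (≋-+ 1ℤ i≋a))) (sym (δ-yes i≋a))
    ... | no i≢a = trans (δ-no λ j≋ → i≢a (subst₂ _≋_ (cancel i) (cancel a) (≋-+ -1ℤ (≋-trans (≋-sym j≋i+1) j≋)))) (sym (δ-no i≢a))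

  -- Lengths of the elements t_β′ s_α.

  module Targets (p q : ℤ) (p<q : p < q) (q<p+N : q < p + N) where
    open Raising p q p<q q<p+N using (p≢q; d; d-periodic; Terminal)
    open Climbing p q p<q q<p+N

    α : Qaff
    α = root p q

    record Admissible (x y : ℤ) : Set where
      constructor admissible
      field
        q≤x   : q ≤ x
        x<p+N : x < p + N
        q<y   : q < y
        y≤p+N : y ≤ p + N
        x≢y   : ¬ x ≋ y

    target : ℤ → ℤ → Endo
    target x y = t[ root x y ] ∘ refl[ α ]

    reflection-length : ∃ λ m → HasLength refl[ α ] m
    reflection-length = hasLength (waff-refl {id} p<q p≢q ([] , λ _ → refl))

    m : ℕ
    m = proj₁ reflection-length

    refl-represents : Represents refl[ α ] (swapₚ p q)
    refl-represents = represents (refl-act p≢q)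

    τ : ℤ → ℤ
    τ = swap p q

    +N≋ : ∀ z → z + N ≋ z
    +N≋ z = 1ℤ , lia 2 (z , N) λ z N → ⊢ z :+ N :≡ z :+ # 1 :* N

    τ-≤ : ∀ {v} → ¬ v ≋ p → τ v ≤ v
    τ-≤ {v} v≢p with v ≋? q
    ... | yes v≋q = lia 4 (p , q , v , τ v) (λ p q v z → z :≡ v :- (q :- p) , p :< q ⊢ z :≤ v) (swap-≋ʳ p≢q v≋q) p<q
    ... | no v≢q  = ℤ.≤-reflexive (swap-fix v≢p v≢q)

    τ-≥ : ∀ {v} → ¬ v ≋ q → v ≤ τ v
    τ-≥ {v} v≢q with v ≋? p
    ... | yes v≋p = lia 4 (p , q , v , τ v) (λ p q v z → z :≡ v :+ (q :- p) , p :< q ⊢ v :≤ z) (swap-≋ˡ p≢q v≋p) p<q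
    ... | no v≢p  = ℤ.≤-reflexive (sym (swap-fix v≢p v≢q))

    -- `x` is not congruent to `p`, so `τ` does not raise it. A larger `v` can fall only if it is
    -- congruent to `q`; then `v ≥ q + n`, and `τ v ≥ p + n` still exceeds `x`.
    τ-above : ∀ {x v} → q ≤ x → x < p + N → x < v → τ x < τ v
    τ-above {x} {v} q≤x x<p+N x<v = ℤ.≤-<-trans (τ-≤ (≋-apart (ℤ.<-≤-trans p<q q≤x) x<p+N ∘ ≋-sym)) (beyond (v ≋? q))
      where
      beyond : Dec (v ≋ q) → x < τ v
      beyond (no v≢q)  = ℤ.<-≤-trans x<v (τ-≥ v≢q)
      beyond (yes v≋q) = lia 6 (p , q , x , v , τ v , N) (λ p q x v z N → z :≡ v :- (q :- p) , q :+ N :≤ v , x :< p :+ N ⊢ x :< z)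
        (swap-≋ʳ p≢q v≋q) (≋-<⇒+N≤ (ℤ.≤-<-trans q≤x x<v) (≋-sym v≋q)) x<p+N

    τ-below : ∀ {y v} → q < y → y ≤ p + N → v < y → τ v < τ y
    τ-below {y} {v} q<y y≤p+N v<y = ℤ.<-≤-trans (beyond (v ≋? p))
        (τ-≥ (≋-apart q<y (ℤ.≤-<-trans y≤p+N (ℤ.+-monoˡ-< N p<q)) ∘ ≋-sym))
      where
      v≤p : v ≋ p → v ≤ p
      v≤p v≋p = ℤ.≮⇒≥ λ p<v → ℤ.<-irrefl refl (ℤ.<-≤-trans v<y (ℤ.≤-trans y≤p+N (≋-<⇒+N≤ p<v (≋-sym v≋p))))
      beyond : Dec (v ≋ p) → τ v < y
      beyond (no v≢p)  = ℤ.≤-<-trans (τ-≤ v≢p) v<y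
      beyond (yes v≋p) = lia 5 (p , q , y , v , τ v) (λ p q y v z → z :≡ v :+ (q :- p) , v :≤ p , q :< y ⊢ z :< y)
        (swap-≋ˡ p≢q v≋p) (v≤p v≋p) q<y

    -- The bounds on `x` make it a left-to-right maximum of `τ`: this is the contrapositive of
    -- `τ-above`, with positions and values interchanged because `τ` is an involution. Likewise
    -- `y-below` makes `y` a right-to-left minimum.
    x-above : ∀ {x} → q ≤ x → x < p + N → ∀ j → j < τ x → τ j < τ (τ x)
    x-above {x} q≤x x<p+N j j<τx = subst (τ j <_) (sym (swap-involutive p q x)) (ℤ.≰⇒> λ x≤τj →
      ℤ.<-asym j<τx (subst (τ x <_) (swap-involutive p q j) (τ-above q≤x x<p+N (ℤ.≤∧≢⇒< x≤τj
        λ x≡τj → ℤ.<⇒≢ j<τx (trans (sym (swap-involutive p q j)) (cong τ (sym x≡τj)))))))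

    y-below : ∀ {y} → q < y → y ≤ p + N → ∀ j → τ y < j → y < τ j
    y-below {y} q<y y≤p+N j τy<j = ℤ.≰⇒> λ τj≤y →
      ℤ.<-asym τy<j (subst (_< τ y) (swap-involutive p q j) (τ-below q<y y≤p+N (ℤ.≤∧≢⇒< τj≤y
        λ τj≡y → ℤ.<⇒≢ τy<j (trans (cong τ (sym τj≡y)) (swap-involutive p q j)))))

    -- Starting from s_α, first the value x moves n - 1 places to the left and then y moves n - 1 places to the right.
    target-length : ∀ {x y w} → Admissible x y → w ≗ target x y → HasLength w (2 ℕ.* (n ℕ.∸ 1) ℕ.+ m)
    target-length {x} {y} {w} (admissible q≤x x<p+N q<y y≤p+N x≢y) w≗ =
      from-left (move-left (n ℕ.∸ 1) (τ x) n-1<N refl-represents (proj₂ reflection-length) (λ j _ → x-above q≤x x<p+N j))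
      where
      M : ℕ
      M = n ℕ.∸ 1
      -- The value `y` stood at position `τ y`; the passage of `x` has pushed it one place to the
      -- right.
      b : ℤ
      b = τ y + 1ℤ
      from-left : Moved (M ℕ.+ m) (MovedLeft (swapₚ p q) (τ x) (+ M)) → HasLength w (2 ℕ.* M ℕ.+ m)
      from-left (moved {v₁} {π₁} v₁π₁ l₁ left) = from-right (move-right M b n-1<N v₁π₁ l₁ larger)
        where
        π₁≗ : to π₁ ≗ τ ∘ left-cycle (τ x)
        π₁≗ = moved-left-≗ (swapₚ p q) (τ x) π₁ left
        b≢ : ¬ b ≋ τ x + 1ℤ
        b≢ e = x≢y (to-≋⁻¹ (swapₚ p q) (≋-sym (subst₂ _≋_ (cancel (τ y)) (cancel (τ x)) (≋-+ -1ℤ e))))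
          where
          cancel : ∀ k → k + 1ℤ + -1ℤ ≡ k
          cancel k = lia 1 k λ k → ⊢ k :+ # 1 :+ -# 1 :≡ k
        π₁b : to π₁ b ≡ y
        π₁b = trans (π₁≗ b) (trans (cong τ (trans (cong (λ z → b - 1ℤ + z * N) (δ-no b≢))
          (lia 2 (τ y , N) λ y N → ⊢ y :+ # 1 :- # 1 :+ # 0 :* N :≡ y))) (swap-involutive p q y))
        larger : ∀ j → b < j → j < b + N → to π₁ b < to π₁ j
        larger j lo _ = subst₂ _<_ (sym π₁b) (sym (trans (π₁≗ j) (swap-+ p q (j - 1ℤ) (δ j (τ x + 1ℤ)))))
          (ℤ.<-≤-trans
            (y-below q<y y≤p+N (j - 1ℤ) (lia 2 (τ y , j) (λ y j → y :+ # 1 :< j ⊢ y :< j :- # 1) lo))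
            (lia 2 (τ (j - 1ℤ) , δ j (τ x + 1ℤ) * N) (λ z d → # 0 :≤ d ⊢ z :≤ z :+ d)
              (0≤* (0≤δ j (τ x + 1ℤ)) (ℤ.<⇒≤ 0<N))))
        from-right : Moved (M ℕ.+ (M ℕ.+ m)) (MovedRight π₁ b (+ M)) → HasLength w (2 ℕ.* M ℕ.+ m)
        from-right (moved {v₂} {π₂} v₂π₂ l₂ right) = HasLength-cong v₂≗w (subst (HasLength v₂) length-eq l₂)
          where
          length-eq : M ℕ.+ (M ℕ.+ m) ≡ 2 ℕ.* M ℕ.+ m
          length-eq = trans (sym (ℕ.+-assoc M M m)) (cong (λ z → M ℕ.+ z ℕ.+ m) (sym (ℕ.+-identityʳ M)))
          π₂≗ : ∀ i → to π₂ i ≡ translation x y (τ i)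
          π₂≗ i = begin
            to π₂ i                                          ≡⟨ moved-right-≗ π₁ b π₂ right i ⟩
            to π₁ (right-cycle b i)                          ≡⟨ π₁≗ (right-cycle b i) ⟩
            τ (left-cycle (τ x) (right-cycle b i))           ≡⟨ cong τ (left-right-cycle (τ x) (τ y) i) ⟩
            τ (translation (τ x) (τ y) i)                    ≡⟨ translation-conj (swapₚ p q) (τ x) (τ y) i ⟩
            translation (τ (τ x)) (τ (τ y)) (τ i)            ≡⟨ cong₂ (λ a b → translation a b (τ i)) (swap-involutive p q x) (swap-involutive p q y) ⟩
            translation x y (τ i)                            ∎
            where open ≡-Reasoning
          v₂≗w : v₂ ≗ w
          v₂≗w μ = trans (same-action v₂π₂ (represents-t-refl x y p≢q) π₂≗ μ) (sym (w≗ μ))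

  -- The curve neighbourhood

  i≤∣i∣ : ∀ i → i ≤ + ℤ.∣ i ∣
  i≤∣i∣ (+ _)      = ℤ.≤-refl
  i≤∣i∣ (ℤ.-[1+ _ ]) = ℤ.-≤+

  ≤Q-intro : ∀ {a b} → (∀ k → a ! k ≤ b ! k) → a ≤Q b
  ≤Q-intro {a} {b} a≤b i = subst₂ _≤_ (!-⌜⌝ a i) (!-⌜⌝ b i) (a≤b ⌜ i ⌝)

  ≤B-length : ∀ {u w k l} → u ≤B w → HasLength u k → HasLength w l → k ℕ.≤ l
  ≤B-length (equal u≗w) uk wl = ℕ.≤-reflexive (HasLength-unique (HasLength-cong u≗w uk) wl)
  ≤B-length (step u≤v _ _ vk′ wl′ k′<l′) uk wl = ℕ.≤-trans (≤B-length u≤v uk vk′)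
    (ℕ.≤-trans (ℕ.<⇒≤ k′<l′) (ℕ.≤-reflexive (HasLength-unique wl′ wl)))

  -- Every `step` strictly lengthens, so an upper element that is no longer than the lower one is
  -- reached without any step.
  ≤B-antisym-length : ∀ {u w k l} → u ≤B w → HasLength u k → HasLength w l → l ℕ.≤ k → u ≗ w
  ≤B-antisym-length (equal u≗w) _ _ _ = u≗w
  ≤B-antisym-length (step u≤v _ _ vk′ wl′ k′<l′) uk wl l≤k = contradiction
    (ℕ.≤-<-trans (≤B-length u≤v uk vk′) (ℕ.<-≤-trans k′<l′ (ℕ.≤-reflexive (HasLength-unique wl′ wl))))
    (ℕ.≤⇒≯ l≤k)

  -- Roots below c and their translations.

  t-cong : ∀ {x y x′ y′} → x ≋ x′ → y ≋ y′ → t[ root x y ] ≗ t[ root x′ y′ ]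
  t-cong {x} {y} {x′} {y′} x≋ y≋ μ = trans (sym (act-translation x y μ))
    (trans (act-cong (translation-cong x≋ y≋) μ) (act-translation x′ y′ μ))

  root-⊖c : ∀ x y → root x y ⊖ c ≡ root (x + 1ℤ * N) y
  root-⊖c x y = !-ext λ k → trans (⊖-! (root x y) c k) (trans
    (lia 5 (root x y ! k , c ! k , E x k , E y k , E (x + 1ℤ * N) k)
      (λ r c x y x′ → r :≡ x :- y , c :≡ # 1 , x′ :≡ x :- # 1 ⊢ r :- c :≡ x′ :- y)
      (root-! x y k) (c-! k) (E-shiftˡ x k 1ℤ))
    (sym (root-! (x + 1ℤ * N) y k)))

  t-≡ : ∀ {μ ν} → μ ≡ ν → t[ μ ] ≗ t[ ν ]
  t-≡ refl _ = refl

  -- Subtracting c replaces the first index by a congruent one, and translations see only classes.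
  -- So both families in the theorem are treated through `t[ β ]`.
  t-⊖c : ∀ {β x y} → β ≡ root x y → t[ β ⊖ c ] ≗ t[ β ]
  t-⊖c {β} {x} {y} β≡ μ = trans (t-≡ (trans (cong (_⊖ c) β≡) (root-⊖c x y)) μ)
    (trans (t-cong (≋-+N x 1ℤ) ≋-refl μ) (t-≡ (sym β≡) μ))

  E-+N : ∀ a k → E (a + N) k ≡ E a k - 1ℤ
  E-+N a k = trans (cong (λ z → E z k) (lia 2 (a , N) λ a N → ⊢ a :+ N :≡ a :+ # 1 :* N)) (E-shiftˡ a k 1ℤ)

  short-root<c : ∀ {i j} → i < j → j < i + N → root i j <Q c
  short-root<c {i} {j} i<j j<i+N = ≤Q-intro {root i j} {c} (λ k → lia 5 (root i j ! k , c ! k , E i k , E j k , E (i + N) k)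
      (λ r c e e′ e⁺ → r :≡ e :- e′ , c :≡ # 1 , e⁺ :≤ e′ , e⁺ :≡ e :- # 1 ⊢ r :≤ c)
      (root-! i j k) (c-! k) (E-anti k (ℤ.<⇒≤ j<i+N)) (E-+N i k)) ,
    λ eq → lia 2 (E i k₀ , E j k₀) (λ x y → x :- y :≡ # 1 , x :≤ -# 1 , -# 1 :≤ y ⊢ :⊥)
      (trans (sym (root-! i j k₀)) (trans (cong (_! k₀) eq) (c-! k₀)))
      (E≤-1 (lia 1 i λ i → ⊢ i :- # 1 :< i))
      (-1≤E (lia 3 (i , j , N) (λ i j N → j :< i :+ N ⊢ j :≤ i :- # 1 :+ N) j<i+N))
    where
    -- Just before `i` the root has coefficient 0, which tells it apart from c.
    k₀ : ℤ
    k₀ = i - 1ℤ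

  root<c⇒short : ∀ {i j} → ¬ i ≋ j → root i j <Q c → j < i + N
  root<c⇒short {i} {j} i≢j (≤c , _) = ℤ.≰⇒> λ i+N≤j →
    lia 4 (root i j ! i , c ! i , E i i , E j i) (λ r c x y → r :≤ c , r :≡ x :- y , c :≡ # 1 , x :≡ # 0 , y :< -# 1 ⊢ :⊥)
      (≤c (class i)) (root-! i j i) (c-! i) (E-self i)
      (E-< j i -1ℤ (lia 3 (i , j , N) (λ i j N → i :+ N :< j ⊢ i :< j :+ -# 1 :* N)
        (ℤ.≤∧≢⇒< i+N≤j λ eq → i≢j (≋-sym (≋-trans (≋-reflexive (sym eq))
          (1ℤ , lia 2 (i , N) λ i N → ⊢ i :+ N :≡ i :+ # 1 :* N))))))

  -- A pairing of 2 forces both ends to agree modulo n, since each delta is at most 1. The spans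
  -- `j - i` and `l - k` are then congruent and strictly between 0 and n, hence equal.
  short-roots-agree : ∀ {i j k l} → i < j → j < i + N → k < l → l < k + N →
    ⟨ root k l , root i j ⟩ ≡ ⟨ root i j , root i j ⟩ → root i j ≡ root k l
  short-roots-agree {i} {j} {k} {l} i<j j<i+N k<l l<k+N eq = by-cases (i ≋? k) (j ≋? l)
    where
    i≢j : ¬ i ≋ j
    i≢j = ≋-apart i<j j<i+N
    forms : (δ i k - δ i l) - (δ j k - δ j l) ≡ + 2
    forms = trans (sym (⟨root,root⟩ k l i j)) (trans eq (trans (⟨root,root⟩ i j i j)
      (cong₂ _-_ (cong₂ _-_ (δ-yes ≋-refl) (δ-no i≢j)) (cong₂ _-_ (δ-no (i≢j ∘ ≋-sym)) (δ-yes ≋-refl)))))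
    by-cases : Dec (i ≋ k) → Dec (j ≋ l) → root i j ≡ root k l
    by-cases (no i≢k) _ = ⊥-elim (lia 4 (δ i k , δ i l , δ j k , δ j l)
      (λ a b c d → (a :- b) :- (c :- d) :≡ # 2 , a :≡ # 0 , # 0 :≤ b , # 0 :≤ c , d :≤ # 1 ⊢ :⊥)
      forms (δ-no i≢k) (0≤δ i l) (0≤δ j k) (δ≤1 j l))
    by-cases (yes _) (no j≢l) = ⊥-elim (lia 4 (δ i k , δ i l , δ j k , δ j l)
      (λ a b c d → (a :- b) :- (c :- d) :≡ # 2 , d :≡ # 0 , # 0 :≤ b , # 0 :≤ c , a :≤ # 1 ⊢ :⊥)
      forms (δ-no j≢l) (0≤δ i l) (0≤δ j k) (δ≤1 i k))
    by-cases (yes i≋k@(r , i≡)) (yes (s , j≡)) = root-cong i≋k (≋-close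
      (s - r , lia 7 (i , j , k , l , r , s , N) (λ i j k l r s N → i :≡ k :+ r :* N , j :≡ l :+ s :* N ⊢
        j :- i :≡ l :- k :+ (s :- r) :* N) i≡ j≡)
      (lia 5 (i , j , k , l , N) (λ i j k l N → j :< i :+ N , k :< l ⊢ j :- i :< l :- k :+ N) j<i+N k<l)
      (lia 5 (i , j , k , l , N) (λ i j k l N → l :< k :+ N , i :< j ⊢ l :- k :< j :- i :+ N) l<k+N i<j))

  -- At `refl[ root a b ] ν` with `ν = root i j` the reflections cancel, and one coefficient of the
  -- result shows the pairing of each root with `ν`.
  t-injective : ∀ {i j k l a b} → ¬ a ≋ b → i < j → j < i + N → k < l → l < k + N →
    t[ root i j ] ∘ refl[ root a b ] ≗ t[ root k l ] ∘ refl[ root a b ] → root i j ≡ root k l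
  t-injective {i} {j} {k} {l} {a} {b} a≢b i<j j<i+N k<l l<k+N eq = short-roots-agree i<j j<i+N k<l l<k+N
      (lia 3 (ν ! 0ℤ , ⟨ root k l , ν ⟩ , ⟨ ν , ν ⟩) (λ z x y → z :- y :* # 1 :≡ z :- x :* # 1 ⊢ x :≡ y)
        (trans (sym (at (root i j))) (trans (cong (_! 0ℤ) same) (at (root k l)))))
    where
    ν : Qaff
    ν = root i j
    same : t[ root i j ] ν ≡ t[ root k l ] ν
    same = trans (cong t[ root i j ] (sym (refl-involutive a≢b ν))) (trans (eq (refl[ root a b ] ν)) (cong t[ root k l ] (refl-involutive a≢b ν)))
    at : ∀ β → t[ β ] ν ! 0ℤ ≡ ν ! 0ℤ - ⟨ β , ν ⟩ * 1ℤ
    at β = trans (⊖-! ν (⟨ β , ν ⟩ · c) 0ℤ) (cong (λ z → ν ! 0ℤ - z) (trans (·-! ⟨ β , ν ⟩ c 0ℤ) (cong (⟨ β , ν ⟩ *_) (c-! 0ℤ))))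

  -- The maximal elements and the roots that index them.

  module Neighbourhood (p q : ℤ) (p<q : p < q) (q<p+N : q < p + N) where
    open Raising p q p<q q<p+N using (p≢q; d; Terminal)
    open Climbing p q p<q q<p+N
    open Targets p q p<q q<p+N

    -- Translations depend on classes only; `end` is the representative of `y` for which
    -- `root x end` is positive and below c.
    record Arc (x y : ℤ) : Set where
      field
        end      : ℤ
        end≋y    : end ≋ y
        x<end    : x < end
        end<x+N  : end < x + N
        member   : root x end ∈ Πre⁺[ α ]

    arc : ∀ {x y} → Admissible x y → Arc x y
    arc {x} {y} (admissible q≤x x<p+N q<y y≤p+N x≢y) = by-cases (ℤ.<-cmp x y)
      where
      by-cases : Tri (x < y) (x ≡ y) (y < x) → Arc x y
      by-cases (tri≈ _ x≡y _) = contradiction (≋-reflexive x≡y) x≢y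
      -- The arc from `x` to `y` stays between `q` and `p + n`, the complement of α.
      by-cases (tri< x<y _ _) = record { end≋y = ≋-refl ; x<end = x<y ; end<x+N = y<x+N
          ; member = root⇒Πre⁺ x<y x≢y , short-root<c x<y y<x+N , inj₁ (≤Q-intro {root x y} {c ⊖ α} λ k →
              lia 9 (root x y ! k , (c ⊖ α) ! k , c ! k , α ! k , E x k , E y k , E p k , E q k , E (p + N) k)
                (λ r s c a x y p q p⁺ → r :≡ x :- y , s :≡ c :- a , c :≡ # 1 , a :≡ p :- q , x :≤ q , p⁺ :≤ y , p⁺ :≡ p :- # 1 ⊢ r :≤ s)
                (root-! x y k) (⊖-! c α k) (c-! k) (root-! p q k) (E-anti k q≤x) (E-anti k y≤p+N) (E-+N p k)) }
        where
        y<x+N : y < x + N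
        y<x+N = ℤ.≤-<-trans y≤p+N (ℤ.+-monoˡ-< N (ℤ.<-≤-trans p<q q≤x))
      -- The arc from `x` runs past `p + n` and `q + n` to `y + n`: it contains α and shares no end
      -- with it, whence orthogonality.
      by-cases (tri> _ _ y<x) = record { end≋y = +N≋ y ; x<end = x<y+N ; end<x+N = ℤ.+-monoˡ-< N y<x
          ; member = root⇒Πre⁺ x<y+N (x≢y ∘ λ e → ≋-trans e (+N≋ y)) , short-root<c x<y+N (ℤ.+-monoˡ-< N y<x) , inj₂ ((α≤ , α≢) , perpendicular) }
        where
        p<x : p < x
        p<x = ℤ.<-≤-trans p<q q≤x
        y<p+N : y < p + N
        y<p+N = ℤ.<-trans y<x x<p+N
        x<y+N : x < y + N
        x<y+N = ℤ.<-trans x<p+N (ℤ.+-monoˡ-< N (ℤ.<-trans p<q q<y))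
        q<x : q < x
        q<x = ℤ.<-trans q<y y<x
        α≤ : α ≤Q root x (y + N)
        α≤ = ≤Q-intro {α} {root x (y + N)} λ k →
          lia 8 (α ! k , root x (y + N) ! k , E x k , E y k , E (y + N) k , E p k , E q k , E (p + N) k)
            (λ a r x y y⁺ p q p⁺ → a :≡ p :- q , r :≡ x :- y⁺ , y⁺ :≡ y :- # 1 , p⁺ :≡ p :- # 1 , p⁺ :≤ x , y :≤ q ⊢ a :≤ r)
            (root-! p q k) (root-! x (y + N) k) (E-+N y k) (E-+N p k) (E-anti k (ℤ.<⇒≤ x<p+N)) (E-anti k (ℤ.<⇒≤ q<y))
        α≢ : α ≢ root x (y + N)
        α≢ eq = lia 4 (E p x , E q x , E x x , E (y + N) x)
          (λ p q x y → p :- q :≡ x :- y , p :≤ # 0 , # 0 :≤ q , x :≡ # 0 , y :≤ -# 1 ⊢ :⊥)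
          (trans (sym (root-! p q x)) (trans (cong (_! x) eq) (root-! x (y + N) x)))
          (E≤0 x<p+N) (0≤E q≤x) (E-self x) (E≤-1 x<y+N)
        perpendicular : root x (y + N) ⊥ α
        perpendicular = trans (⟨root,root⟩ x (y + N) p q) (cong₂ _-_
          (cong₂ _-_ (δ-no (≋-apart p<x x<p+N)) (δ-no λ e → ≋-apart (ℤ.<-trans p<q q<y) y<p+N (≋-trans e (+N≋ y))))
          (cong₂ _-_ (δ-no (≋-apart q<x (ℤ.<-trans x<p+N (ℤ.+-monoˡ-< N p<q))))
            (δ-no λ e → ≋-apart q<y (ℤ.<-trans y<p+N (ℤ.+-monoˡ-< N p<q)) (≋-trans e (+N≋ y)))))

    target-arc : ∀ {x y} (a : Arc x y) → target x y ≗ t[ root x (Arc.end a) ] ∘ refl[ α ]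
    target-arc a μ = t-cong ≋-refl (≋-sym (Arc.end≋y a)) (refl[ α ] μ)

    target∈Reachable : ∀ {x y w} → Admissible x y → w ≗ target x y → w ∈ Reachable (c ⊕ α) id
    target∈Reachable adm w≗ = reachable-target p<q p≢q x<end end<x+N λ μ → trans (w≗ μ) (target-arc (arc adm) μ)
      where open Arc (arc adm)

    -- The chain enters only through its flow bound; climbing under that bound can stop only at a
    -- target.
    reachable-below-target : ∀ {v} → v ∈ Reachable (c ⊕ α) id → ∃₂ λ x y → Admissible x y × v ≤B target x y
    reachable-below-target {v} (v∈W , u , _ , u≤id , π , degree≤) = from-flow (chain-flow π (≤B-id u≤id))
      where
      degree≤d : ∀ k → degree π ! k ≤ d k
      degree≤d k = ℤ.≤-trans (degree≤ (class k)) (ℤ.≤-reflexive (trans (⊕-! c α k) (cong₂ _+_ (c-! k) (root-! p q k))))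
      from-top : Climb v → ∃₂ λ x y → Admissible x y × v ≤B target x y
      from-top record { top = top ; π = π ; u≤top = v≤top ; topπ = topπ ; final = final } =
          x , y , admissible q≤x x<p+N q<y y≤p+N x≢y , ≤B-cong v≤top (same-action topπ (represents-t-refl x y p≢q) to≗)
        where
        open Terminal final
        ≤B-cong : ∀ {u w w′} → u ≤B w → w ≗ w′ → u ≤B w′
        ≤B-cong (equal u≗w) w≗w′ = equal λ μ → trans (u≗w μ) (w≗w′ μ)
        ≤B-cong (step u≤v β∈ w≗ vk wl k<l) w≗w′ =
          step u≤v β∈ (λ μ → trans (sym (w≗w′ μ)) (w≗ μ)) vk (HasLength-cong w≗w′ wl) k<l
      from-flow : (∃ λ σ → Represents v σ × Balanced σ × (∀ k → flow σ k ≤ degree π ! k)) →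
        ∃₂ λ x y → Admissible x y × v ≤B target x y
      from-flow (σ , vσ , bal , flow≤) = from-top (climb (suc ℕ.zero ℕ.+ ℤ.∣ gap ∣)
          (ℤ.≤-<-trans (i≤∣i∣ gap) (ℤ.+<+ ℕ.≤-refl)) (equal λ _ → refl) v∈W vσ bal λ k → ℤ.≤-trans (flow≤ k) (degree≤d k))
        where
        gap : ℤ
        gap = N * (+ 4 * N * N) - energy σ

    -- A reachable element above a target is caught between it and a second target. All targets have
    -- the same length, so the element is no longer than the first and equals it.
    target∈Γ : ∀ {x y w} → Admissible x y → w ≗ target x y → w ∈ Γ (c ⊕ α) id
    target∈Γ {w = w} adm w≗ = target∈Reachable adm w≗ , λ v v∈R w≤v →
      let x′ , y′ , adm′ , v≤target = reachable-below-target v∈R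
          l , vl = hasLength (proj₁ v∈R)
      in ≤B-antisym-length w≤v (target-length adm w≗) vl (≤B-length v≤target vl (target-length adm′ λ _ → refl))

    Γ⇒target : ∀ {w} → w ∈ Γ (c ⊕ α) id → ∃₂ λ x y → Admissible x y × w ≗ target x y
    Γ⇒target (w∈R , maximal) =
      let x , y , adm , w≤target = reachable-below-target w∈R
      in x , y , adm , maximal (target x y) (target∈Reachable adm λ _ → refl) w≤target

    record Member (β : Qaff) : Set where
      field
        {x y i j} : ℤ
        adm     : Admissible x y
        i<j     : i < j
        j<i+N   : j < i + N
        i≋x     : i ≋ x
        j≋y     : j ≋ y
        β≡root  : β ≡ root i j

    -- The converse of `arc`. Up to classes β starts at `x` and ends at `y`: its coefficients are 1
    -- at `x` and `y - 1`, but 0 at `x - 1` and `y`. A wrong position of `x` or `y` contradicts the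
    -- condition on β at one of these four places or, when β starts at `p` or ends at `q`, by a
    -- positive pairing with α.
    member : ∀ {β} → β ∈ Πre⁺[ α ] → Member β
    member {β} (β∈ , β<c , condition) = from-root (Πre⁺⇒root β∈)
      where
      from-root : Positive-root β → Member β
      from-root (positive-root i j i<j i≢j β≡) =
        let x , i≋x , p≤x , x<p+N = representative p i
            y , j≋y , p<y , y<p+1+N = representative (p + 1ℤ) j
        in from-representatives i≋x p≤x x<p+N j≋y p<y y<p+1+N
        where
        j<i+N : j < i + N
        j<i+N = root<c⇒short i≢j (subst (_<Q c) β≡ β<c)
        from-representatives : ∀ {x y} → i ≋ x → p ≤ x → x < p + N →
          j ≋ y → p + 1ℤ ≤ y → y < p + 1ℤ + N → Member β
        from-representatives {x} {y} i≋x@(r , i≡) p≤x x<p+N j≋y@(s , j≡) p+1≤y y<p+1+N = record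
          { adm = admissible (ℤ.≮⇒≥ (¬x<q condition)) x<p+N (ℤ.≰⇒> (¬y≤q condition))
                    (lia 3 (p , y , N) (λ p y N → y :< p :+ # 1 :+ N ⊢ y :≤ p :+ N) y<p+1+N)
                    (λ x≋y → i≢j (≋-trans i≋x (≋-trans x≋y (≋-sym j≋y))))
          ; i<j = i<j ; j<i+N = j<i+N ; i≋x = i≋x ; j≋y = j≋y ; β≡root = β≡ }
          where
          β-! : ∀ k → β ! k ≡ E i k - E j k
          β-! k = trans (cong (_! k) β≡) (root-! i j k)
          α-! : ∀ k → α ! k ≡ E p k - E q k
          α-! = root-! p q
          α-inside : ∀ {k} → p ≤ k → k < q → 1ℤ ≤ α ! k
          α-inside {k} p≤k k<q = lia 3 (α ! k , E p k , E q k) (λ a x y → a :≡ x :- y , # 0 :≤ x , y :≤ -# 1 ⊢ # 1 :≤ a)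
            (α-! k) (0≤E p≤k) (E≤-1 k<q)
          disjoint : ∀ {k} → β ≤Q c ⊖ α → p ≤ k → k < q → ¬ 1ℤ ≤ β ! k
          disjoint {k} β≤c-α p≤k k<q 1≤β = lia 4 (β ! k , α ! k , c ! k , (c ⊖ α) ! k)
            (λ b a c s → b :≤ s , s :≡ c :- a , c :≡ # 1 , # 1 :≤ a , # 1 :≤ b ⊢ :⊥)
            (β≤c-α (class k)) (⊖-! c α k) (c-! k) (α-inside p≤k k<q) 1≤β
          covered : ∀ {k} → α <Q β → p ≤ k → k < q → ¬ β ! k ≤ 0ℤ
          covered {k} (α≤β , _) p≤k k<q β≤0 = lia 2 (β ! k , α ! k) (λ b a → a :≤ b , # 1 :≤ a , b :≤ # 0 ⊢ :⊥)
            (α≤β (class k)) (α-inside p≤k k<q) β≤0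
          form : β ⊥ α → (δ p i - δ p j) - (δ q i - δ q j) ≡ 0ℤ
          form β⊥α = trans (sym (⟨root,root⟩ i j p q)) (trans (cong ⟨_, α ⟩ (sym β≡)) β⊥α)

          ¬x<q : β ≤Q c ⊖ α ⊎ (α <Q β × β ⊥ α) → ¬ x < q
          ¬x<q (inj₁ β≤c-α) x<q = disjoint β≤c-α p≤x x<q (lia 4 (β ! x , E i x , E j x , r)
            (λ b e e′ r → b :≡ e :- e′ , neg r :≤ e , e′ :< neg r ⊢ # 1 :≤ b) (β-! x)
            (E-≥ i x (- r) (lia 4 (i , x , r , N) (λ i x r N → i :≡ x :+ r :* N ⊢ i :+ neg r :* N :≤ x) i≡))
            (E-< j x (- r) (lia 5 (i , j , x , r , N) (λ i j x r N → i :≡ x :+ r :* N , i :< j ⊢ x :< j :+ neg r :* N) i≡ i<j)))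
          ¬x<q (inj₂ (α<β , β⊥α)) x<q with p ℤ.≟ x
          ... | yes refl = lia 4 (δ p i , δ p j , δ q i , δ q j)
                (λ a b c d → (a :- b) :- (c :- d) :≡ # 0 , a :≡ # 1 , b :≡ # 0 , c :≡ # 0 , # 0 :≤ d ⊢ :⊥)
                (form β⊥α) (δ-yes (≋-sym i≋x)) (δ-no λ p≋j → i≢j (≋-trans i≋x p≋j)) (δ-no λ q≋i → p≢q (≋-sym (≋-trans q≋i i≋x))) (0≤δ q j)
          ... | no p≢x = covered {x - 1ℤ} α<β (lia 2 (p , x) (λ p x → p :< x ⊢ p :≤ x :- # 1) (ℤ.≤∧≢⇒< p≤x p≢x))
                (lia 2 (x , q) (λ x q → x :< q ⊢ x :- # 1 :< q) x<q)
                (lia 4 (β ! (x - 1ℤ) , E i (x - 1ℤ) , E j (x - 1ℤ) , r)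
                  (λ b e e′ r → b :≡ e :- e′ , e :< neg r , neg r :- # 1 :≤ e′ ⊢ b :≤ # 0) (β-! (x - 1ℤ))
                  (E-< i (x - 1ℤ) (- r) (lia 4 (i , x , r , N) (λ i x r N → i :≡ x :+ r :* N ⊢ x :- # 1 :< i :+ neg r :* N) i≡))
                  (E-≥ j (x - 1ℤ) (- r - 1ℤ) (lia 5 (i , j , x , r , N)
                    (λ i j x r N → i :≡ x :+ r :* N , j :< i :+ N ⊢ j :+ (neg r :- # 1) :* N :≤ x :- # 1) i≡ j<i+N)))

          ¬y≤q : β ≤Q c ⊖ α ⊎ (α <Q β × β ⊥ α) → ¬ y ≤ q
          ¬y≤q (inj₁ β≤c-α) y≤q = disjoint {y - 1ℤ} β≤c-α (lia 2 (p , y) (λ p y → p :+ # 1 :≤ y ⊢ p :≤ y :- # 1) p+1≤y)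
            (lia 2 (y , q) (λ y q → y :≤ q ⊢ y :- # 1 :< q) y≤q)
            (lia 4 (β ! (y - 1ℤ) , E i (y - 1ℤ) , E j (y - 1ℤ) , s)
              (λ b e e′ s → b :≡ e :- e′ , neg s :≤ e , e′ :< neg s ⊢ # 1 :≤ b) (β-! (y - 1ℤ))
              (E-≥ i (y - 1ℤ) (- s) (lia 5 (i , j , y , s , N) (λ i j y s N → j :≡ y :+ s :* N , i :< j ⊢ i :+ neg s :* N :≤ y :- # 1) j≡ i<j))
              (E-< j (y - 1ℤ) (- s) (lia 4 (j , y , s , N) (λ j y s N → j :≡ y :+ s :* N ⊢ y :- # 1 :< j :+ neg s :* N) j≡)))
          ¬y≤q (inj₂ (α<β , β⊥α)) y≤q with y ℤ.≟ q
          ... | yes refl = lia 4 (δ p i , δ p j , δ q i , δ q j)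
                (λ a b c d → (a :- b) :- (c :- d) :≡ # 0 , d :≡ # 1 , b :≡ # 0 , c :≡ # 0 , # 0 :≤ a ⊢ :⊥)
                (form β⊥α) (δ-yes (≋-sym j≋y)) (δ-no λ p≋j → p≢q (≋-trans p≋j j≋y)) (δ-no λ q≋i → i≢j (≋-sym (≋-trans j≋y q≋i))) (0≤δ p i)
          ... | no y≢q = covered {y} α<β (lia 2 (p , y) (λ p y → p :+ # 1 :≤ y ⊢ p :≤ y) p+1≤y) (ℤ.≤∧≢⇒< y≤q y≢q)
                (lia 4 (β ! y , E i y , E j y , s) (λ b e e′ s → b :≡ e :- e′ , e :< neg s :+ # 1 , neg s :≤ e′ ⊢ b :≤ # 0) (β-! y)
                  (E-< i y (- s + 1ℤ) (lia 5 (i , j , y , s , N)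
                    (λ i j y s N → j :≡ y :+ s :* N , j :< i :+ N ⊢ y :< i :+ (neg s :+ # 1) :* N) j≡ j<i+N))
                  (E-≥ j y (- s) (lia 4 (j , y , s , N) (λ j y s N → j :≡ y :+ s :* N ⊢ j :+ neg s :* N :≤ y) j≡)))

    translated : Qaff → Endo
    translated β = t[ β ] ∘ refl[ α ]

    translated-⊖c : ∀ {β} → β ∈ Πre⁺[ α ] → t[ β ⊖ c ] ∘ refl[ α ] ≗ translated β
    translated-⊖c β∈ μ = t-⊖c β≡root (refl[ α ] μ)
      where open Member (member β∈)

    translated∈Γ : ∀ {β w} → β ∈ Πre⁺[ α ] → w ≗ translated β → w ∈ Γ (c ⊕ α) id
    translated∈Γ β∈ w≗ = target∈Γ adm λ μ → trans (w≗ μ) (trans (t-≡ β≡root (refl[ α ] μ)) (t-cong i≋x j≋y (refl[ α ] μ)))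
      where open Member (member β∈)

    Γ⇒translated : ∀ {w} → w ∈ Γ (c ⊕ α) id → ∃ λ β → β ∈ Πre⁺[ α ] × w ≗ translated β
    Γ⇒translated w∈Γ =
      let x , y , adm , w≗ = Γ⇒target w∈Γ
          open Arc (arc adm) using (end) renaming (member to β∈)
      in root x end , β∈ , λ μ → trans (w≗ μ) (target-arc (arc adm) μ)

    translated-injective : ∀ {β γ} → β ∈ Πre⁺[ α ] → γ ∈ Πre⁺[ α ] → translated β ≗ translated γ → β ≡ γ
    translated-injective {β} {γ} β∈ γ∈ eq = trans β₁.β≡root (trans
        (t-injective p≢q β₁.i<j β₁.j<i+N γ₁.i<j γ₁.j<i+N λ μ →
          trans (t-≡ (sym β₁.β≡root) (refl[ α ] μ)) (trans (eq μ) (t-≡ γ₁.β≡root (refl[ α ] μ))))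
        (sym γ₁.β≡root))
      where
      module β₁ = Member (member β∈)
      module γ₁ = Member (member γ∈)

    Γ⇔ : ∀ w → w ∈ Γ (c ⊕ α) id ⇔
      ((∃[ β′ ] (β′ ∈ Πre⁺[ α ] × 0ᵢ ∉ supp β′ × w ≗ t[ β′ ] ∘ refl[ α ]))
      ⊎ (∃[ β′ ] (β′ ∈ Πre⁺[ α ] × 0ᵢ ∈ supp β′ × w ≗ t[ β′ ⊖ c ] ∘ refl[ α ])))
    Γ⇔ w = mk⇔ forth back
      where
      forth : w ∈ Γ (c ⊕ α) id → _
      forth w∈Γ =
        let β , β∈ , w≗ = Γ⇒translated w∈Γ
        in by-support β β∈ w≗ (lookup β 0ᵢ ℤ.≟ 0ℤ)
        where
        by-support : ∀ β → β ∈ Πre⁺[ α ] → w ≗ translated β → Dec (lookup β 0ᵢ ≡ 0ℤ) →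
          ((∃[ β′ ] (β′ ∈ Πre⁺[ α ] × 0ᵢ ∉ supp β′ × w ≗ t[ β′ ] ∘ refl[ α ]))
          ⊎ (∃[ β′ ] (β′ ∈ Πre⁺[ α ] × 0ᵢ ∈ supp β′ × w ≗ t[ β′ ⊖ c ] ∘ refl[ α ])))
        by-support β β∈ w≗ (yes β₀≡0) = inj₁ (β , β∈ , (λ β₀≢0 → β₀≢0 β₀≡0) , w≗)
        by-support β β∈ w≗ (no β₀≢0)  = inj₂ (β , β∈ , β₀≢0 , λ μ → trans (w≗ μ) (sym (translated-⊖c β∈ μ)))
      back : _ → w ∈ Γ (c ⊕ α) id
      back (inj₁ (β , β∈ , _ , w≗)) = translated∈Γ β∈ w≗
      back (inj₂ (β , β∈ , _ , w≗)) = translated∈Γ β∈ λ μ → trans (w≗ μ) (translated-⊖c β∈ μ)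

    Γ↔Πre⁺ : Bijection (ΓSetoid (c ⊕ α) id) (Πre⁺Setoid α)
    Γ↔Πre⁺ = record
      { to = λ (w , w∈Γ) → let β , β∈ , _ = Γ⇒translated w∈Γ in β , β∈
      ; cong = λ { {w , w∈Γ} {v , v∈Γ} w≗v →
          let β , β∈ , w≗ = Γ⇒translated w∈Γ
              γ , γ∈ , v≗ = Γ⇒translated v∈Γ
          in translated-injective β∈ γ∈ λ μ → trans (sym (w≗ μ)) (trans (w≗v μ) (v≗ μ)) }
      ; bijective =
          (λ { {w , w∈Γ} {v , v∈Γ} β≡γ μ →
            let β , β∈ , w≗ = Γ⇒translated w∈Γ
                γ , γ∈ , v≗ = Γ⇒translated v∈Γ
            in trans (w≗ μ) (trans (t-≡ β≡γ (refl[ α ] μ)) (sym (v≗ μ))) }) ,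
          λ { (β , β∈) → (translated β , translated∈Γ β∈ λ _ → refl) ,
            λ { {w , w∈Γ} w≗ → let γ , γ∈ , w≗γ = Γ⇒translated w∈Γ
              in translated-injective γ∈ β∈ λ μ → trans (sym (w≗γ μ)) (w≗ μ) } }
      }

    Γ-length : ∀ w → w ∈ Γ (c ⊕ α) id → HasLength w (2 ℕ.* (n ℕ.∸ 1) ℕ.+ m)
    Γ-length w w∈Γ = let _ , _ , adm , w≗ = Γ⇒target w∈Γ in target-length adm w≗

open import Data.Nat.Base using (_≤_; _+_; _*_; _∸_)

theorem1p10 : (n : ℕ) (n≥3 : 3 ≤ n) → let open Affine n n≥3 in
    ∀ α → α ∈ Πre⁺ → α <Q c →
    (∀ w → w ∈ Γ (c ⊕ α) id ⇔
    ((∃[ β′ ] (β′ ∈ Πre⁺[ α ] × 0ᵢ ∉ supp β′ × w ≗ t[ β′ ] ∘ refl[ α ]))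
    ⊎ (∃[ β′ ] (β′ ∈ Πre⁺[ α ] × 0ᵢ ∈ supp β′ × w ≗ t[ β′ ⊖ c ] ∘ refl[ α ]))))
    × Bijection (ΓSetoid (c ⊕ α) id) (Πre⁺Setoid α)
    × (∃[ m ] (HasLength refl[ α ] m
    × (∀ w → w ∈ Γ (c ⊕ α) id → HasLength w (2 * (n ∸ 1) + m))))
theorem1p10 n n≥3 _ α∈ α<c with AffineWeylGroup.Πre⁺⇒root n n≥3 α∈
... | AffineWeylGroup.positive-root p q p<q p≢q refl =
    Γ⇔ , Γ↔Πre⁺ , proj₁ reflection-length , proj₂ reflection-length , Γ-length
  where
  open AffineWeylGroup n n≥3
  -- `α < c` enters here, as the bound on the span of α on which the flow bound of at most 2 rests.
  q<p+N : q ℤ.< p ℤ.+ N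
  q<p+N = root<c⇒short p≢q α<c
  open Targets p q p<q q<p+N using (reflection-length)
  open Neighbourhood p q p<q q<p+N using (Γ⇔; Γ↔Πre⁺; Γ-length)
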